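{- Let $T$ be a spider with bipartition $X$ and $Y$, and let $t=\max\{|X|,|Y|\}$. Then every $3$-connected bipartite graph $G$ with minimum degree $\delta(G)\geq t+3$ contains a subgraph $T'$ that is a spider isomorphic to $T$ and such that $G-V(T')$ is still $3$-connected.
   Context: All graphs are finite and undirected, without loops or multiple edges. $\delta(G)$ is the minimum degree of $G$. For $S\subseteq V(G)$, $G-S$ is the graph obtained from $G$ by deleting the vertices of $S$ (and all incident edges). The connectivity $\kappa(G)$ is the minimum size of a vertex set $S$ such that $G-S$ is disconnected or has only one vertex; $G$ is $k$-connected if $\kappa(G)\geq k$. A spider is a tree with at most one vertex of degree more than $2$. The bipartition $X,Y$ of a tree is its partition into two independent sets. -}

module Defs where

open import Data.Fin using (Fin; zero; suc; inject₁; fromℕ)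
open import Data.Fin.Subset using (Subset; _∈_; _∉_; _⊆_; _∪_; _∩_; _─_; ⊥; ∣_∣; Nonempty)
open import Data.Fin.Subset.Properties using (_∈?_; x∈p∧x∉q⇒x∈p─q)
open import Data.Nat using (ℕ; _+_; _≤_; _<_)
open import Data.Product using (∃; ∃-syntax; _×_; _,_; proj₁)
open import Data.Sum using (_⊎_)
open import Data.Vec using (allFin; count)
open import Function.Base using (_∘_)
open import Function.Bundles using (_↔_; _⇔_; Inverse)
open import Function.Definitions using (Injective)
open import Level using (0ℓ)
open import Relation.Binary.Core using (Rel; _⇒_)
open import Relation.Binary.Construct.Closure.ReflexiveTransitive using (Star)
open import Relation.Binary.Definitions using (Decidable; Symmetric; Irreflexive)
open import Relation.Binary.PropositionalEquality using (_≡_)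
open import Relation.Nullary using (¬_)
open import Relation.Nullary.Decidable using (_×-dec_; ¬?)

-- Finite simple graphs whose vertex set is a subset of the ambient set Fin n.
-- The ambient set lets a graph, its subgraphs and its vertex-deleted subgraphs
-- share one type; every finite graph arises, e.g. with V = ⊤.
record Graph (n : ℕ) : Set₁ where
  field
    V        : Subset n
    Adj      : Rel (Fin n) 0ℓ
    adj?     : Decidable Adj
    symm     : Symmetric Adj
    loopless : Irreflexive _≡_ Adj
    adj⇒∈V   : ∀ {u v} → Adj u v → u ∈ V

open Graph public

Vertex : ∀ {n} → Graph n → Set
Vertex G = ∃[ v ] v ∈ V G

degree : ∀ {n} → Graph n → Fin n → ℕ
degree {n} G v = count (adj? G v) (allFin n)

infixl 6 _∖_

_∖_ : ∀ {n} → Graph n → Subset n → Graph n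
G ∖ S = record
  { V        = V G ─ S
  ; Adj      = λ u v → Adj G u v × u ∉ S × v ∉ S
  ; adj?     = λ u v → adj? G u v ×-dec ¬? (u ∈? S) ×-dec ¬? (v ∈? S)
  ; symm     = λ (a , u∉S , v∉S) → symm G a , v∉S , u∉S
  ; loopless = λ u≡v → loopless G u≡v ∘ proj₁
  ; adj⇒∈V   = λ (a , u∉S , _) → x∈p∧x∉q⇒x∈p─q (adj⇒∈V G a) u∉S
  }

IsMinimum : (ℕ → Set) → ℕ → Set
IsMinimum P m = P m × (∀ k → P k → m ≤ k)

-- IsMinDegree G d says δ(G) = d.
IsMinDegree : ∀ {n} → Graph n → ℕ → Set
IsMinDegree G = IsMinimum λ d → ∃[ v ] v ∈ V G × degree G v ≡ d

Connected : ∀ {n} → Graph n → Set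
Connected G = Nonempty (V G) × (∀ {u v} → u ∈ V G → v ∈ V G → Star (Adj G) u v)

Disconnected : ∀ {n} → Graph n → Set
Disconnected G = ∃[ u ] ∃[ v ] u ∈ V G × v ∈ V G × ¬ Star (Adj G) u v

-- IsConnectivity G c says κ(G) = c.
IsConnectivity : ∀ {n} → Graph n → ℕ → Set
IsConnectivity G = IsMinimum λ c → ∃[ S ]
  S ⊆ V G × ∣ S ∣ ≡ c × (Disconnected (G ∖ S) ⊎ ∣ V (G ∖ S) ∣ ≡ 1)

-- The minimum defining κ must be attained, so the graph with no vertices is
-- not k-connected for any k.
KConnected : ∀ {n} → ℕ → Graph n → Set
KConnected k G = ∃[ c ] IsConnectivity G c × k ≤ c

record Cycle {n} (G : Graph n) : Set where
  field
    k         : ℕ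
    vertex    : Fin (3 + k) → Fin n
    injective : Injective _≡_ _≡_ vertex
    step      : ∀ i → Adj G (vertex (inject₁ i)) (vertex (suc i))
    close     : Adj G (vertex (fromℕ (2 + k))) (vertex zero)

IsTree : ∀ {n} → Graph n → Set
IsTree G = Connected G × ¬ Cycle G

IsSpider : ∀ {n} → Graph n → Set
IsSpider G = IsTree G ×
  (∀ {u v} → u ∈ V G → v ∈ V G → 2 < degree G u → 2 < degree G v → u ≡ v)

Independent : ∀ {n} → Graph n → Subset n → Set
Independent G S = ∀ {u v} → u ∈ S → v ∈ S → ¬ Adj G u v

-- A part may be empty, as in the bipartition of the one-vertex tree.
record IsBipartition {n} (G : Graph n) (X Y : Subset n) : Set where
  field
    cover        : X ∪ Y ≡ V G
    disjoint     : X ∩ Y ≡ ⊥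
    independentˡ : Independent G X
    independentʳ : Independent G Y

Bipartite : ∀ {n} → Graph n → Set
Bipartite G = ∃[ X ] ∃[ Y ] IsBipartition G X Y

infix 4 _IsSubgraphOf_ _≅_

_IsSubgraphOf_ : ∀ {n} → Graph n → Graph n → Set
H IsSubgraphOf G = V H ⊆ V G × Adj H ⇒ Adj G

-- Equality in Vertex G is equality of the underlying elements of Fin n,
-- because proofs of membership in a Subset are unique.
record _≅_ {m n} (G : Graph m) (H : Graph n) : Set where
  field
    bijection : Vertex G ↔ Vertex H
  open Inverse bijection using (to)
  field
    adj⇔ : ∀ u v → Adj G (proj₁ u) (proj₁ v) ⇔ Adj H (proj₁ (to u)) (proj₁ (to v))

-- Suppose that no copy of T leaves a 3-connected rest.  Among the pairs U ⊆ B such that no two vertices separate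
-- two vertices of U in G[B] and Z = V(G) - B contains a copy of T, choose one with |U| maximal and then |B| minimal.
-- Then B - U falls into the interiors of paths between two vertices of U, and a vertex of Z avoided by some copy in Z
-- has at most two neighbours in B.  As T is a spider, a copy that does not fill Z can be rerouted along its legs, or
-- rebuilt around another centre, so as to avoid any given vertex of Z.  So all of Z sends few edges to B, and T still
-- embeds greedily in Z after the removal of a shortest path that attaches the interior of one of those paths (or, if
-- B = U, a shortest path in Z between two vertices of U) to the rest of B.  That path creates a vertex joined to U
-- by three disjoint paths, against the maximality of U.  To start, remove any copy of T and take for U a smallest
-- vertex set with at most two neighbours.  All this is classical and takes place under the double negation NN; the
-- subgraph itself is found by finite search at the end.
module Submission where

open import Data.Bool using (Bool; true; false; not)
open import Data.Bool.Properties using () renaming (_≟_ to _≟B_)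
open import Data.Empty using (⊥; ⊥-elim)
open import Data.Fin using (Fin; zero; suc; inject₁; fromℕ)
open import Data.Fin.Properties using (any?; all?) renaming (_≟_ to _≟F_)
open import Data.Fin.Subset using (Subset; Nonempty; ∣_∣; _─_; _∪_; _∩_; ⁅_⁆) renaming (_∈_ to _∈ˢ_; _∉_ to _∉ˢ_; _⊆_ to _⊆ˢ_; _-_ to _-ˢ_)
open import Data.Fin.Subset.Properties using (_⊆?_; nonempty?; anySubset?; x∈⁅x⁆; x∈⁅y⁆⇒x≡y; ∣⁅x⁆∣≡1; ⊆-antisym; p─q⊆p; x∈p∧x≢y⇒x∈p-y; x∈p⇒∣p-x∣<∣p∣; x∈p∩q⁺; x∈p∩q⁻; x∈p∪q⁺; x∈p∪q⁻) renaming (_∈?_ to _∈ˢ?_; x∈p∧x∉q⇒x∈p─q to ∈-─)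
open import Data.List using (List; []; _∷_; _++_; length; lookup; map; filter; tabulate; take; allFin)
open import Data.List.Membership.Propositional using (_∈_; _∉_)
open import Data.List.Membership.Propositional.Properties using (∈-++⁺ˡ; ∈-++⁺ʳ; ∈-++⁻; ∈-∃++; ∈-filter⁺; ∈-filter⁻; ∈-allFin; ∈-map⁺; ∈-map⁻)
open import Data.List.Properties using (length-++; length-map; map-++; ++-assoc; ++-identityʳ; ∷-injective; ∷-injectiveʳ)
open import Data.List.Relation.Unary.All using ([]; _∷_)
open import Data.List.Relation.Unary.All.Properties using (¬Any⇒All¬; All¬⇒¬Any)
open import Data.List.Relation.Unary.AllPairs using ([]; _∷_)
open import Data.List.Relation.Unary.Any using (here; there)
open import Data.List.Relation.Unary.Unique.Propositional using (Unique)
open import Data.List.Relation.Unary.Unique.Propositional.Properties using (allFin⁺) renaming (++⁺ to unique-++⁺; filter⁺ to unique-filter⁺)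
open import Data.Nat using (ℕ; zero; suc; _+_; _∸_; _⊔_; _≤_; _<_; _≥_; z≤n; s≤s)
open import Data.Nat.Induction using (<-rec)
open import Data.Nat.Properties
open import Data.Product using (∃; ∃₂; ∃-syntax; _×_; _,_; proj₁; proj₂)
open import Data.Sum using (_⊎_; inj₁; inj₂; [_,_]′)
open import Data.Unit using (⊤; tt)
import Data.Vec as Vec
import Data.Vec.Properties as Vec
open import Function.Base using (_∘_; case_of_)
open import Function.Bundles using (mk↔ₛ′; mk⇔)
open import Relation.Binary.Construct.Closure.ReflexiveTransitive using (Star; ε; _◅_; _◅◅_)
open import Relation.Binary.PropositionalEquality using (_≡_; _≢_; refl; sym; trans; cong; cong₂; subst; subst₂; ≢-sym)
open import Relation.Nullary using (¬_; Dec; yes; no)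
open import Relation.Nullary.Decidable using (_×-dec_; _⊎-dec_; _→-dec_; ¬?; does; dec-true; dec-false; map′)

-- Why the degree bound is `t + 3`: all neighbours of a vertex have the other colour, and a copy has
-- at most `t` vertices of each colour. A vertex with at most two neighbours in `B` keeps `t + 1` in
-- `Z` and so has a neighbour outside every copy; rerouting lives on this single spare neighbour.
-- Once a path has been added to `B` the loss may be three, and the remaining `t` are just enough
-- for a greedy embedding, since the vertex about to be placed is itself one of the at most `t` of
-- its colour. The obstacle is a circle: the bound of two is available only for a vertex that some
-- copy avoids, as only then can the vertex be added to `B` while a copy remains; but rerouting,
-- which produces such copies, already needs spare neighbours. So avoidance is spread outwards from
-- vertices known to be avoided, and only those prefixes of legs stay locked that are not yet known
-- to be avoidable. Rerouting never moves the centre, which is why a copy with another centre has to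
-- be built.

NN : Set → Set
NN A = ¬ ¬ A

pure : ∀ {A} → A → NN A
pure a k = k a

infixl 1 _>>=_ _>>_
_>>=_ : ∀ {A B} → NN A → (A → NN B) → NN B
(m >>= f) k = m λ a → f a k

_>>_ : ∀ {A B} → NN A → NN B → NN B
m >> n = m >>= λ _ → n

em : ∀ P → NN (P ⊎ ¬ P)
em P k = k (inj₂ (k ∘ inj₁))

em-dec : ∀ P → NN (Dec P)
em-dec P k = k (no (k ∘ yes))

absurd : ∀ {A : Set} → ⊥ → NN A
absurd ()

by-contra : ∀ {A} → (¬ A → NN ⊥) → NN A
by-contra h k = h k (λ x → x)

run : NN ⊥ → ⊥
run m = m (λ x → x)

-- The double negation shift, available here because the quantifier ranges over a finite set.
commute-Fin : ∀ n {P : Fin n → Set} → (∀ i → NN (P i)) → NN (∀ i → P i)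
commute-Fin zero    h = pure λ ()
commute-Fin (suc n) h = do
  p ← h zero
  q ← commute-Fin n (h ∘ suc)
  pure λ { zero → p ; (suc i) → q i }

decide : ∀ {n} (P : Fin n → Set) → NN (∀ i → Dec (P i))
decide P = commute-Fin _ (em-dec ∘ P)

minimal : ∀ {A : Set} (P : A → Set) (μ : A → ℕ) → ∃ P → NN (∃[ a ] P a × (∀ b → P b → μ a ≤ μ b))
minimal {A} P μ (a₀ , p₀) = go (μ a₀) a₀ p₀ refl
  where
  Goal : Set
  Goal = ∃[ a ] P a × (∀ b → P b → μ a ≤ μ b)
  go : ∀ m a → P a → μ a ≡ m → NN Goal
  go = <-rec (λ m → ∀ a → P a → μ a ≡ m → NN Goal) λ
    { m rec a p refl → do
        d ← em (∃[ b ] P b × μ b < μ a)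
        case d of λ
          { (inj₁ (b , q , b<a)) → rec b<a b q refl
          ; (inj₂ none) → pure (a , p , λ b q → ≮⇒≥ λ b<a → none (b , q , b<a)) } }

maximal : ∀ {A : Set} (P : A → Set) (μ : A → ℕ) (N : ℕ) → (∀ a → P a → μ a ≤ N) → ∃ P →
  NN (∃[ a ] P a × (∀ b → P b → μ b ≤ μ a))
maximal P μ N bd p = do
  (a , pa , mn) ← minimal P (λ a → N ∸ μ a) p
  pure (a , pa , λ b pb → ≮⇒≥ λ a<b → <⇒≱ (∸-monoʳ-< a<b (bd b pb)) (mn b pb))

-- Lists without repetition

module _ {A : Set} where

  ∈-mid : ∀ (xs : List A) {x ys} → x ∈ xs ++ x ∷ ys
  ∈-mid xs = ∈-++⁺ʳ xs (here refl)

  ∈-unskip : ∀ (xs : List A) {x y ys} → x ∈ xs ++ y ∷ ys → x ≢ y → x ∈ xs ++ ys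
  ∈-unskip xs h ne with ∈-++⁻ xs h
  ... | inj₁ p = ∈-++⁺ˡ p
  ... | inj₂ (here e) = ⊥-elim (ne e)
  ... | inj₂ (there p) = ∈-++⁺ʳ xs p

  unique-∉ : ∀ {x : A} {xs} → Unique (x ∷ xs) → x ∉ xs
  unique-∉ (a ∷ _) = All¬⇒¬Any a

  unique-∷ : ∀ {x : A} {xs} → x ∉ xs → Unique xs → Unique (x ∷ xs)
  unique-∷ x∉ u = ¬Any⇒All¬ _ x∉ ∷ u

  unique-tail : ∀ {x : A} {xs} → Unique (x ∷ xs) → Unique xs
  unique-tail (_ ∷ u) = u

  unique-++ : ∀ {xs ys : List A} → Unique xs → Unique ys → (∀ {x} → x ∈ xs → x ∉ ys) → Unique (xs ++ ys)
  unique-++ u v d = unique-++⁺ u v λ (p , q) → d p q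

  unique-++ˡ : ∀ (xs : List A) {ys} → Unique (xs ++ ys) → Unique xs
  unique-++ˡ [] u = []
  unique-++ˡ (x ∷ xs) u = unique-∷ (unique-∉ u ∘ ∈-++⁺ˡ) (unique-++ˡ xs (unique-tail u))

  unique-++ʳ : ∀ (xs : List A) {ys} → Unique (xs ++ ys) → Unique ys
  unique-++ʳ [] u = u
  unique-++ʳ (x ∷ xs) u = unique-++ʳ xs (unique-tail u)

  unique-disj : ∀ (xs : List A) {ys} → Unique (xs ++ ys) → ∀ {x} → x ∈ xs → x ∉ ys
  unique-disj (x ∷ xs) u (here refl) q = unique-∉ u (∈-++⁺ʳ xs q)
  unique-disj (x ∷ xs) u (there p) q = unique-disj xs (unique-tail u) p q

  length-++∷ : ∀ (xs : List A) {y ys} → length (xs ++ y ∷ ys) ≡ suc (length (xs ++ ys))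
  length-++∷ [] = refl
  length-++∷ (x ∷ xs) = cong suc (length-++∷ xs)

  unique-⊆-length : ∀ {xs ys : List A} → Unique xs → (∀ {x} → x ∈ xs → x ∈ ys) → length xs ≤ length ys
  unique-⊆-length {[]} u s = z≤n
  unique-⊆-length {x ∷ xs} u s with ∈-∃++ (s (here refl))
  ... | as , bs , refl = subst (suc (length xs) ≤_) (sym (length-++∷ as)) (s≤s
         (unique-⊆-length (unique-tail u) λ p → ∈-unskip as (s (there p)) λ { refl → unique-∉ u p }))

module _ {n : ℕ} where

  infix 4 _∈?_
  _∈?_ : (x : Fin n) (L : List (Fin n)) → Dec (x ∈ L)
  x ∈? [] = no λ ()
  x ∈? (y ∷ L) with x ≟F y | x ∈? L
  ... | yes e | _ = yes (here e)
  ... | no _ | yes p = yes (there p)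
  ... | no ne | no q = no λ { (here e) → ne e ; (there p) → q p }

  module _ {P : Fin n → Set} (P? : ∀ i → Dec (P i)) where

    first : (L : List (Fin n)) →
      (∃[ A ] ∃[ x ] ∃[ E ] L ≡ A ++ x ∷ E × P x × (∀ {y} → y ∈ A → ¬ P y)) ⊎ (∀ {y} → y ∈ L → ¬ P y)
    first [] = inj₂ λ ()
    first (x ∷ L) with P? x
    ... | yes p = inj₁ ([] , x , L , refl , p , λ ())
    ... | no ¬p with first L
    ...   | inj₁ (A , y , E , refl , p , h) = inj₁ (x ∷ A , y , E , refl , p ,
              λ { (here refl) → ¬p ; (there q) → h q })
    ...   | inj₂ h = inj₂ λ { (here refl) → ¬p ; (there q) → h q }

    filter-∈ : ∀ {x L} → x ∈ L → P x → x ∈ filter P? L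
    filter-∈ = ∈-filter⁺ P?

    filter-∈⁻ : ∀ {x} L → x ∈ filter P? L → x ∈ L × P x
    filter-∈⁻ L = ∈-filter⁻ P? {xs = L}

    filter-length : ∀ L → length (filter P? L) + length (filter (¬? ∘ P?) L) ≡ length L
    filter-length [] = refl
    filter-length (x ∷ L) with P? x
    ... | yes _ = cong suc (filter-length L)
    ... | no _ = trans (+-suc _ _) (cong suc (filter-length L))

-- Counting colours

δ : Bool → Bool → ℕ
δ true  true  = 1
δ false false = 1
δ _     _     = 0

δ-refl : ∀ b → δ b b ≡ 1
δ-refl true  = refl
δ-refl false = refl

δ-not : ∀ b → δ b (not b) ≡ 0
δ-not true  = refl
δ-not false = refl

δ-flip : ∀ a b → δ (not a) (not b) ≡ δ a b
δ-flip true  true  = refl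
δ-flip true  false = refl
δ-flip false true  = refl
δ-flip false false = refl

δ≤1 : ∀ a b → δ a b ≤ 1
δ≤1 true  true  = ≤-refl
δ≤1 true  false = z≤n
δ≤1 false true  = z≤n
δ≤1 false false = ≤-refl

not-not : ∀ b → not (not b) ≡ b
not-not true  = refl
not-not false = refl

not≢ : ∀ b → b ≢ not b
not≢ true  ()
not≢ false ()

-- The number of b's in the alternating colour sequence of length ℓ that starts with c.
alt : Bool → ℕ → Bool → ℕ
alt c zero    b = 0
alt c (suc ℓ) b = δ c b + alt (not c) ℓ b

alt-flip : ∀ c ℓ b → alt (not c) ℓ (not b) ≡ alt c ℓ b
alt-flip c zero b = refl
alt-flip c (suc ℓ) b = cong₂ _+_ (δ-flip c b) (alt-flip (not c) ℓ b)

sumF : ∀ p → (Fin p → ℕ) → ℕ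
sumF zero    f = 0
sumF (suc p) f = f zero + sumF p (f ∘ suc)

sumF-mono : ∀ p {f g : Fin p → ℕ} → (∀ i → f i ≤ g i) → sumF p f ≤ sumF p g
sumF-mono zero    h = z≤n
sumF-mono (suc p) h = +-mono-≤ (h zero) (sumF-mono p (h ∘ suc))

sumF-cong : ∀ p {f g : Fin p → ℕ} → (∀ i → f i ≡ g i) → sumF p f ≡ sumF p g
sumF-cong zero    h = refl
sumF-cong (suc p) h = cong₂ _+_ (h zero) (sumF-cong p (h ∘ suc))

sumF-mono-< : ∀ p {f g : Fin p → ℕ} → (∀ i → f i ≤ g i) → ∀ j → f j < g j → sumF p f < sumF p g
sumF-mono-< (suc p) h zero    lt = +-mono-<-≤ lt (sumF-mono p (h ∘ suc))
sumF-mono-< (suc p) h (suc j) lt = +-mono-≤-< (h zero) (sumF-mono-< p (h ∘ suc) j lt)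

concatF : ∀ {A : Set} p → (Fin p → List A) → List A
concatF zero    f = []
concatF (suc p) f = f zero ++ concatF p (f ∘ suc)

∈-concatF : ∀ {A : Set} {p} {f : Fin p → List A} {x} j → x ∈ f j → x ∈ concatF p f
∈-concatF zero    h = ∈-++⁺ˡ h
∈-concatF {f = f} (suc j) h = ∈-++⁺ʳ (f zero) (∈-concatF j h)

∈-concatF⁻ : ∀ {A : Set} p {f : Fin p → List A} {x} → x ∈ concatF p f → ∃[ j ] x ∈ f j
∈-concatF⁻ (suc p) {f} h with ∈-++⁻ (f zero) h
... | inj₁ q = zero , q
... | inj₂ q with ∈-concatF⁻ p q
...   | j , r = suc j , r

unique-concatF : ∀ {A : Set} p {f : Fin p → List A} → (∀ j → Unique (f j)) →
  (∀ {i j x} → x ∈ f i → x ∈ f j → i ≡ j) → Unique (concatF p f)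
unique-concatF zero    u d = []
unique-concatF (suc p) u d = unique-++ (u zero)
  (unique-concatF p (u ∘ suc) λ a b → case d a b of λ { refl → refl })
  λ a b → let (j , c) = ∈-concatF⁻ p b in case d a c of λ ()

module Colour {n : ℕ} (col : Fin n → Bool) where

  cc : Bool → List (Fin n) → ℕ
  cc b []      = 0
  cc b (x ∷ L) = δ (col x) b + cc b L

  cc-++ : ∀ b L M → cc b (L ++ M) ≡ cc b L + cc b M
  cc-++ b []      M = refl
  cc-++ b (x ∷ L) M = trans (cong (δ (col x) b +_) (cc-++ b L M)) (sym (+-assoc (δ (col x) b) _ _))

  cc-concatF : ∀ b p (f : Fin p → List (Fin n)) → cc b (concatF p f) ≡ sumF p (cc b ∘ f)
  cc-concatF b zero    f = refl
  cc-concatF b (suc p) f = trans (cc-++ b (f zero) _) (cong (cc b (f zero) +_) (cc-concatF b p (f ∘ suc)))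

  cc≤length : ∀ b L → cc b L ≤ length L
  cc≤length b []      = z≤n
  cc≤length b (x ∷ L) = +-mono-≤ (δ≤1 (col x) b) (cc≤length b L)

  cc-both : ∀ b L → cc b L + cc (not b) L ≡ length L
  cc-both b [] = refl
  cc-both b (x ∷ L) with col x | b | cc-both b L
  ... | true  | true  | h = cong suc h
  ... | true  | false | h = trans (+-suc _ _) (cong suc h)
  ... | false | true  | h = trans (+-suc _ _) (cong suc h)
  ... | false | false | h = cong suc h

-- The number of vertices of colour `b` in a properly coloured spider with leg lengths `ℓ` and a
-- centre of colour `a`.
shapeCount : ∀ p → (Fin p → ℕ) → Bool → Bool → ℕ
shapeCount p ℓ a b = δ a b + sumF p (λ j → alt (not a) (ℓ j) b)

shapeCount-flip : ∀ p ℓ a b → shapeCount p ℓ (not a) (not b) ≡ shapeCount p ℓ a b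
shapeCount-flip p ℓ a b = cong₂ _+_ (δ-flip a b) (sumF-cong p λ j → alt-flip (not a) (ℓ j) b)

-- Walks and paths

module Paths {n : ℕ} (Adj : Fin n → Fin n → Set) where

  data Linked : Fin n → List (Fin n) → Set where
    []  : ∀ {x} → Linked x []
    _∷_ : ∀ {x y L} → Adj x y → Linked y L → Linked x (y ∷ L)

  -- L lists all vertices of the path, both ends included.
  data Pth : Fin n → List (Fin n) → Fin n → Set where
    [-] : ∀ {x} → Pth x (x ∷ []) x
    _∷_ : ∀ {x y L z} → Adj x y → Pth y L z → Pth x (x ∷ L) z

  data Walk (P : Fin n → Set) : Fin n → Fin n → Set where
    stop : ∀ {x} → P x → Walk P x x
    step : ∀ {x y z} → P x → Adj x y → Walk P y z → Walk P x z

  walk-start : ∀ {P x y} → Walk P x y → P x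
  walk-start (stop p) = p
  walk-start (step p _ _) = p

  walk-end : ∀ {P x y} → Walk P x y → P y
  walk-end (stop p) = p
  walk-end (step _ _ w) = walk-end w

  walk-map : ∀ {P Q : Fin n → Set} {x y} → (∀ {v} → P v → Q v) → Walk P x y → Walk Q x y
  walk-map f (stop p) = stop (f p)
  walk-map f (step p a w) = step (f p) a (walk-map f w)

  infixr 5 _+++_
  _+++_ : ∀ {P x y z} → Walk P x y → Walk P y z → Walk P x z
  stop _ +++ v = v
  step p a w +++ v = step p a (w +++ v)

  walk-snoc : ∀ {P x y z} → Walk P x y → Adj y z → P z → Walk P x z
  walk-snoc w a p = w +++ step (walk-end w) a (stop p)

  linked-tail : ∀ A {x y E} → Linked x (A ++ y ∷ E) → Linked y E
  linked-tail [] (a ∷ l) = l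
  linked-tail (_ ∷ A) (a ∷ l) = linked-tail A l

  -- Ends x L z: the last entry of x ∷ L is z.
  data Ends : Fin n → List (Fin n) → Fin n → Set where
    []  : ∀ {x} → Ends x [] x
    _∷_ : ∀ {x L z} y → Ends y L z → Ends x (y ∷ L) z

  ends : ∀ x L → ∃[ y ] Ends x L y
  ends x [] = x , []
  ends x (y ∷ L) with ends y L
  ... | z , e = z , y ∷ e

  ends-++∷ : ∀ x A z → Ends x (A ++ z ∷ []) z
  ends-++∷ x [] z = z ∷ []
  ends-++∷ x (a ∷ A) z = a ∷ ends-++∷ a A z

  ends-∈ : ∀ {x A y} → Ends x A y → y ≡ x ⊎ y ∈ A
  ends-∈ [] = inj₁ refl
  ends-∈ (z ∷ e) with ends-∈ e
  ... | inj₁ refl = inj₂ (here refl)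
  ... | inj₂ q = inj₂ (there q)

  linked-++⁻ʳ : ∀ {x A y E} → Ends x A y → Linked x (A ++ E) → Linked y E
  linked-++⁻ʳ [] l = l
  linked-++⁻ʳ (_ ∷ e) (_ ∷ l) = linked-++⁻ʳ e l

  linked-++⁻ˡ : ∀ {x E} A → Linked x (A ++ E) → Linked x A
  linked-++⁻ˡ [] l = []
  linked-++⁻ˡ (_ ∷ A) (a ∷ l) = a ∷ linked-++⁻ˡ A l

  linked-++ : ∀ {x A y E} → Ends x A y → Linked x A → Linked y E → Linked x (A ++ E)
  linked-++ [] [] m = m
  linked-++ (_ ∷ e) (a ∷ l) m = a ∷ linked-++ e l m

  linked-take : ∀ {x L} k → Linked x L → Linked x (take k L)
  linked-take zero l = []
  linked-take (suc k) [] = []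
  linked-take (suc k) (a ∷ l) = a ∷ linked-take k l

  pth-head : ∀ {x L y} → Pth x L y → x ∈ L
  pth-head [-] = here refl
  pth-head (_ ∷ _) = here refl

  pth-last : ∀ {x L y} → Pth x L y → y ∈ L
  pth-last [-] = here refl
  pth-last (_ ∷ p) = there (pth-last p)

  pth-start : ∀ {x v L y} → Pth x (v ∷ L) y → v ≡ x
  pth-start [-] = refl
  pth-start (_ ∷ _) = refl

  pth-split : ∀ A {x p E y} → Pth x (A ++ p ∷ E) y → Pth x (A ++ p ∷ []) p × Pth p (p ∷ E) y
  pth-split [] [-] = [-] , [-]
  pth-split [] (a ∷ h) = [-] , a ∷ h
  pth-split (_ ∷ []) (a ∷ h) with pth-split [] h
  ... | h₁ , h₂ = a ∷ h₁ , h₂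
  pth-split (_ ∷ b ∷ A) (a ∷ h) with pth-split (b ∷ A) h
  ... | h₁ , h₂ = a ∷ h₁ , h₂

  pth-join : ∀ A {x p q L y} → Pth x (A ++ p ∷ []) p → Adj p q → Pth q L y → Pth x (A ++ p ∷ L) y
  pth-join [] [-] a h = a ∷ h
  pth-join (_ ∷ []) (b ∷ g) a h = b ∷ pth-join [] g a h
  pth-join (_ ∷ c ∷ A) (b ∷ g) a h = b ∷ pth-join (c ∷ A) g a h

  pth-walk : ∀ {P x L y} → Pth x L y → (∀ {v} → v ∈ L → P v) → Walk P x y
  pth-walk [-] h = stop (h (here refl))
  pth-walk (a ∷ p) h = step (h (here refl)) a (pth-walk p (h ∘ there))

  -- Cutting out closed subwalks.
  walk-pth : ∀ {P x y} → Walk P x y → ∃[ L ] Pth x L y × (∀ {v} → v ∈ L → P v) × Unique L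
  walk-pth (stop p) = _ , [-] , (λ { (here refl) → p }) , [] ∷ []
  walk-pth {x = x} (step p a w) with walk-pth w
  ... | L , h , all , u with x ∈? L
  ...   | no x∉L = x ∷ L , a ∷ h , (λ { (here refl) → p ; (there q) → all q }) , unique-∷ x∉L u
  ...   | yes x∈L with ∈-∃++ x∈L
  ...     | A , B , refl = x ∷ B , proj₂ (pth-split A h) , all ∘ ∈-++⁺ʳ A , unique-++ʳ A u

  first-hit : ∀ {P x y} (L : List (Fin n)) → Walk P x y → y ∈ L →
    ∃[ r ] r ∈ L × Walk (λ v → P v × (v ∈ L → v ≡ r)) x r
  first-hit {x = x} L w y∈L with x ∈? L
  ... | yes x∈L = x , x∈L , stop (walk-start w , λ _ → refl)
  first-hit L (stop p) y∈L | no x∉L = ⊥-elim (x∉L y∈L)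
  first-hit L (step p a w) y∈L | no x∉L with first-hit L w y∈L
  ...   | r , r∈L , v = r , r∈L , step (p , λ x∈L → ⊥-elim (x∉L x∈L)) a v

  module Symmetric (symA : ∀ {x y} → Adj x y → Adj y x) where

    walk-rev : ∀ {P x y} → Walk P x y → Walk P y x
    walk-rev (stop p) = stop p
    walk-rev (step p a w) = walk-snoc (walk-rev w) (symA a) p

module Proper {n : ℕ} (Adj : Fin n → Fin n → Set) (col : Fin n → Bool) (colA : ∀ {x y} → Adj x y → col y ≡ not (col x)) where
  open Colour col
  open Paths Adj

  linked-cc : ∀ {x L} b → Linked x L → cc b L ≡ alt (not (col x)) (length L) b
  linked-cc b [] = refl
  linked-cc {x} {y ∷ L} b (a ∷ l) = cong₂ _+_ (cong (λ c → δ c b) (colA a))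
    (trans (linked-cc b l) (cong (λ c → alt (not c) (length L) b) (colA a)))

-- Host graphs and greedy embedding of spiders

record Host (n p : ℕ) : Set₁ where
  field
    Adj  : Fin n → Fin n → Set
    adj? : ∀ x y → Dec (Adj x y)
    symA : ∀ {x y} → Adj x y → Adj y x
    Vs   : List (Fin n)
    adjV : ∀ {x y} → Adj x y → x ∈ Vs
    col  : Fin n → Bool
    colA : ∀ {x y} → Adj x y → col y ≡ not (col x)
    t    : ℕ
    ls   : Fin p → ℕ
    ls>0 : ∀ j → 0 < ls j
    cap  : ∀ a b → shapeCount p ls a b ≤ t
  open Colour col public
  open Paths Adj public
  open Paths.Symmetric Adj symA public
  open Proper Adj col colA public
  field
    -- The degree bound `t + 3` as greedy choices use it: neighbours of `x` have the colour
    -- `not (col x)`, so entries of `L` of the other colour block nothing.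
    deg  : ∀ {x} → x ∈ Vs → ∀ L → cc (not (col x)) L ≤ 2 + t → ∃[ y ] Adj x y × y ∉ L
    conn : ∀ x y {u v} → u ∈ Vs → u ≢ x → u ≢ y → v ∈ Vs → v ≢ x → v ≢ y →
           NN (Walk (λ z → z ∈ Vs × z ≢ x × z ≢ y) u v)

  adjV′ : ∀ {x y} → Adj x y → y ∈ Vs
  adjV′ = adjV ∘ symA

  adj-≢ : ∀ {x y} → Adj x y → x ≢ y
  adj-≢ a refl = not≢ _ (colA a)

  adj²-col : ∀ {x y z} → Adj x y → Adj x z → col y ≡ col z
  adj²-col a b = trans (colA a) (sym (colA b))

  no-triangle : ∀ {x y z} → Adj x y → Adj x z → ¬ Adj y z
  no-triangle a b c = not≢ _ (trans (adj²-col a b) (colA c))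

  t>0 : 0 < t
  t>0 = ≤-trans (m≤m+n 1 _) (cap true true)

  vs : ∀ {q} → Fin n → (Fin q → List (Fin n)) → List (Fin n)
  vs {q} z leg = z ∷ concatF q leg

  record Spider {q} (Z : Fin n → Set) (z : Fin n) (ℓ : Fin q → ℕ) (leg : Fin q → List (Fin n)) : Set where
    field
      centre : Z z
      linked : ∀ j → Linked z (leg j)
      len    : ∀ j → length (leg j) ≡ ℓ j
      all    : ∀ j {x} → x ∈ leg j → Z x
      uniq   : ∀ j → Unique (leg j)
      cent∉  : ∀ j → z ∉ leg j
      disj   : ∀ {i j x} → x ∈ leg i → x ∈ leg j → i ≡ j

    in-Z : ∀ {x} → x ∈ vs z leg → Z x
    in-Z (here refl) = centre
    in-Z (there h) = let (j , q) = ∈-concatF⁻ q h in all j q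

    vs-unique : Unique (vs z leg)
    vs-unique = unique-∷ (λ h → let (j , q) = ∈-concatF⁻ q h in cent∉ j q)
      (unique-concatF q uniq disj)

    cc-vs : ∀ b → cc b (vs z leg) ≡ shapeCount q ℓ (col z) b
    cc-vs b = cong (δ (col z) b +_) (trans (cc-concatF b q leg)
      (sumF-cong q λ j → trans (linked-cc b (linked j)) (cong (λ k → alt (not (col z)) k b) (len j))))

  spider-map : ∀ {q Z Z' z ℓ} {leg : Fin q → List (Fin n)} → (∀ {x} → Z x → Z' x) →
    Spider Z z ℓ leg → Spider Z' z ℓ leg
  spider-map f s = record { Spider s ; centre = f (Spider.centre s) ; all = λ j h → f (Spider.all s j h) }

  cc-spider : ∀ {Z z leg} → Spider Z z ls leg → ∀ b → cc b (vs z leg) ≤ t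
  cc-spider s b = subst (_≤ t) (sym (Spider.cc-vs s b)) (cap _ b)

  -- `K b` is the supply of colour `b`. It depends on the colour because `Rebuild` loses different
  -- numbers of neighbours in the two classes.
  Free : (Fin n → Set) → (Bool → ℕ) → Fin n → Set
  Free Z K y = ∀ L → cc (not (col y)) L < K (not (col y)) → NN (∃[ w ] Adj y w × Z w × w ∉ L)

  module _ {Z : Fin n → Set} {K : Bool → ℕ} (free : ∀ {y} → Z y → Free Z K y) where

    grow : ∀ ℓ {y} L → Z y → (∀ b → cc b L + alt (not (col y)) ℓ b ≤ K b) →
      NN (∃[ leg ] Linked y leg × length leg ≡ ℓ × (∀ {x} → x ∈ leg → Z x) × Unique leg ×
          (∀ {x} → x ∈ leg → x ∉ L))
    grow zero L zy h = pure ([] , [] , refl , (λ ()) , [] , λ ())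
    grow (suc ℓ) {y} L zy h = do
      let c = not (col y)
      (w , a , zw , w∉) ← free zy L (≤-trans
        (≤-trans (≤-reflexive (trans (sym (+-comm (cc c L) 1)) (cong (cc c L +_) (sym (δ-refl c)))))
                 (+-monoʳ-≤ (cc c L) (m≤m+n _ _))) (h c))
      (leg , l , e , zs , u , d) ← grow ℓ (w ∷ L) zw λ b → ≤-trans (≤-reflexive
        (trans (cong₂ _+_ (trans (+-comm (δ (col w) b) (cc b L)) (cong (λ k → cc b L + δ k b) (colA a)))
                          (cong (λ k → alt (not k) ℓ b) (colA a)))
               (+-assoc (cc b L) _ _))) (h b)
      pure (w ∷ leg , a ∷ l , cong suc e , (λ { (here refl) → zw ; (there q) → zs q }) ,
        unique-∷ (λ q → d q (here refl)) u , λ { (here refl) → w∉ ; (there q) → d q ∘ there })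

    growAll : ∀ q (ℓ : Fin q → ℕ) {y} L → Z y → y ∈ L →
      (∀ b → cc b L + sumF q (λ j → alt (not (col y)) (ℓ j) b) ≤ K b) →
      NN (∃[ leg ] Spider Z y ℓ leg × (∀ j {x} → x ∈ leg j → x ∉ L))
    growAll zero ℓ L zy y∈ h = pure ((λ ()) , record
      { centre = zy ; linked = λ () ; len = λ () ; all = λ () ; uniq = λ () ; cent∉ = λ ()
      ; disj = λ { {()} } } , λ ())
    growAll (suc q) ℓ {y} L zy y∈ h = do
      (g , l , e , zs , u , d) ← grow (ℓ zero) L zy λ b → ≤-trans (+-monoʳ-≤ (cc b L) (m≤m+n _ _)) (h b)
      (leg , s , d') ← growAll q (ℓ ∘ suc) (g ++ L) zy (∈-++⁺ʳ g y∈) λ b → ≤-trans (≤-reflexive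
        (trans (cong (_+ sumF q (λ j → alt (not (col y)) (ℓ (suc j)) b))
          (trans (cc-++ b g L) (trans (+-comm (cc b g) (cc b L)) (cong (cc b L +_)
            (trans (linked-cc b l) (cong (λ k → alt (not (col y)) k b) e))))))
          (+-assoc (cc b L) _ _))) (h b)
      let module S = Spider s
      pure ((λ { zero → g ; (suc j) → leg j }) , record
        { centre = zy
        ; linked = λ { zero → l ; (suc j) → S.linked j }
        ; len = λ { zero → e ; (suc j) → S.len j }
        ; all = λ { zero → zs ; (suc j) → S.all j }
        ; uniq = λ { zero → u ; (suc j) → S.uniq j }
        ; cent∉ = λ { zero y∈g → d y∈g y∈ ; (suc j) → S.cent∉ j }
        ; disj = λ { {zero} {zero} _ _ → refl
                   ; {zero} {suc j} a b → ⊥-elim (d' j b (∈-++⁺ˡ a))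
                   ; {suc i} {zero} a b → ⊥-elim (d' i a (∈-++⁺ˡ b))
                   ; {suc i} {suc j} a b → cong suc (S.disj a b) }
        } , λ { zero → d ; (suc j) a → d' j a ∘ ∈-++⁺ʳ g })

    -- Whenever a vertex is still to be placed, fewer than `t` vertices of its colour are in use,
    -- because the complete spider has at most `t`.
    greedy : (∀ b → t ≤ K b) → ∀ {y} → Z y → NN (∃[ leg ] Spider Z y ls leg)
    greedy t≤K {y} zy = do
      (leg , s , _) ← growAll p ls (y ∷ []) zy (here refl) λ b →
        ≤-trans (≤-trans (≤-reflexive (cong (_+ sumF p (λ j → alt (not (col y)) (ls j) b)) (+-identityʳ _)))
          (cap (col y) b)) (t≤K b)
      pure (leg , s)

  Few : ℕ → Fin n → (Fin n → Set) → Set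
  Few k x P = ∃[ L ] length L ≤ k × (∀ {y} → Adj x y → P y → y ∈ L)

  few-⊎ : ∀ {j k x} {P Q : Fin n → Set} → Few j x P → Few k x Q → Few (j + k) x (λ y → P y ⊎ Q y)
  few-⊎ (L , l , f) (M , m , g) = L ++ M , ≤-trans (≤-reflexive (length-++ L)) (+-mono-≤ l m) ,
    λ a → [ ∈-++⁺ˡ ∘ f a , ∈-++⁺ʳ L ∘ g a ]′

  few-map : ∀ {j k x} {P Q : Fin n → Set} → j ≤ k → (∀ {y} → Adj x y → Q y → P y) → Few j x P → Few k x Q
  few-map j≤k h (L , l , f) = L , ≤-trans l j≤k , λ a q → f a (h a q)

  few-deg : ∀ {x P k} → x ∈ Vs → Few k x P → ∀ L → k + cc (not (col x)) L ≤ 2 + t →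
    ∃[ y ] Adj x y × ¬ P y × y ∉ L
  few-deg {x} {P} {k} x∈ (M , m , f) L h with deg x∈ (M ++ L) (≤-trans (≤-reflexive (cc-++ _ M L))
      (≤-trans (+-monoˡ-≤ _ (≤-trans (cc≤length _ M) m)) h))
  ... | y , a , y∉ = y , a , (λ py → y∉ (∈-++⁺ˡ (f a py))) , y∉ ∘ ∈-++⁺ʳ M

  two-nbrs : ∀ {x P} → ¬ Few 1 x P → NN (∃₂ λ y z → Adj x y × P y × Adj x z × P z × y ≢ z)
  two-nbrs {x} {P} ¬f = by-contra λ none → pure (¬f' none)
    where
    ¬f' : ¬ (∃₂ λ y z → Adj x y × P y × Adj x z × P z × y ≢ z) → ⊥
    ¬f' none = em (∃[ y ] Adj x y × P y) λ
      { (inj₂ no₁) → ¬f ([] , z≤n , λ a q → ⊥-elim (no₁ (_ , a , q)))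
      ; (inj₁ (y , a , q)) → ¬f (y ∷ [] , ≤-refl , λ {z} b r → case (z ≟F y) of λ
          { (yes refl) → here refl ; (no ne) → ⊥-elim (none (y , z , a , q , b , r , ne ∘ sym)) }) }

  few-three : ∀ {x P u v w} → Few 2 x P → Adj x u → P u → Adj x v → P v → Adj x w → P w →
    u ≢ v → u ≢ w → v ≢ w → ⊥
  few-three {u = u} {v} {w} (L , l , f) a pu b pv c pw u≢v u≢w v≢w = <⇒≱ ≤-refl (≤-trans
    (unique-⊆-length {xs = u ∷ v ∷ w ∷ []}
      (unique-∷ (λ { (here e) → u≢v e ; (there (here e)) → u≢w e })
        (unique-∷ (λ { (here e) → v≢w e }) (unique-∷ (λ ()) [])))
      (λ { (here refl) → f a pu ; (there (here refl)) → f b pv ; (there (there (here refl))) → f c pw })) l)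

  few-free : ∀ {Z P : Fin n → Set} {y} → y ∈ Vs → (∀ {w} → w ∈ Vs → ¬ P w → Z w) →
    Few 3 y P → Free Z (λ _ → t) y
  few-free y∈ zw f L lt with few-deg y∈ f L (s≤s (s≤s lt))
  ... | w , a , ¬pw , w∉ = pure (w , a , zw (adjV′ a) ¬pw , w∉)

  few-pair : ∀ {x P p q} → (∀ {w} → Adj x w → P w → w ≡ p ⊎ w ≡ q) → Few 2 x P
  few-pair {p = p} {q} h = p ∷ q ∷ [] , ≤-refl , λ a r → case h a r of λ
    { (inj₁ refl) → here refl ; (inj₂ refl) → there (here refl) }

  few-one : ∀ {x P p} → (∀ {w} → Adj x w → P w → w ≡ p) → Few 1 x P
  few-one {p = p} h = p ∷ [] , ≤-refl , λ a r → here (h a r)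

  few-none : ∀ {x P} → (∀ {w} → Adj x w → P w → ⊥) → Few 0 x P
  few-none h = [] , z≤n , λ a r → ⊥-elim (h a r)

-- Rerouting a leg

module _ {A : Set} {q : ℕ} where

  upd : (Fin q → A) → Fin q → A → Fin q → A
  upd f j a i with i ≟F j
  ... | yes _ = a
  ... | no  _ = f i

  upd-same : ∀ f j a → upd f j a j ≡ a
  upd-same f j a with j ≟F j
  ... | yes _ = refl
  ... | no ne = ⊥-elim (ne refl)

  upd-other : ∀ f {j} a {i} → i ≢ j → upd f j a i ≡ f i
  upd-other f {j} a {i} ne with i ≟F j
  ... | yes e = ⊥-elim (ne e)
  ... | no _ = refl

  upd-elim : ∀ {f j a} (P : Fin q → A → Set) → P j a → (∀ i → i ≢ j → P i (f i)) → ∀ i → P i (upd f j a i)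
  upd-elim {f} {j} P h g i with i ≟F j
  ... | yes refl = h
  ... | no ne = g i ne

module Legs {n p : ℕ} (H : Host n p) where
  open Host H

  ∈-vs : ∀ {q z x} {leg : Fin q → List (Fin n)} j → x ∈ leg j → x ∈ vs z leg
  ∈-vs j h = there (∈-concatF j h)

  ∈-vs⁻ : ∀ {q z x} {leg : Fin q → List (Fin n)} → x ∈ vs z leg → x ≡ z ⊎ (∃[ j ] x ∈ leg j)
  ∈-vs⁻ (here e) = inj₁ e
  ∈-vs⁻ {q} (there h) = inj₂ (∈-concatF⁻ q h)

  ∈-upd : ∀ {q x j X} {leg : Fin q → List (Fin n)} i → x ∈ upd leg j X i → (i ≡ j × x ∈ X) ⊎ (i ≢ j × x ∈ leg i)
  ∈-upd {x = x} {j} {X} {leg} = upd-elim (λ i L → x ∈ L → (i ≡ j × x ∈ X) ⊎ (i ≢ j × x ∈ leg i))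
    (λ h → inj₁ (refl , h)) (λ i ne h → inj₂ (ne , h))

  vs-upd⁻ : ∀ {q z x j X} {leg : Fin q → List (Fin n)} → x ∈ vs z (upd leg j X) → x ∈ X ⊎ x ∈ vs z leg
  vs-upd⁻ {q} {X = X} {leg} h with ∈-vs⁻ h
  ... | inj₁ refl = inj₂ (here refl)
  ... | inj₂ (i , r) with ∈-upd {X = X} {leg} i r
  ...   | inj₁ (_ , s) = inj₁ s
  ...   | inj₂ (_ , s) = inj₂ (∈-vs {leg = leg} i s)

  vs-upd⁺ : ∀ {q z x X} {leg : Fin q → List (Fin n)} j → x ∈ X → x ∈ vs z (upd leg j X)
  vs-upd⁺ {x = x} {X} {leg} j h = ∈-vs j (subst (x ∈_) (sym (upd-same leg j X)) h)

  vs-upd-other : ∀ {q z x j X} {leg : Fin q → List (Fin n)} i → i ≢ j → x ∈ leg i → x ∈ vs z (upd leg j X)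
  vs-upd-other {x = x} {X = X} {leg} i ne h = ∈-vs i (subst (x ∈_) (sym (upd-other leg X ne)) h)

  set-leg : ∀ {q Z z ℓ} {leg : Fin q → List (Fin n)} → Spider Z z ℓ leg → ∀ j X →
    Linked z X → (∀ {x} → x ∈ X → Z x) → Unique X →
    (∀ {x} → x ∈ X → x ∈ leg j ⊎ x ∉ vs z leg) → Spider Z z (λ i → length (upd leg j X i)) (upd leg j X)
  set-leg {q} {Z} {z} {ℓ} {leg} s j X l zs u d = record
    { centre = centre
    ; linked = upd-elim (λ _ → Linked z) l (λ i _ → linked i)
    ; len = λ _ → refl
    ; all = upd-elim (λ _ L → ∀ {x} → x ∈ L → Z x) zs (λ i _ → all i)
    ; uniq = upd-elim (λ _ → Unique) u (λ i _ → uniq i)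
    ; cent∉ = upd-elim (λ _ → z ∉_) (λ h → case d h of λ
        { (inj₁ r) → cent∉ j r ; (inj₂ r) → r (here refl) }) (λ i _ → cent∉ i)
    ; disj = λ {i} {k} a b → case (∈-upd {X = X} {leg} i a , ∈-upd {X = X} {leg} k b) of λ
        { (inj₁ (refl , _) , inj₁ (refl , _)) → refl
        ; (inj₁ (refl , a') , inj₂ (ne , b')) → ⊥-elim (clash k ne a' b')
        ; (inj₂ (ne , a') , inj₁ (refl , b')) → ⊥-elim (clash i ne b' a')
        ; (inj₂ (_ , a') , inj₂ (_ , b')) → disj a' b' }
    }
    where
    open Spider s
    clash : ∀ k → k ≢ j → ∀ {x} → x ∈ X → x ∈ leg k → ⊥
    clash k ne a b = case d a of λ
      { (inj₁ r) → ne (disj b r) ; (inj₂ r) → r (∈-vs k b) }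

  re-len : ∀ {q Z z ℓ ℓ'} {leg : Fin q → List (Fin n)} → Spider Z z ℓ leg → (∀ j → length (leg j) ≡ ℓ' j) → Spider Z z ℓ' leg
  re-len s h = record { Spider s ; len = h }

  colAt : Bool → ℕ → Bool
  colAt c zero = c
  colAt c (suc k) = colAt (not c) k

  ends-col : ∀ {x L y} → Ends x L y → Linked x L → col y ≡ colAt (col x) (length L)
  ends-col [] [] = refl
  ends-col {L = z ∷ L} (_ ∷ e) (a ∷ l) = trans (ends-col e l) (cong (λ c → colAt c (length L)) (colA a))

  module _ (Z : Fin n → Set) (Z⊆V : ∀ {x} → Z x → x ∈ Vs) where

    -- One neighbour more than a copy can block: a good vertex sees a vertex of `Z` outside any
    -- given copy.
    Good : Fin n → Set
    Good = Free Z (λ _ → suc t)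

    Copy : Fin n → (Fin p → List (Fin n)) → Set
    Copy z leg = Spider Z z ls leg

    Avoided : Fin n → Set
    Avoided y = ∃₂ λ z leg → Copy z leg × y ∉ vs z leg

    -- Goodness has to be earned: each use of `good` below presents a copy that avoids the vertex in
    -- question.
    module DT (good : ∀ {y} → Z y → Avoided y → Good y) where

      -- The leg is rerouted through w around the first vertex τ of its tail: grow a path ws outside the copy.
      -- Once it has as many vertices as a prefix τ ∷ A of the tail, only τ and the tail beyond A count as
      -- occupied, so it can either be prolonged or be joined to the tail past τ.
      module Reroute {z : Fin n} {leg : Fin p → List (Fin n)} (S : Copy z leg) (j : Fin p) {pre : List (Fin n)} {τ h : Fin n} (e : Ends z pre h) where
        open Spider S

        Result : List (Fin n) → Set
        Result pre = ∃[ tl ] Copy z (upd leg j (pre ++ tl)) × τ ∉ vs z (upd leg j (pre ++ tl))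

        extend : ∀ A T ws {x y} → leg j ≡ pre ++ τ ∷ A ++ T → Linked h ws → Ends h ws x → Ends h (τ ∷ A) y →
          length ws ≡ suc (length A) → (∀ {v} → v ∈ ws → Z v × v ∉ vs z leg) → Unique ws → x ∈ ws → NN (Result pre)

        finish : ∀ A T tl → leg j ≡ pre ++ τ ∷ A ++ T → Linked h tl → length tl ≡ suc (length (A ++ T)) →
          (∀ {x} → x ∈ tl → Z x) → Unique tl → (∀ {x} → x ∈ tl → x ∈ A ++ T ⊎ x ∉ vs z leg) → Result pre
        finish A T tl eq l ln zs u d = tl , re-len (set-leg S j (pre ++ tl)
            (linked-++ e (linked-++⁻ˡ pre (subst (Linked z) eq (linked j))) l)
            (λ r → [ (λ q → all j (subst (_ ∈_) (sym eq) (∈-++⁺ˡ q))) , zs ]′ (∈-++⁻ pre r))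
            (unique-++ (unique-++ˡ pre U) u λ q r → case d r of λ
              { (inj₁ r') → unique-disj pre U q (there r')
              ; (inj₂ r') → r' (∈-vs j (subst (_ ∈_) (sym eq) (∈-++⁺ˡ q))) })
            (λ r → case ∈-++⁻ pre r of λ
              { (inj₁ q) → inj₁ (subst (_ ∈_) (sym eq) (∈-++⁺ˡ q))
              ; (inj₂ q) → case d q of λ
                { (inj₁ q') → inj₁ (subst (_ ∈_) (sym eq) (∈-++⁺ʳ pre (there q'))) ; (inj₂ q') → inj₂ q' } }))
            (upd-elim (λ i L → length L ≡ ls i)
              (trans (length-++ pre) (trans (cong (length pre +_) ln) (trans (sym (length-++ pre))
                (trans (cong length (sym eq)) (len j)))))
              (λ i _ → len i)) ,
            λ r → case ∈-vs⁻ r of λ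
              { (inj₁ refl) → cent∉ j τ∈
              ; (inj₂ (i , q)) → case ∈-upd {X = pre ++ tl} {leg} i q of λ
                { (inj₂ (ne , q')) → ne (disj q' τ∈)
                ; (inj₁ (refl , q')) → case ∈-++⁻ pre q' of λ
                  { (inj₁ q'') → unique-disj pre U q'' (here refl)
                  ; (inj₂ q'') → case d q'' of λ
                    { (inj₁ r') → unique-∉ (unique-++ʳ pre U) r' ; (inj₂ r') → r' (∈-vs j τ∈) } } } }
          where
          U : Unique (pre ++ τ ∷ A ++ T)
          U = subst Unique eq (uniq j)
          τ∈ : τ ∈ leg j
          τ∈ = subst (τ ∈_) (sym eq) (∈-mid pre)

        extend A [] ws eq l ex ey ln zs u x∈ = pure (finish A [] ws eq l
          (trans ln (cong (suc ∘ length) (sym (++-identityʳ A)))) (proj₁ ∘ zs) u (inj₂ ∘ proj₂ ∘ zs))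
        extend A (σ ∷ T) ws {x} {y} eq l ex ey ln zs u x∈ = do
            (w , a , zw , w∉) ← good (proj₁ (zs x∈)) (z , leg , S , proj₂ (zs x∈))
              (vs z (upd leg j new)) (s≤s count)
            case w ∈? vs z leg of λ
              { (no w∉S) → extend (A ++ σ ∷ []) T (ws ++ w ∷ [])
                  (trans eq (cong (λ L → pre ++ τ ∷ L) (assoc A σ T)))
                  (linked-++ ex l (a ∷ [])) (ends-snoc′ ex w) (σ-ends ey)
                  (trans (length-++∷ ws) (trans (cong suc (trans (cong length (++-identityʳ ws)) ln))
                    (cong suc (sym (trans (length-++∷ A) (cong (suc ∘ length) (++-identityʳ A)))))))
                  (λ r → case ∈-++⁻ ws r of λ { (inj₁ q) → zs q ; (inj₂ (here refl)) → zw , w∉S })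
                  (unique-++ u ([] ∷ []) (λ { q (here refl) → w∉ (vs-upd⁺ j (∈-new-ws q)) }))
                  (∈-++⁺ʳ ws (here refl))
              ; (yes w∈S) → jump w a w∉ (locate w w∈S w∉) }
          where
          new : List (Fin n)
          new = pre ++ τ ∷ T ++ ws
          ∈-new-ws : ∀ {v} → v ∈ ws → v ∈ new
          ∈-new-ws q = ∈-++⁺ʳ pre (there (∈-++⁺ʳ T q))
          assoc : ∀ (A : List (Fin n)) σ T → A ++ σ ∷ T ≡ (A ++ σ ∷ []) ++ T
          assoc [] σ T = refl
          assoc (a ∷ A) σ T = cong (a ∷_) (assoc A σ T)
          ends-snoc′ : ∀ {x L y} → Ends x L y → ∀ w → Ends x (L ++ w ∷ []) w
          ends-snoc′ [] w = w ∷ []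
          ends-snoc′ (v ∷ e) w = v ∷ ends-snoc′ e w
          σ-ends : Ends h (τ ∷ A) y → Ends h (τ ∷ A ++ σ ∷ []) σ
          σ-ends ey = ends-snoc′ ey σ
          Lτ : Linked h (τ ∷ A ++ σ ∷ T)
          Lτ = linked-++⁻ʳ e (subst (Linked z) eq (linked j))
          b = not (col x)
          x-y : col x ≡ col y
          x-y = trans (ends-col ex l) (trans (cong (colAt (col h)) ln) (sym (ends-col ey (linked-++⁻ˡ (τ ∷ A) Lτ))))
          head-adj : ∀ {y} → Ends h (τ ∷ A) y → Linked h (τ ∷ A ++ σ ∷ T) → Adj y σ
          head-adj ey l with linked-++⁻ʳ ey l
          ... | a ∷ _ = a
          σ-col : δ (col σ) b ≡ 1
          σ-col = trans (cong (λ c → δ c b) (trans (colA (head-adj ey Lτ)) (cong not (sym x-y)))) (δ-refl b)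
          ws-τA : cc b ws ≡ cc b (τ ∷ A)
          ws-τA = trans (linked-cc b l) (trans (cong (λ k → alt (not (col h)) k b) ln)
            (sym (linked-cc b (linked-++⁻ˡ (τ ∷ A) Lτ))))
          -- `ws` and `τ ∷ A` both follow `h` and have equal length, so they agree in every colour.
          -- Keeping `τ` occupied costs at most one, which is paid for by `σ`: it has colour `b` and
          -- is released.
          leg-count : cc b new ≤ cc b (leg j)
          leg-count = begin
            cc b (pre ++ τ ∷ T ++ ws)             ≡⟨ cc-++ b pre _ ⟩
            cc b pre + (δ (col τ) b + cc b (T ++ ws)) ≤⟨ +-monoʳ-≤ (cc b pre) (+-mono-≤ (δ≤1 (col τ) b)
                                                        (≤-reflexive (trans (cc-++ b T ws) (trans (+-comm (cc b T) _) (cong (_+ cc b T) ws-τA))))) ⟩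
            cc b pre + (1 + (cc b (τ ∷ A) + cc b T)) ≡⟨ cong (cc b pre +_) (sym (+-suc (cc b (τ ∷ A)) (cc b T))) ⟩
            cc b pre + (cc b (τ ∷ A) + (1 + cc b T)) ≡⟨ cong (λ k → cc b pre + (cc b (τ ∷ A) + (k + cc b T))) (sym σ-col) ⟩
            cc b pre + (cc b (τ ∷ A) + cc b (σ ∷ T)) ≡⟨ cong (cc b pre +_) (sym (cc-++ b (τ ∷ A) (σ ∷ T))) ⟩
            cc b pre + cc b (τ ∷ A ++ σ ∷ T)       ≡⟨ sym (cc-++ b pre _) ⟩
            cc b (pre ++ τ ∷ A ++ σ ∷ T)           ≡⟨ cong (cc b) (sym eq) ⟩
            cc b (leg j)                           ∎
            where open ≤-Reasoning
          count : cc b (vs z (upd leg j new)) ≤ t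
          count = ≤-trans (+-monoʳ-≤ (δ (col z) b) (≤-trans (≤-reflexive (cc-concatF b p (upd leg j new)))
              (≤-trans (sumF-mono p (upd-elim (λ i L → cc b L ≤ cc b (leg i)) leg-count λ _ _ → ≤-refl))
                (≤-reflexive (sym (cc-concatF b p leg)))))) (cc-spider S b)
          locate : ∀ w → w ∈ vs z leg → w ∉ vs z (upd leg j new) → w ∈ A ++ σ ∷ []
          locate w w∈ w∉ with ∈-vs⁻ w∈
          ... | inj₁ refl = ⊥-elim (w∉ (here refl))
          ... | inj₂ (i , q) with i ≟F j
          ...   | no ne = ⊥-elim (w∉ (vs-upd-other i ne q))
          ...   | yes refl with ∈-++⁻ pre (subst (w ∈_) eq q)
          ...     | inj₁ r = ⊥-elim (w∉ (vs-upd⁺ j (∈-++⁺ˡ r)))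
          ...     | inj₂ (here refl) = ⊥-elim (w∉ (vs-upd⁺ j (∈-mid pre)))
          ...     | inj₂ (there r) with ∈-++⁻ A r
          ...       | inj₁ s = ∈-++⁺ˡ s
          ...       | inj₂ (here refl) = ∈-mid A
          ...       | inj₂ (there s) = ⊥-elim (w∉ (vs-upd⁺ j (∈-++⁺ʳ pre (there (∈-++⁺ˡ s)))))
          ∈-take : ∀ k {v : Fin n} {L} → v ∈ take k L → v ∈ L
          ∈-take (suc k) {L = _ ∷ _} (here e) = here e
          ∈-take (suc k) {L = _ ∷ _} (there q) = there (∈-take k q)
          unique-take : ∀ k {L : List (Fin n)} → Unique L → Unique (take k L)
          unique-take zero u = []
          unique-take (suc k) {[]} u = []
          unique-take (suc k) {v ∷ L} u = unique-∷ (unique-∉ u ∘ ∈-take k) (unique-take k (unique-tail u))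
          length-take : ∀ k (L : List (Fin n)) → k ≤ length L → length (take k L) ≡ k
          length-take zero L h = refl
          length-take (suc k) (v ∷ L) (s≤s h) = cong suc (length-take k L h)
          -- From `w` on the leg follows its old tail, cut to the old total length. Enough of the
          -- tail is left because `w` does not come after `σ`.
          jump : ∀ w → Adj x w → w ∉ vs z (upd leg j new) → w ∈ A ++ σ ∷ [] → NN (Result pre)
          jump w a w∉ w∈ with ∈-∃++ w∈
          ... | A₁ , A₂ , eqA = pure (finish A (σ ∷ T) (ws ++ take k (w ∷ A₂ ++ T)) eq
              (linked-++ ex l (linked-take k (a ∷ linked-tail (τ ∷ A₁) (subst (λ L → Linked h (τ ∷ L)) eqT Lτ))))
              (trans (length-++ ws) (trans (cong₂ _+_ ln (length-take k (w ∷ A₂ ++ T)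
                (s≤s (≤-trans (m≤n+m (length T) (length A₂)) (≤-reflexive (sym (length-++ A₂)))))))
                (cong suc (sym (length-++ A)))))
              (λ r → case ∈-++⁻ ws r of λ { (inj₁ q) → proj₁ (zs q)
                ; (inj₂ q) → all j (subst (_ ∈_) (sym eq) (∈-++⁺ʳ pre (there (in-tail q)))) })
              (unique-++ u (unique-take k (unique-++ʳ A₁ (subst Unique eqT U)))
                λ q r → proj₂ (zs q) (∈-vs j (subst (_ ∈_) (sym eq) (∈-++⁺ʳ pre (there (in-tail r))))))
              λ r → case ∈-++⁻ ws r of λ { (inj₁ q) → inj₂ (proj₂ (zs q)) ; (inj₂ q) → inj₁ (in-tail q) })
            where
            k = length (σ ∷ T)
            eqT : A ++ σ ∷ T ≡ A₁ ++ w ∷ A₂ ++ T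
            eqT = trans (assoc A σ T) (trans (cong (_++ T) eqA) (++assoc A₁))
              where
              ++assoc : ∀ B → (B ++ w ∷ A₂) ++ T ≡ B ++ w ∷ A₂ ++ T
              ++assoc [] = refl
              ++assoc (c ∷ B) = cong (c ∷_) (++assoc B)
            in-tail : ∀ {v} → v ∈ take k (w ∷ A₂ ++ T) → v ∈ A ++ σ ∷ T
            in-tail q = subst (_ ∈_) (sym eqT) (∈-++⁺ʳ A₁ (∈-take k q))
            U : Unique (A ++ σ ∷ T)
            U = unique-tail (unique-++ʳ pre (subst Unique eq (uniq j)))

      -- Induction along the tail. Rerouting around its first vertex `τ` shows that `τ` is avoided,
      -- hence good; so `τ` has its own neighbour outside the copy and can take over the part of `h`
      -- with a longer prefix.
      unlock : ∀ {z leg} (S : Copy z leg) (j : Fin p) pre tail {h w} → leg j ≡ pre ++ tail → Ends z pre h →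
        Z w → w ∉ vs z leg → Adj h w → ∀ {x} → x ∈ tail →
        NN (∃[ tl ] Copy z (upd leg j (pre ++ tl)) × x ∉ vs z (upd leg j (pre ++ tl)))
      unlock {z} {leg} S j pre (τ ∷ ts) {h} {w} eq e zw w∉ a x∈ = do
          (tl , S' , τ∉) ← Reroute.extend S j {pre} {τ} e [] ts (w ∷ []) eq (a ∷ []) (w ∷ []) (τ ∷ []) refl
            (λ { (here refl) → zw , w∉ }) ([] ∷ []) (here refl)
          case x∈ of λ
            { (here refl) → pure (tl , S' , τ∉)
            ; (there x∈ts) → do
                (w' , a' , zw' , w'∉) ← good (Spider.all S j (subst (τ ∈_) (sym eq) (∈-mid pre)))
                  (z , _ , S' , τ∉) (vs z leg) (s≤s (cc-spider S _))
                (tl' , S'' , x∉) ← unlock S j (pre ++ τ ∷ []) ts (trans eq (assoc pre)) (ends-++∷ z pre τ) zw' w'∉ a' x∈ts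
                pure (τ ∷ tl' , subst (λ L → Copy z (upd leg j L)) (sym (assoc pre)) S'' ,
                  subst (λ L → _ ∉ vs z (upd leg j L)) (sym (assoc pre)) x∉) }
        where
        assoc : ∀ B {T} → B ++ τ ∷ T ≡ (B ++ τ ∷ []) ++ T
        assoc [] = refl
        assoc (b ∷ B) = cong (b ∷_) (assoc B)

-- Rebuilding a copy around a centre of the other colour

twoCol : ∀ c a → c ≡ a ⊎ c ≡ not a
twoCol true  true  = inj₁ refl
twoCol true  false = inj₂ refl
twoCol false true  = inj₂ refl
twoCol false false = inj₁ refl

alt-mono : ∀ c {k ℓ} b → k ≤ ℓ → alt c k b ≤ alt c ℓ b
alt-mono c b z≤n = z≤n
alt-mono c b (s≤s h) = +-monoʳ-≤ (δ c b) (alt-mono (not c) b h)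

-- How much of a leg of length ℓ of the new copy is grown inside Γ: for a leg whose head has the colour of
-- the old centre everything before the last vertex of that colour; otherwise everything, or everything but
-- the last vertex when ℓ is even.
data PlanA : ℕ → ℕ → Set where
  short₁  : PlanA 0 1
  short₂  : PlanA 0 2
  more : ∀ {k ℓ} → PlanA k ℓ → PlanA (2 + k) (2 + ℓ)

data PlanB : ℕ → ℕ → Set where
  short₁  : PlanB 1 1
  short₂  : PlanB 1 2
  more : ∀ {k ℓ} → PlanB k ℓ → PlanB (2 + k) (2 + ℓ)

planA : ∀ ℓ → 0 < ℓ → ∃[ k ] PlanA k ℓ
planA 1 _ = 0 , short₁
planA 2 _ = 0 , short₂
planA (suc (suc (suc ℓ))) _ = let (k , h) = planA (suc ℓ) (s≤s z≤n) in 2 + k , more h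

planB : ∀ ℓ → 0 < ℓ → ∃[ k ] PlanB k ℓ
planB 1 _ = 1 , short₁
planB 2 _ = 1 , short₂
planB (suc (suc (suc ℓ))) _ = let (k , h) = planB (suc ℓ) (s≤s z≤n) in 2 + k , more h

planA-≤ : ∀ {k ℓ} → PlanA k ℓ → k ≤ ℓ
planA-≤ short₁ = z≤n
planA-≤ short₂ = z≤n
planA-≤ (more h) = s≤s (s≤s (planA-≤ h))

planB-≤ : ∀ {k ℓ} → PlanB k ℓ → k ≤ ℓ
planB-≤ short₁ = s≤s z≤n
planB-≤ short₂ = s≤s z≤n
planB-≤ (more h) = s≤s (s≤s (planB-≤ h))

planA-len : ∀ {k ℓ} → PlanA k ℓ → ℓ ≡ k + 1 ⊎ ℓ ≡ k + 2
planA-len short₁ = inj₁ refl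
planA-len short₂ = inj₂ refl
planA-len (more h) with planA-len h
... | inj₁ refl = inj₁ refl
... | inj₂ refl = inj₂ refl

planB-len : ∀ {k ℓ} → PlanB k ℓ → ℓ ≡ k ⊎ ℓ ≡ k + 1
planB-len short₁ = inj₁ refl
planB-len short₂ = inj₂ refl
planB-len (more h) with planB-len h
... | inj₁ refl = inj₁ refl
... | inj₂ refl = inj₂ refl

planA-a : ∀ a {k ℓ} → PlanA k ℓ → suc (alt a k a) ≤ alt a ℓ a
planA-a true short₁ = ≤-refl
planA-a false short₁ = ≤-refl
planA-a true short₂ = ≤-refl
planA-a false short₂ = ≤-refl
planA-a true (more h) = s≤s (planA-a true h)
planA-a false (more h) = s≤s (planA-a false h)

alt-b : ∀ a ℓ → alt a ℓ (not a) ≤ alt (not a) ℓ (not a)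
alt-b a zero = z≤n
alt-b true (suc zero) = z≤n
alt-b false (suc zero) = z≤n
alt-b true (suc (suc ℓ)) = s≤s (alt-b true ℓ)
alt-b false (suc (suc ℓ)) = s≤s (alt-b false ℓ)

planA-two : ∀ a {k ℓ} → PlanA k ℓ → ℓ ≡ k + 2 → suc (alt a k (not a)) ≤ alt (not a) ℓ (not a)
planA-two true short₂ e = ≤-refl
planA-two false short₂ e = ≤-refl
planA-two true (more h) e = s≤s (planA-two true h (suc-injective (suc-injective e)))
planA-two false (more h) e = s≤s (planA-two false h (suc-injective (suc-injective e)))

planB-b : ∀ a {k ℓ} → PlanB k ℓ → suc (alt a k (not a)) ≤ alt (not a) ℓ (not a)
planB-b true short₁ = ≤-refl
planB-b false short₁ = ≤-refl
planB-b true short₂ = ≤-refl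
planB-b false short₂ = ≤-refl
planB-b true (more h) = s≤s (planB-b true h)
planB-b false (more h) = s≤s (planB-b false h)

module _ {n p : ℕ} (H : Host n p) where
  open Host H
  open Legs H

  planA-col : ∀ c {k ℓ} → PlanA k ℓ → colAt c k ≡ c
  planA-col c short₁ = refl
  planA-col c short₂ = refl
  planA-col c (more {k} h) = trans (cong (λ d → colAt d k) (not-not c)) (planA-col c h)

  cc-∈ : ∀ b {x L} → x ∈ L → δ (col x) b ≤ cc b L
  cc-∈ b (here refl) = m≤m+n _ _
  cc-∈ b {L = y ∷ L} (there h) = ≤-trans (cc-∈ b h) (m≤n+m _ (δ (col y) b))

  -- Γ is the region outside a locked part of Z, and head j is the only vertex of the j-th locked leg that
  -- Γ may see.  The copy is centred at a vertex of the colour opposite to the old centre.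
  module Rebuild (Z Γ : Fin n → Set) (Z⊆V : ∀ {x} → Z x → x ∈ Vs) (Γ⊆Z : ∀ {x} → Γ x → Z x)
    (good : ∀ {x} → Γ x → Free Z (λ _ → suc t) x)
    (a : Bool) (head inn : Fin p → Fin n)
    (head-R : ∀ c → sumF p (λ j → δ (col (head j)) c) ≤ t)
    (sees : ∀ {x y} → Γ x → Adj x y → Z y → NN (Γ y ⊎ (∃[ j ] y ≡ head j)))
    (innZ : ∀ j → col (head j) ≡ a → Z (inn j) × ¬ Γ (inn j) × Adj (head j) (inn j))
    (inn-inj : ∀ {i j} → col (head i) ≡ a → col (head j) ≡ a → inn i ≡ inn j → i ≡ j)
    where

    R : Bool → ℕ
    R c = sumF p (λ j → δ (col (head j)) c)

    -- A vertex of `Γ` has at least `t + 1` neighbours in `Z`, and those outside `Γ` are heads; what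
    -- remains after subtracting the heads of the relevant colour is the supply inside `Γ`.
    K : Bool → ℕ
    K c = suc t ∸ R c

    heads : List (Fin n)
    heads = concatF p (λ j → head j ∷ [])

    freeΓ : ∀ {y} → Γ y → Free Γ K y
    freeΓ {y} g L lt = do
      let c = not (col y)
      (w , ad , zw , w∉) ← good g (heads ++ L) (≤-trans (s≤s (≤-reflexive (trans (cc-++ c heads L)
        (cong (_+ cc c L) (trans (cc-concatF c p _) (sumF-cong p λ j → +-identityʳ (δ (col (head j)) c)))))))
        (≤-trans (≤-reflexive (cong suc (+-comm (R c) (cc c L)))) (m<n∸o⇒m+o<n′ (cc c L) lt)))
      s ← sees g ad zw
      case s of λ
        { (inj₁ γ) → pure (w , ad , γ , w∉ ∘ ∈-++⁺ʳ heads)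
        ; (inj₂ (j , refl)) → absurd (w∉ (∈-++⁺ˡ (∈-concatF j (here refl)))) }
      where
      m<n∸o⇒m+o<n′ : ∀ m {n o} → m < n ∸ o → m + o < n
      m<n∸o⇒m+o<n′ m {n} {o} h = case o ≤? n of λ
        { (yes o≤n) → subst (suc m + o ≤_) (m∸n+n≡m o≤n) (+-monoˡ-≤ o h)
        ; (no o≰n) → ⊥-elim (<⇒≱ (≤-trans (s≤s z≤n) h) (≤-reflexive (m≤n⇒m∸n≡0 (<⇒≤ (≰⇒> o≰n))))) }

    fit : ∀ {m} c → m + R c ≤ suc t → m ≤ K c
    fit {m} c h = subst (_≤ K c) (m+n∸n≡m m (R c)) (∸-monoˡ-≤ (R c) h)

    centre : ∃ Γ → NN (∃[ w ] Γ w × col w ≡ not a)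
    centre (v , g) = case twoCol (col v) a of λ
      { (inj₂ e) → pure (v , g , e)
      ; (inj₁ e) → do
          (w , ad , gw , _) ← freeΓ g [] (fit _ (s≤s (head-R _)))
          pure (w , gw , trans (colA ad) (cong not e)) }

    Plan : Fin p → ℕ → Set
    Plan j k = (col (head j) ≡ a × PlanA k (ls j)) ⊎ (col (head j) ≡ not a × PlanB k (ls j))

    plan : ∀ j → ∃ (Plan j)
    plan j = case twoCol (col (head j)) a of λ
      { (inj₁ e) → let (k , h) = planA _ (ls>0 j) in k , inj₁ (e , h)
      ; (inj₂ e) → let (k , h) = planB _ (ls>0 j) in k , inj₂ (e , h) }

    k : Fin p → ℕ
    k j = proj₁ (plan j)

    k≤ls : ∀ j → k j ≤ ls j
    k≤ls j with plan j
    ... | _ , inj₁ (_ , h) = planA-≤ h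
    ... | _ , inj₂ (_ , h) = planB-≤ h

    -- If the head has colour `a`, the planned part of the leg omits the last vertex of that colour,
    -- which pays for the head.
    count-a : ∀ j → alt a (k j) a + δ (col (head j)) a ≤ alt a (ls j) a
    count-a j with plan j
    ... | m , inj₁ (e , h) = ≤-trans (≤-reflexive (trans (cong (λ c → alt a m a + δ c a) e)
              (trans (cong (alt a m a +_) (δ-refl a)) (+-comm _ 1)))) (planA-a a h)
    ... | m , inj₂ (e , h) = ≤-trans (≤-reflexive (trans (cong (λ c → alt a m a + δ c a) e)
              (trans (cong (alt a m a +_) (δ-not′ a)) (+-identityʳ _)))) (alt-mono a a (planB-≤ h))
      where
      δ-not′ : ∀ a → δ (not a) a ≡ 0
      δ-not′ true = refl
      δ-not′ false = refl

    -- A leg whose head has colour a may already have its full length here.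
    count-b : ∀ j m → m ≡ k j ⊎ (m ≤ ls j × col (head j) ≡ a) →
      alt a m (not a) + δ (col (head j)) (not a) ≤ alt (not a) (ls j) (not a)
    count-b j m c with plan j | c
    ... | _ , inj₁ (e , h) | inj₁ refl = ≤-trans (≤-reflexive (trans (cong (λ c → alt a m (not a) + δ c (not a)) e)
              (trans (cong (alt a m (not a) +_) (δ-not a)) (+-identityʳ _))))
              (≤-trans (alt-mono a (not a) (planA-≤ h)) (alt-b a (ls j)))
    ... | _ , inj₂ (e , h) | inj₁ refl = ≤-trans (≤-reflexive (trans (cong (λ c → alt a m (not a) + δ c (not a)) e)
              (trans (cong (alt a m (not a) +_) (δ-refl (not a))) (+-comm _ 1)))) (planB-b a h)
    ... | _ | inj₂ (m≤ , e) = ≤-trans (≤-reflexive (trans (cong (λ c → alt a m (not a) + δ c (not a)) e)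
              (trans (cong (alt a m (not a) +_) (δ-not a)) (+-identityʳ _))))
              (≤-trans (alt-mono a (not a) m≤) (alt-b a (ls j)))

    sumF-+ : ∀ q (f g : Fin q → ℕ) → sumF q f + sumF q g ≡ sumF q (λ j → f j + g j)
    sumF-+ zero f g = refl
    sumF-+ (suc q) f g = trans (swap4 (f zero) _ (g zero) _) (cong (f zero + g zero +_) (sumF-+ q (f ∘ suc) (g ∘ suc)))
      where
      swap4 : ∀ x y z w → (x + y) + (z + w) ≡ (x + z) + (y + w)
      swap4 x y z w = trans (+-assoc x y (z + w)) (trans (cong (x +_) (trans (sym (+-assoc y z w))
        (trans (cong (_+ w) (+-comm y z)) (+-assoc z y w)))) (sym (+-assoc x z (y + w))))

    total-a : ∀ {m : Fin p → ℕ} → (∀ j → m j ≤ ls j) → sumF p (λ j → alt a (m j) a) ≤ t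
    total-a h = ≤-trans (sumF-mono p λ j → alt-mono a a (h j))
      (≤-trans (≤-reflexive (sumF-cong p λ j → cong (λ c → alt c (ls j) a) (sym (not-not a))))
      (≤-trans (m≤n+m _ (δ (not a) a)) (cap (not a) a)))

    -- The capacity for `not a` is read off the spider with a centre of colour `a`, whose legs begin
    -- with `not a`, although the copy under construction has its centre in the other class. This
    -- gains enough for the heads of colour `not a`.
    total-b : sumF p (λ j → alt (not a) (ls j) (not a)) ≤ t
    total-b = ≤-trans (m≤n+m _ (δ a (not a))) (cap a (not a))

    module Build (w : Fin n) (γw : Γ w) (w-col : col w ≡ not a) where

      Cur : (Fin p → List (Fin n)) → Set
      Cur cur = Spider Z w (λ j → length (cur j)) cur

      cc-a : ∀ {cur} → Cur cur → (∀ j → length (cur j) ≤ ls j) → cc a (vs w cur) ≤ t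
      cc-a {cur} S h = ≤-trans (≤-reflexive (trans (Spider.cc-vs S a) (cong₂ _+_
        (trans (cong (λ c → δ c a) w-col) (δ-na a)) (sumF-cong p λ j → cong (λ c → alt c (length (cur j)) a)
          (trans (cong not w-col) (not-not a)))))) (total-a h)
        where
        δ-na : ∀ a → δ (not a) a ≡ 0
        δ-na true = refl
        δ-na false = refl

      cc-cur : ∀ {cur} → Cur cur → (∀ j → length (cur j) ≤ ls j) → ∀ b → cc b (vs w cur) ≤ t
      cc-cur S h b = ≤-trans (≤-reflexive (Spider.cc-vs S b))
        (≤-trans (+-monoʳ-≤ (δ (col w) b) (sumF-mono p λ j → alt-mono _ b (h j))) (cap (col w) b))

      extend : ∀ {cur} → Cur cur → ∀ j X {y} → Ends w (cur j) y → Linked y X → (∀ {x} → x ∈ X → Z x) →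
        Unique X → (∀ {x} → x ∈ X → x ∉ vs w cur) → Cur (upd cur j (cur j ++ X))
      extend {cur} S j X e l zs u d = set-leg S j (cur j ++ X) (linked-++ e (S.linked j) l)
          (λ r → [ S.all j , zs ]′ (∈-++⁻ (cur j) r))
          (unique-++ (S.uniq j) u λ q r → d r (∈-vs {leg = cur} j q))
          (λ r → case ∈-++⁻ (cur j) r of λ { (inj₁ q) → inj₁ q ; (inj₂ q) → inj₂ (d q) })
        where module S = Spider S

      end-Γ : ∀ {L y} → (∀ {x} → x ∈ L → Γ x) → Ends w L y → Γ y
      end-Γ h e = case ends-∈ e of λ { (inj₁ refl) → γw ; (inj₂ q) → h q }

      -- Legs whose heads have colour `a` are finished before the others, because the count in
      -- `room` needs the others at their planned lengths. By `inner∉` an inner vertex is occupied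
      -- only together with its head, so a leg that reaches a free head can continue to the inner
      -- vertex behind it.
      record Phase₂ (todo : List (Fin p)) (cur : Fin p → List (Fin n)) : Set where
        field
          spider : Cur cur
          doneA  : ∀ j → col (head j) ≡ a → j ∉ todo → length (cur j) ≡ ls j
          fresh  : ∀ j → j ∈ todo ⊎ col (head j) ≡ not a → length (cur j) ≡ k j × (∀ {x} → x ∈ cur j → Γ x)
          inner∉ : ∀ j → col (head j) ≡ a → head j ∉ vs w cur → inn j ∉ vs w cur

      advance : ∀ {j todo cur} → Phase₂ (j ∷ todo) cur → col (head j) ≡ a → j ∉ todo → ∀ X {y} → Ends w (cur j) y →
        Linked y X → (∀ {x} → x ∈ X → Z x) → Unique X → (∀ {x} → x ∈ X → x ∉ vs w cur) →
        length (cur j ++ X) ≡ ls j →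
        (∀ i → col (head i) ≡ a → head i ∉ X → inn i ∉ X) →
        Phase₂ todo (upd cur j (cur j ++ X))
      advance {j} {todo} {cur} P ja j∉ X e l zs u d ln inn∉ = record
        { spider = extend spider j X e l zs u d
        ; doneA = upd-elim (λ i L → col (head i) ≡ a → i ∉ todo → length L ≡ ls i) (λ _ _ → ln)
            (λ i ne ia i∉ → doneA i ia λ { (here refl) → ne refl ; (there q) → i∉ q })
        ; fresh = upd-elim (λ i L → i ∈ todo ⊎ col (head i) ≡ not a → length L ≡ k i × (∀ {x} → x ∈ L → Γ x))
            (λ { (inj₁ q) → ⊥-elim (j∉ q) ; (inj₂ jb) → ⊥-elim (not≢ a (trans (sym ja) jb)) })
            (λ i ne → λ { (inj₁ q) → fresh i (inj₁ (there q)) ; (inj₂ q) → fresh i (inj₂ q) })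
        ; inner∉ = λ i ia h∉ q → case vs-upd⁻ {X = cur j ++ X} {cur} q of λ
            { (inj₂ r) → inner∉ i ia (λ r' → h∉ (grow-vs r')) r
            ; (inj₁ r) → case ∈-++⁻ (cur j) r of λ
              { (inj₁ r') → inner∉ i ia (λ r'' → h∉ (grow-vs r'')) (∈-vs {leg = cur} j r')
              ; (inj₂ r') → inn∉ i ia (λ r'' → h∉ (vs-upd⁺ j (∈-++⁺ʳ (cur j) r''))) r' } } }
        where
        open Phase₂ P
        grow-vs : ∀ {x} → x ∈ vs w cur → x ∈ vs w (upd cur j (cur j ++ X))
        grow-vs q with ∈-vs⁻ q
        ... | inj₁ refl = here refl
        ... | inj₂ (i , r) with i ≟F j
        ...   | yes refl = vs-upd⁺ j (∈-++⁺ˡ r)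
        ...   | no ne = vs-upd-other i ne r

      phase₂ : ∀ todo {cur} → Unique todo → (∀ {j} → j ∈ todo → col (head j) ≡ a) → Phase₂ todo cur → NN (∃ (Phase₂ []))
      phase₂ [] u ta P = pure (_ , P)
      phase₂ (j ∷ todo) {cur} u ta P = do
          (x , ad , zx , x∉) ← good γy (vs w cur) (s≤s (subst (λ c → cc c (vs w cur) ≤ t) (sym (trans (cong not y-col) (not-not a)))
            (cc-a spider len≤)))
          let x-col = trans (colA ad) (trans (cong not y-col) (not-not a))
          case planA-len planJ of λ
            { (inj₁ e₁) → phase₂ todo (unique-tail u) (ta ∘ there) (advance P ja (unique-∉ u) (x ∷ []) e
                (ad ∷ []) (λ { (here refl) → zx }) ([] ∷ []) (λ { (here refl) → x∉ })
                (trans (length-++ (cur j)) (trans (cong (_+ 1) (proj₁ (fresh j (inj₁ (here refl))))) (sym e₁)))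
                (λ i ia _ → λ { (here refl) → inn-col i ia x-col }))
            ; (inj₂ e₂) → do
                s ← sees γy ad zx
                case s of λ
                  { (inj₁ γx) → do
                      (v , ad' , γv , v∉) ← freeΓ γx (vs w cur) (fit _ (subst
                        (λ c → suc (cc c (vs w cur)) + R c ≤ suc t) (sym (cong not x-col)) (room e₂)))
                      phase₂ todo (unique-tail u) (ta ∘ there) (advance P ja (unique-∉ u) (x ∷ v ∷ []) e
                        (ad ∷ ad' ∷ []) (λ { (here refl) → zx ; (there (here refl)) → Γ⊆Z γv })
                        (unique-∷ (λ { (here refl) → adj-≢ ad' refl }) ([] ∷ []))
                        (λ { (here refl) → x∉ ; (there (here refl)) → v∉ })
                        (long e₂)
                        (λ i ia _ → λ { (here refl) → inn-col i ia x-col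
                                      ; (there (here refl)) → proj₁ (proj₂ (innZ i ia)) γv }))
                  ; (inj₂ (i , refl)) → let (zi , γi , ai) = innZ i x-col in
                      phase₂ todo (unique-tail u) (ta ∘ there) (advance P ja (unique-∉ u) (head i ∷ inn i ∷ []) e
                        (ad ∷ ai ∷ []) (λ { (here refl) → zx ; (there (here refl)) → zi })
                        (unique-∷ (λ { (here q) → adj-≢ ai q }) ([] ∷ []))
                        (λ { (here refl) → x∉ ; (there (here refl)) → inner∉ i x-col x∉ })
                        (long e₂)
                        (λ i' ia h∉ → λ { (here q) → inn-col i' ia (trans (cong col q) x-col)
                                        ; (there (here q)) → h∉ (here (cong head (inn-inj ia x-col q))) })) } }
        where
        open Phase₂ P
        ja = ta (here refl)
        y = proj₁ (ends w (cur j))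
        e = proj₂ (ends w (cur j))
        γy : Γ y
        γy = end-Γ (proj₂ (fresh j (inj₁ (here refl)))) e
        planOf : ∀ {i} → col (head i) ≡ a → PlanA (k i) (ls i)
        planOf {i} ia with plan i
        ... | _ , inj₁ (_ , h) = h
        ... | _ , inj₂ (ib , _) = ⊥-elim (not≢ a (trans (sym ia) ib))
        planJ : PlanA (k j) (ls j)
        planJ = planOf ja
        y-col : col y ≡ not a
        y-col = trans (ends-col e (Spider.linked spider j)) (trans (cong (colAt (col w)) (proj₁ (fresh j (inj₁ (here refl)))))
          (trans (planA-col (col w) planJ) w-col))
        status : ∀ i → length (cur i) ≡ k i ⊎ (length (cur i) ≤ ls i × col (head i) ≡ a)
        status i = case twoCol (col (head i)) a of λ
          { (inj₂ ib) → inj₁ (proj₁ (fresh i (inj₂ ib)))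
          ; (inj₁ ia) → case i ∈? (j ∷ todo) of λ
            { (yes q) → inj₁ (proj₁ (fresh i (inj₁ q)))
            ; (no q) → inj₂ (≤-reflexive (doneA i ia q) , ia) } }
        len≤ : ∀ i → length (cur i) ≤ ls i
        len≤ i = case status i of λ { (inj₁ e) → ≤-trans (≤-reflexive e) (k≤ls i) ; (inj₂ (h , _)) → h }
        inn-col : ∀ i → col (head i) ≡ a → ¬ (col (inn i) ≡ a)
        inn-col i ia q = not≢ a (trans (sym q) (trans (colA (proj₂ (proj₂ (innZ i ia)))) (cong not ia)))
        long : ∀ {x v} → ls j ≡ k j + 2 → length (cur j ++ x ∷ v ∷ []) ≡ ls j
        long e₂ = trans (length-++ (cur j)) (trans (cong (_+ 2) (proj₁ (fresh j (inj₁ (here refl))))) (sym e₂))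
        -- The leg `j` still lacks a vertex of colour `not a`, so the comparison of sums is strict;
        -- the unit gained makes room for the centre `w`.
        room : ls j ≡ k j + 2 → suc (cc (not a) (vs w cur)) + R (not a) ≤ suc t
        room e₂ = s≤s (begin
          cc (not a) (vs w cur) + R (not a)
            ≡⟨ cong (_+ R (not a)) (trans (Spider.cc-vs spider (not a)) (cong₂ _+_
                 (trans (cong (λ c → δ c (not a)) w-col) (δ-refl (not a)))
                 (sumF-cong p λ i → cong (λ c → alt c (length (cur i)) (not a)) (trans (cong not w-col) (not-not a))))) ⟩
          suc (sumF p (λ i → alt a (length (cur i)) (not a)) + R (not a))
            ≡⟨ cong suc (sumF-+ p _ _) ⟩
          suc (sumF p (λ i → alt a (length (cur i)) (not a) + δ (col (head i)) (not a)))
            ≤⟨ sumF-mono-< p (λ i → count-b i _ (status i)) j (≤-trans (s≤s (≤-reflexive (trans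
                 (cong₂ (λ m c → alt a m (not a) + δ c (not a)) (proj₁ (fresh j (inj₁ (here refl)))) ja)
                 (trans (cong (alt a (k j) (not a) +_) (δ-not a)) (+-identityʳ _)))))
                 (planA-two a planJ e₂)) ⟩
          sumF p (λ i → alt (not a) (ls i) (not a))
            ≤⟨ total-b ⟩
          t ∎)
          where open ≤-Reasoning

      record Phase₃ (todo : List (Fin p)) (cur : Fin p → List (Fin n)) : Set where
        field
          spider : Cur cur
          done   : ∀ j → j ∉ todo → length (cur j) ≡ ls j
          fresh  : ∀ j → j ∈ todo → (length (cur j) ≡ ls j ⊎ suc (length (cur j)) ≡ ls j) × (∀ {x} → x ∈ cur j → Γ x)

      phase₃ : ∀ todo {cur} → Unique todo → Phase₃ todo cur → NN (∃ (Phase₃ []))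
      phase₃ [] u P = pure (_ , P)
      phase₃ (j ∷ todo) {cur} u P = case proj₁ (fresh j (here refl)) of λ
        { (inj₁ e) → phase₃ todo (unique-tail u) record
            { spider = spider
            ; done = λ i i∉ → case (i ≟F j) of λ
                { (yes refl) → e ; (no ne) → done i λ { (here refl) → ne refl ; (there q) → i∉ q } }
            ; fresh = λ i q → fresh i (there q) }
        ; (inj₂ ln) → do
            let (y , e) = ends w (cur j)
            (x , ad , zx , x∉) ← good (end-Γ (proj₂ (fresh j (here refl))) e) (vs w cur) (s≤s (cc-cur spider len≤ _))
            phase₃ todo (unique-tail u) record
              { spider = extend spider j (x ∷ []) e (ad ∷ []) (λ { (here refl) → zx }) ([] ∷ []) (λ { (here refl) → x∉ })
              ; done = upd-elim (λ i L → i ∉ todo → length L ≡ ls i)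
                  (λ _ → trans (length-++ (cur j)) (trans (+-comm _ 1) ln))
                  (λ i ne i∉ → done i λ { (here refl) → ne refl ; (there q) → i∉ q })
              ; fresh = upd-elim (λ i L → i ∈ todo → (length L ≡ ls i ⊎ suc (length L) ≡ ls i) × (∀ {x} → x ∈ L → Γ x))
                  (λ q → ⊥-elim (unique-∉ u q)) (λ i _ q → fresh i (there q)) } }
        where
        open Phase₃ P
        len≤ : ∀ i → length (cur i) ≤ ls i
        len≤ i = case i ∈? (j ∷ todo) of λ
          { (no i∉) → ≤-reflexive (done i i∉)
          ; (yes q) → case proj₁ (fresh i q) of λ
            { (inj₁ e) → ≤-reflexive e ; (inj₂ e) → ≤-trans (n≤1+n _) (≤-reflexive e) } }

      build : NN (∃[ leg ] Spider Z w ls leg)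
      build = do
        (cur₀ , S₀ , _) ← growAll freeΓ p k (w ∷ []) γw (here refl) λ c → fit c (start c (twoCol c a))
        let module S₀ = Spider S₀
        (cur₁ , P₁) ← phase₂ todoA (unique-filter⁺ isA (allFin⁺ p))
          (λ q → proj₂ (filter-∈⁻ isA (allFin p) q))
          record
            { spider = re-len (spider-map Γ⊆Z S₀) (λ _ → refl)
            ; doneA = λ j ja j∉ → ⊥-elim (j∉ (filter-∈ isA (∈-allFin j) ja))
            ; fresh = λ j _ → S₀.len j , S₀.all j
            ; inner∉ = λ j ja _ q → proj₁ (proj₂ (innZ j ja)) (S₀.in-Z q) }
        let module P₁ = Phase₂ P₁
        (cur₂ , P₂) ← phase₃ todoB (unique-filter⁺ (¬? ∘ isA) (allFin⁺ p)) record
          { spider = P₁.spider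
          ; done = λ j j∉ → case isA j of λ
              { (yes ja) → P₁.doneA j ja (λ ())
              ; (no jb) → ⊥-elim (j∉ (filter-∈ (¬? ∘ isA) (∈-allFin j) jb)) }
          ; fresh = λ j q → let jb = isB j (proj₂ (filter-∈⁻ (¬? ∘ isA) (allFin p) q)) ; f = P₁.fresh j (inj₂ jb) in
              (case planB-len (planOf jb) of λ
                { (inj₁ e) → inj₁ (trans (proj₁ f) (sym e))
                ; (inj₂ e) → inj₂ (trans (cong suc (proj₁ f)) (trans (+-comm 1 _) (sym e))) }) , proj₂ f }
        pure (cur₂ , re-len (Phase₃.spider P₂) λ j → Phase₃.done P₂ j λ ())
        where
        isA : ∀ j → Dec (col (head j) ≡ a)
        isA j = col (head j) ≟B a
        isB : ∀ j → ¬ (col (head j) ≡ a) → col (head j) ≡ not a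
        isB j h = [ ⊥-elim ∘ h , (λ e → e) ]′ (twoCol (col (head j)) a)
        planOf : ∀ {i} → col (head i) ≡ not a → PlanB (k i) (ls i)
        planOf {i} ib with plan i
        ... | _ , inj₁ (ia , _) = ⊥-elim (not≢ a (trans (sym ia) ib))
        ... | _ , inj₂ (_ , h) = h
        todoA = filter isA (allFin p)
        todoB = filter (¬? ∘ isA) (allFin p)
        -- In each colour the planned legs and the heads together stay within `t`; the extra unit of
        -- `suc t` is for the centre.
        start : ∀ c → c ≡ a ⊎ c ≡ not a → cc c (w ∷ []) + sumF p (λ j → alt (not (col w)) (k j) c) + R c ≤ suc t
        start c h = ≤-trans (≤-reflexive (trans (+-assoc (cc c (w ∷ [])) _ _) (cong (cc c (w ∷ []) +_)
          (trans (cong (_+ R c) (sumF-cong p λ j → cong (λ d → alt d (k j) c) (trans (cong not w-col) (not-not a))))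
            (sumF-+ p _ _))))) (go h)
          where
          go : c ≡ a ⊎ c ≡ not a → cc c (w ∷ []) + sumF p (λ j → alt a (k j) c + δ (col (head j)) c) ≤ suc t
          go (inj₁ refl) = +-mono-≤ (cc≤length c (w ∷ [])) (≤-trans (sumF-mono p count-a) (total-a λ _ → ≤-refl))
          go (inj₂ refl) = +-mono-≤ (cc≤length c (w ∷ [])) (≤-trans (sumF-mono p λ j → count-b j (k j) (inj₁ refl)) total-b)

-- Every vertex of Z is avoided by some copy

module Exchange {n p : ℕ} (H : Host n p) (Z : Fin n → Set) (Z⊆V : ∀ {x} → Z x → x ∈ Host.Vs H) where
  open Host H
  open Legs H

  module _ (good : ∀ {y} → Z y → Avoided Z Z⊆V y → Good Z Z⊆V y) where
    open DT Z Z⊆V good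

    Pre : Set
    Pre = Fin n × (Fin p → List (Fin n))

    Extends : Pre → (Fin p → List (Fin n)) → Set
    Extends (z , pre) leg = Copy Z Z⊆V z leg × (∀ j → ∃[ tl ] leg j ≡ pre j ++ tl)

    -- The prefixes hold what no rerouting is yet known to free. A whole copy is a legitimate start,
    -- and the last component keeps the region outside the prefixes nonempty, so that a new centre
    -- can be found there.
    Locked : Pre → Set
    Locked (z , pre) = ∃ (Extends (z , pre)) ×
      (∀ y → Z y → y ∉ vs z pre → NN (∃[ leg ] Extends (z , pre) leg × y ∉ vs z leg)) ×
      (∃[ v ] Z v × v ∉ vs z pre)

    size : Pre → ℕ
    size (z , pre) = sumF p (λ j → length (pre j))

    -- By unlocking, a vertex that sees a locked one allows the rest of that prefix to be released.
    shrink : ∀ {z pre} → Locked (z , pre) → ∀ {y} → Z y → y ∉ vs z pre → ∀ j {p₁ s p₂ x} →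
      pre j ≡ p₁ ++ s ∷ p₂ → Ends z p₁ x → Adj x y → NN (∃[ pre' ] Locked (z , pre') × size (z , pre') < size (z , pre))
    shrink {z} {pre} ((leg , S , ex) , av , (v , zv , v∉)) {y} zy y∉ j {p₁} {s} {p₂} eq e ad = do
        (leg₁ , (S₁ , ex₁) , y∉₁) ← av _ zy y∉
        pure (upd pre j p₁ , ((leg , S , weaken ex) , avoid S₁ ex₁ y∉₁ , (v , zv , λ q → v∉ (sub q))) , smaller)
      where
      assoc : ∀ (B : List (Fin n)) {C D} → (B ++ C) ++ D ≡ B ++ (C ++ D)
      assoc B = ++-assoc B _ _
      weaken : ∀ {leg : Fin p → List (Fin n)} → (∀ j → ∃[ tl ] leg j ≡ pre j ++ tl) → ∀ i → ∃[ tl ] leg i ≡ upd pre j p₁ i ++ tl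
      weaken {leg} ex = upd-elim (λ i L → ∃[ tl ] leg i ≡ L ++ tl)
        (let (tl , e) = ex j in s ∷ p₂ ++ tl , trans e (trans (cong (_++ tl) eq) (assoc p₁)))
        (λ i _ → ex i)
      sub : ∀ {x} → x ∈ vs z (upd pre j p₁) → x ∈ vs z pre
      sub q with vs-upd⁻ {X = p₁} {pre} q
      ... | inj₁ r = ∈-vs {leg = pre} j (subst (_ ∈_) (sym eq) (∈-++⁺ˡ r))
      ... | inj₂ r = r
      smaller : size (z , upd pre j p₁) < size (z , pre)
      smaller = sumF-mono-< p
        (upd-elim (λ i L → length L ≤ length (pre i)) (<⇒≤ shorter) (λ _ _ → ≤-refl)) j
        (≤-trans (≤-reflexive (cong (suc ∘ length) (upd-same pre j p₁))) shorter)
        where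
        shorter : length p₁ < length (pre j)
        shorter = ≤-trans (s≤s (m≤m+n _ (length p₂))) (≤-reflexive (trans (cong suc (sym (length-++ p₁)))
          (trans (sym (length-++∷ p₁)) (cong length (sym eq)))))
      avoid : ∀ {leg₁} → Copy Z Z⊆V z leg₁ → (∀ j → ∃[ tl ] leg₁ j ≡ pre j ++ tl) → y ∉ vs z leg₁ →
        ∀ y' → Z y' → y' ∉ vs z (upd pre j p₁) → NN (∃[ leg ] Extends (z , upd pre j p₁) leg × y' ∉ vs z leg)
      avoid {leg₁} S₁ ex₁ y∉₁ y' zy' y'∉ = case y' ∈? vs z pre of λ
        { (no q) → do
            (leg , (S , ex) , r) ← av _ zy' q
            pure (leg , (S , weaken ex) , r)
        ; (yes q) → do
            let (tl , e₁) = ex₁ j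
            (tl' , S' , r) ← unlock S₁ j p₁ (s ∷ p₂ ++ tl) (trans e₁ (trans (cong (_++ tl) eq) (assoc p₁)))
              e zy y∉₁ ad (∈-++⁺ˡ (rest q))
            pure (_ , (S' , upd-elim (λ i L → ∃[ tl ] L ≡ upd pre j p₁ i ++ tl)
                (tl' , cong (_++ tl') (sym (upd-same pre j p₁))) (λ i ne → let (tl , e) = ex₁ i in
                  tl , trans e (cong (_++ tl) (sym (upd-other pre p₁ ne))))) , r) }
        where
        rest : y' ∈ vs z pre → y' ∈ s ∷ p₂
        rest q with ∈-vs⁻ {leg = pre} q
        ... | inj₁ refl = ⊥-elim (y'∉ (here refl))
        ... | inj₂ (i , r) with i ≟F j
        ...   | no ne = ⊥-elim (y'∉ (vs-upd-other {leg = pre} i ne r))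
        ...   | yes refl with ∈-++⁻ p₁ (subst (y' ∈_) eq r)
        ...     | inj₁ r' = ⊥-elim (y'∉ (vs-upd⁺ {leg = pre} j r'))
        ...     | inj₂ r' = r'

    lastOf : ∀ (q : Fin n) L → ∃₂ λ A h → q ∷ L ≡ A ++ h ∷ []
    lastOf q [] = [] , q , refl
    lastOf q (r ∷ L) with lastOf r L
    ... | A , h , e = q ∷ A , h , cong (q ∷_) e

    recentre : ∀ {z pre} → Locked (z , pre) → (∀ q → Locked q → size (z , pre) ≤ size q) →
      NN (∃[ w ] ∃[ leg ] Copy Z Z⊆V w leg × Z w × NN (Avoided Z Z⊆V w))
    recentre {z} {pre} lk@((leg , S , ex) , av , (v , zv , v∉)) mn = do
        d ← em (∃[ y ] Z y × y ∉ vs z pre × Adj z y)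
        case d of λ
          { (inj₁ (y , zy , y∉ , ad)) → small y zy y∉ ad
          ; (inj₂ none) → large λ zy y∉ ad → none (_ , zy , y∉ , ad) }
      where
      module S = Spider S
      Γ : Fin n → Set
      Γ y = Z y × y ∉ vs z pre
      avoided : ∀ {y} → Γ y → NN (Avoided Z Z⊆V y)
      avoided (zy , y∉) = do
        (leg' , (S' , _) , r) ← av _ zy y∉
        pure (z , leg' , S' , r)
      goodΓ : ∀ {y} → Γ y → Free Z (λ _ → suc t) y
      goodΓ γ L h = do
        a ← avoided γ
        good (proj₁ γ) a L h
      locked : ∀ {y} → Γ y → ∀ j {p₁ s p₂ x} → pre j ≡ p₁ ++ s ∷ p₂ → Ends z p₁ x → Adj x y → NN ⊥
      locked (zy , y∉) j eq e ad = do
        (pre' , lk' , lt) ← shrink lk zy y∉ j eq e ad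
        pure (<⇒≱ lt (mn _ lk'))
      pre⊆leg : ∀ {j x} → x ∈ pre j → x ∈ leg j
      pre⊆leg {j} q = subst (_ ∈_) (sym (proj₂ (ex j))) (∈-++⁺ˡ q)

      -- By minimality a neighbour of `z` outside the prefixes forces all prefixes to be empty. Then
      -- only `z` is locked, each other vertex of `Z` loses at most one of its `t + 1` neighbours,
      -- and the greedy embedding works.
      small : ∀ y → Z y → y ∉ vs z pre → Adj z y → _
      small y zy y∉ ad = do
          (leg' , S') ← greedy {Z = Γ} {K = λ _ → t} free (λ _ → ≤-refl) (zv , v∉)
          pure (v , leg' , spider-map proj₁ S' , zv , avoided (zv , v∉))
        where
        empty : ∀ j → NN (pre j ≡ [])
        empty j with pre j in eq
        ... | [] = pure refl
        ... | s ∷ p₂ = do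
          () ← locked (zy , y∉) j {[]} eq [] ad
        free : ∀ {y} → Γ y → Free Γ (λ _ → t) y
        free γ L h = do
          (w , a , zw , w∉) ← goodΓ γ (z ∷ L) (s≤s (≤-trans (+-monoˡ-≤ _ (δ≤1 (col z) _)) h))
          e ← commute-Fin p empty
          pure (w , a , (zw , λ q → case ∈-vs⁻ {leg = pre} q of λ
            { (inj₁ refl) → w∉ (here refl)
            ; (inj₂ (j , r)) → case subst (w ∈_) (e j) r of λ () }) , w∉ ∘ there)

      -- Now `z` sees nothing outside the prefixes, so no prefix is empty. By minimality the region
      -- outside sees only the last vertex of each prefix, which is the situation of `Rebuild`.
      large : (∀ {y} → Z y → y ∉ vs z pre → ¬ Adj z y) → _
      large sep = do
          (w , γw , w-col) ← R.centre (v , zv , v∉)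
          (leg' , S') ← R.Build.build w γw w-col
          pure (w , leg' , S' , proj₁ γw , avoided γw)
        where
        Tip : Fin p → Fin n → Set
        Tip j h = ∃[ A ] pre j ≡ A ++ h ∷ []
        tip : ∀ j → ∃ (Tip j)
        tip j with pre j in eq | ex j
        ... | q ∷ L | _ = let (A , h , e) = lastOf q L in h , A , e
        ... | [] | (tl , e) with leg j in eqL | S.len j
        ...   | [] | ln = ⊥-elim (<⇒≢ (ls>0 j) ln)
        ...   | τ ∷ L | _ = ⊥-elim (sep (S.all j τ∈) τ∉ (first-adj (subst (Linked z) eqL (S.linked j))))
          where
          τ∈ : τ ∈ leg j
          τ∈ = subst (τ ∈_) (sym eqL) (here refl)
          first-adj : Linked z (τ ∷ L) → Adj z τ
          first-adj (a ∷ _) = a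
          τ∉ : τ ∉ vs z pre
          τ∉ q with ∈-vs⁻ {leg = pre} q
          ... | inj₁ refl = S.cent∉ j τ∈
          ... | inj₂ (i , r) with S.disj (pre⊆leg r) τ∈
          ...   | refl = case subst (τ ∈_) eq r of λ ()
        head : Fin p → Fin n
        head j = proj₁ (tip j)
        head∈ : ∀ j → head j ∈ pre j
        head∈ j = let (h , A , e) = tip j in subst (h ∈_) (sym e) (∈-mid A)
        pre-linked : ∀ j → Linked z (pre j)
        pre-linked j = linked-++⁻ˡ (pre j) (subst (Linked z) (proj₂ (ex j)) (S.linked j))
        pre-unique : ∀ j → Unique (pre j)
        pre-unique j = unique-++ˡ (pre j) (subst Unique (proj₂ (ex j)) (S.uniq j))
        -- A head with the colour of `z` is not adjacent to `z`, so the vertex before it lies on the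
        -- same leg. Hence the inner vertices of different legs are distinct.
        Inn : Fin p → Fin n → Set
        Inn j u = col (head j) ≡ col z → u ∈ pre j × Adj (head j) u
        inner : ∀ j → ∃ (Inn j)
        inner j = go (pre j) (proj₁ (proj₂ (tip j))) (proj₂ (proj₂ (tip j))) (pre-linked j)
          where
          go : ∀ L A → L ≡ A ++ head j ∷ [] → Linked z L → ∃[ u ] (col (head j) ≡ col z → u ∈ L × Adj (head j) u)
          go _ [] refl (a ∷ _) = z , λ c → ⊥-elim (not≢ _ (trans (sym c) (colA a)))
          go _ (q ∷ A) refl l with ends q A
          ... | u , e with linked-++⁻ʳ (q ∷ e) l
          ...   | a ∷ _ = u , λ _ → (case ends-∈ e of λ { (inj₁ refl) → here refl ; (inj₂ r) → there (∈-++⁺ˡ r) }) , symA a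
        inn : Fin p → Fin n
        inn j = proj₁ (inner j)
        sees : ∀ {x y} → Γ x → Adj x y → Z y → NN (Γ y ⊎ (∃[ j ] y ≡ head j))
        sees {x} {y} γ ad zy with y ∈? vs z pre
        ... | no q = pure (inj₁ (zy , q))
        ... | yes q with ∈-vs⁻ {leg = pre} q
        ...   | inj₁ refl = ⊥-elim (sep (proj₁ γ) (proj₂ γ) (symA ad))
        ...   | inj₂ (j , r) with ∈-∃++ r
        ...     | A , s ∷ p₂ , e = do
                    () ← locked γ j {A ++ y ∷ []} {s} {p₂} (trans e (assoc A)) (ends-++∷ z A y) (symA ad)
          where
          assoc : ∀ A → A ++ y ∷ s ∷ p₂ ≡ (A ++ y ∷ []) ++ s ∷ p₂
          assoc [] = refl
          assoc (b ∷ A) = cong (b ∷_) (assoc A)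
        ...     | A , [] , e = pure (inj₂ (j , snoc-inj A (proj₁ (proj₂ (tip j))) (trans (sym e) (proj₂ (proj₂ (tip j))))))
          where
          snoc-inj : ∀ A B {x y : Fin n} → A ++ x ∷ [] ≡ B ++ y ∷ [] → x ≡ y
          snoc-inj [] [] refl = refl
          snoc-inj [] (_ ∷ []) ()
          snoc-inj [] (_ ∷ _ ∷ _) ()
          snoc-inj (_ ∷ []) [] ()
          snoc-inj (_ ∷ _ ∷ _) [] ()
          snoc-inj (_ ∷ A) (_ ∷ B) e = snoc-inj A B (∷-injectiveʳ e)
        head-R : ∀ c → sumF p (λ j → δ (col (head j)) c) ≤ t
        head-R c = ≤-trans (sumF-mono p λ j → cc-∈ H c (pre⊆leg (head∈ j)))
          (≤-trans (≤-reflexive (sym (cc-concatF c p leg))) (≤-trans (m≤n+m _ (δ (col z) c)) (cc-spider S c)))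
        inn-Z : ∀ j → col (head j) ≡ col z → Z (inn j) × ¬ Γ (inn j) × Adj (head j) (inn j)
        inn-Z j e = let (q , a) = proj₂ (inner j) e in
          S.all j (pre⊆leg q) , (λ γ → proj₂ γ (∈-vs {leg = pre} j q)) , a
        inn-inj : ∀ {i j} → col (head i) ≡ col z → col (head j) ≡ col z → inn i ≡ inn j → i ≡ j
        inn-inj {i} {j} ci cj e = S.disj (pre⊆leg (proj₁ (proj₂ (inner i) ci)))
          (subst (_∈ leg j) (sym e) (pre⊆leg (proj₁ (proj₂ (inner j) cj))))
        module R = Rebuild H Z Γ Z⊆V proj₁ goodΓ (col z) head inn head-R sees inn-Z inn-inj

    -- The new centre `w` is avoided by another copy. Hence it is good and sees a vertex outside its
    -- own copy, and unlocking from the empty prefix reaches every vertex of the legs; for `w`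
    -- itself the other copy serves.
    all-avoided : ∀ {z leg v} → Copy Z Z⊆V z leg → Z v → v ∉ vs z leg → ∀ {y} → Z y → NN (Avoided Z Z⊆V y)
    all-avoided {z} {leg} {v} S zv v∉ {y} zy = do
      ((z₀ , pre) , lk , mn) ← minimal Locked size ((z , leg) ,
        ((leg , S , λ j → [] , sym (++-identityʳ (leg j))) , (λ _ zy y∉ → pure (leg , (S , λ j → [] , sym (++-identityʳ (leg j))) , y∉)) , (v , zv , v∉)))
      (w , leg' , S' , zw , avw) ← recentre lk mn
      aw ← avw
      (w' , ad , zw' , w'∉) ← good zw aw (vs w leg') (s≤s (cc-spider S' _))
      case y ∈? vs w leg' of λ
        { (no q) → pure (w , leg' , S' , q)
        ; (yes q) → case ∈-vs⁻ {leg = leg'} q of λ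
          { (inj₁ refl) → pure aw
          ; (inj₂ (j , r)) → do
              (_ , S'' , y∉) ← unlock S' j [] (leg' j) refl [] zw' w'∉ ad r
              pure (w , _ , S'' , y∉) } }

-- Sets that two vertices do not separate

module Linkage {n p : ℕ} (H : Host n p) where
  open Host H

  Off : List (Fin n) → Fin n → Fin n → Fin n → Set
  Off B x y v = v ∈ B × v ≢ x × v ≢ y

  -- `x` and `y` may coincide or lie outside `B`, which includes the deletion of fewer than two
  -- vertices.
  Inseparable : List (Fin n) → List (Fin n) → Set
  Inseparable U B = ∀ x y {u v} → u ∈ U → u ≢ x → u ≢ y → v ∈ U → v ≢ x → v ≢ y → NN (Walk (Off B x y) u v)

  insep-mono : ∀ {U B B'} → (∀ {v} → v ∈ B → v ∈ B') → Inseparable U B → Inseparable U B'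
  insep-mono h I x y a b c d e f = do
    w ← I x y a b c d e f
    pure (walk-map (λ (i , r) → h i , r) w)

  -- At least four elements, in the form in which this is used.
  Spread : List (Fin n) → Set
  Spread U = ∀ a b c → ∃[ u ] u ∈ U × u ≢ a × u ≢ b × u ≢ c

  -- Each excursion of a walk into `C`, entering from `e` and leaving to `e'`, is replaced by
  -- `bridge`; the rest of the walk is kept.
  module Detour {P P' C E : Fin n → Set} (C? : ∀ v → Dec (C v))
    (keep : ∀ {v} → P v → ¬ C v → P' v)
    (exit : ∀ {v w} → C v → Adj v w → P w → ¬ C w → E w)
    (bridge : ∀ {e e' c d} → E e → P e → E e' → P e' → Adj e c → Walk (λ v → C v × P v) c d → Adj d e' → NN (Walk P' e e'))
    where

    outside : ∀ {u v} → Walk P u v → ¬ C u → ¬ C v → NN (Walk P' u v)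
    inside : ∀ {e c d v} → E e → P e → Adj e c → Walk (λ v → C v × P v) c d → Walk P d v → C d → ¬ C v → NN (Walk P' e v)

    outside (stop q) ¬u ¬v = pure (stop (keep q ¬u))
    outside (step {y = y} q a w) ¬u ¬v with C? y
    ... | no ¬y = do
      w' ← outside w ¬y ¬v
      pure (step (keep q ¬u) a w')
    ... | yes cy = inside (exit cy (symA a) q ¬u) q a (stop (cy , walk-start w)) w cy ¬v

    inside Ee q a b (stop r) cd ¬v = ⊥-elim (¬v cd)
    inside Ee q a b (step {y = y} r a' w) cd ¬v with C? y
    ... | yes cy = inside Ee q a (walk-snoc b a' (cy , walk-start w)) w cy ¬v
    ... | no ¬y = do
      w₁ ← bridge Ee q (exit cd a' (walk-start w) ¬y) (walk-start w) a b a'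
      w₂ ← outside w ¬y ¬v
      pure (w₁ +++ w₂)

  module _ {U B B' : List (Fin n)} {C : Fin n → Set} (C? : ∀ v → Dec (C v)) {x₁ x₂ : Fin n}
    (x₁≢x₂ : x₁ ≢ x₂) (I : Inseparable U B) (U∌C : ∀ {u} → u ∈ U → ¬ C u)
    (exit : ∀ {v w} → C v → Adj v w → w ∈ B → ¬ C w → w ≡ x₁ ⊎ w ≡ x₂)
    (keep : ∀ {v} → v ∈ B → ¬ C v → v ∈ B')
    (x₁∈U : x₁ ∈ U) (x₂∈U : x₂ ∈ U) where

    -- No excursion into `C` leads from one of `x₁`, `x₂` to the other, so each returns to the
    -- vertex where it began and can be skipped.
    drop-insep : (∀ {c d} → Adj x₁ c → Walk (λ v → C v × v ∈ B) c d → Adj d x₂ → ⊥) → Inseparable U B'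
    drop-insep ¬link x y {u} {v} u∈ ux uy v∈ vx vy = do
      w ← I x y u∈ ux uy v∈ vx vy
      Detour.outside {P' = Off B' x y} {E = λ w → w ≡ x₁ ⊎ w ≡ x₂} C? (λ (q , r) ¬c → keep q ¬c , r)
        (λ c a (q , _) ¬c → exit c a q ¬c)
        (λ { (inj₁ refl) (q , r) (inj₁ refl) _ a w b → pure (stop (keep q (U∌C x₁∈U) , r))
           ; (inj₁ refl) _ (inj₂ refl) _ a w b → ⊥-elim (¬link a (walk-map (λ (c , q , _) → c , q) w) b)
           ; (inj₂ refl) _ (inj₁ refl) _ a w b → ⊥-elim (¬link (symA b) (walk-rev (walk-map (λ (c , q , _) → c , q) w)) (symA a))
           ; (inj₂ refl) (q , r) (inj₂ refl) _ a w b → pure (stop (keep q (U∌C x₂∈U) , r)) })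
        w (U∌C u∈) (U∌C v∈)

    module _ (spread : Spread U) {L} (path : Pth x₁ L x₂)
      (L⊆ : ∀ {v} → v ∈ L → C v ⊎ v ≡ x₁ ⊎ v ≡ x₂) (L⊆B' : ∀ {v} → v ∈ L → v ∈ B') where

      -- The deleted `c` may lie on the new path. But only `y` is deleted besides, so one of `x₁`,
      -- `x₂` can be deleted in place of `c`: a walk that misses it returns from `C` to where it
      -- came from. If the ends of the walk are `x₁` and `x₂` themselves, `spread` supplies a
      -- stopover.
      through : ∀ {c y u v} → C c → u ∈ U → u ≢ y → v ∈ U → v ≢ y → NN (Walk (Off B' c y) u v)
      through {c} {y} {u} {v} cc u∈ uy v∈ vy = go (u ≟F x₁) (v ≟F x₁) (u ≟F x₂) (v ≟F x₂)
        where
        avoid : ∀ {e f} → (∀ {w} → w ≡ x₁ ⊎ w ≡ x₂ → w ≢ e → w ≡ f) → ∀ {u v} → u ∈ U → u ≢ e → u ≢ y → v ∈ U → v ≢ e → v ≢ y →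
          NN (Walk (Off B' c y) u v)
        avoid {e} {f} only {u} {v} u∈ ue uy v∈ ve vy = do
          w ← I e y u∈ ue uy v∈ ve vy
          Detour.outside {P' = Off B' c y} {E = λ w → w ≡ x₁ ⊎ w ≡ x₂} C?
            (λ { (q , _ , r) ¬c → keep q ¬c , (λ { refl → ¬c cc }) , r })
            (λ c a (q , _) ¬c → exit c a q ¬c)
            (λ Ee (q , ne , r) Ef (_ , ne' , _) _ _ _ → case trans (only Ee ne) (sym (only Ef ne')) of λ
              { refl → pure (stop (keep q (U∌C (ends∈ Ee)) , (λ { refl → U∌C (ends∈ Ee) cc }) , r)) })
            w (U∌C u∈) (U∌C v∈)
          where
          ends∈ : ∀ {w} → w ≡ x₁ ⊎ w ≡ x₂ → w ∈ U
          ends∈ (inj₁ refl) = x₁∈U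
          ends∈ (inj₂ refl) = x₂∈U
        avoid₁ : ∀ {u v} → u ∈ U → u ≢ x₁ → u ≢ y → v ∈ U → v ≢ x₁ → v ≢ y → NN (Walk (Off B' c y) u v)
        avoid₁ = avoid λ { (inj₁ refl) ne → ⊥-elim (ne refl) ; (inj₂ e) _ → e }
        avoid₂ : ∀ {u v} → u ∈ U → u ≢ x₂ → u ≢ y → v ∈ U → v ≢ x₂ → v ≢ y → NN (Walk (Off B' c y) u v)
        avoid₂ = avoid λ { (inj₂ refl) ne → ⊥-elim (ne refl) ; (inj₁ e) _ → e }
        go : Dec (u ≡ x₁) → Dec (v ≡ x₁) → Dec (u ≡ x₂) → Dec (v ≡ x₂) → NN (Walk (Off B' c y) u v)
        go (no a) (no b) _ _ = avoid₁ u∈ a uy v∈ b vy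
        go _ _ (no a) (no b) = avoid₂ u∈ a uy v∈ b vy
        go (yes refl) _ (yes e) _ = ⊥-elim (x₁≢x₂ e)
        go _ (yes refl) _ (yes e) = ⊥-elim (x₁≢x₂ e)
        go (yes refl) _ (no _) (yes refl) = do
          let (u' , i , a , b , d) = spread x₁ x₂ y
          w₁ ← avoid₂ u∈ x₁≢x₂ uy i b d
          w₂ ← avoid₁ i a d v∈ (≢-sym x₁≢x₂) vy
          pure (w₁ +++ w₂)
        go (no _) (yes refl) (yes refl) _ = do
          let (u' , i , a , b , d) = spread x₁ x₂ y
          w₁ ← avoid₁ u∈ (≢-sym x₁≢x₂) uy i a d
          w₂ ← avoid₂ i b d v∈ x₁≢x₂ vy
          pure (w₁ +++ w₂)

      replace-insep : Inseparable U B'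
      replace-insep x y {u} {v} u∈ ux uy v∈ vx vy = go (C? x) (C? y)
        where
        go : Dec (C x) → Dec (C y) → NN (Walk (Off B' x y) u v)
        go (yes cx) _ = through cx u∈ uy v∈ vy
        go _ (yes cy) = do
          w ← through cy u∈ ux v∈ vx
          pure (walk-map (λ (q , a , b) → q , b , a) w)
        go (no ¬cx) (no ¬cy) = do
            w ← I x y u∈ ux uy v∈ vx vy
            Detour.outside {P' = Off B' x y} {E = λ w → w ≡ x₁ ⊎ w ≡ x₂} C? (λ (q , r) ¬c → keep q ¬c , r)
              (λ c a (q , _) ¬c → exit c a q ¬c)
              (λ { (inj₁ refl) (q , r) (inj₁ refl) _ _ _ _ → pure (stop (keep q (U∌C x₁∈U) , r))
                 ; (inj₁ refl) (_ , a) (inj₂ refl) (_ , b) _ _ _ → pure (along a b)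
                 ; (inj₂ refl) (_ , a) (inj₁ refl) (_ , b) _ _ _ → pure (walk-rev (along b a))
                 ; (inj₂ refl) (q , r) (inj₂ refl) _ _ _ _ → pure (stop (keep q (U∌C x₂∈U) , r)) })
              w (U∌C u∈) (U∌C v∈)
          where
          along : x₁ ≢ x × x₁ ≢ y → x₂ ≢ x × x₂ ≢ y → Walk (Off B' x y) x₁ x₂
          along (a , b) (c , d) = pth-walk path λ q → L⊆B' q , off q a c ¬cx , off q b d ¬cy
            where
            off : ∀ {v z} → v ∈ L → x₁ ≢ z → x₂ ≢ z → ¬ C z → v ≢ z
            off q a c ¬c refl = case L⊆ q of λ
              { (inj₁ r) → ¬c r ; (inj₂ (inj₁ refl)) → a refl ; (inj₂ (inj₂ refl)) → c refl }

  -- Three disjoint paths from one vertex to U: two removed vertices cannot meet all of them.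
  module Fan {U B : List (Fin n)} (I : Inseparable U B) (U⊆B : ∀ {v} → v ∈ U → v ∈ B) where

    Free-of : Fin n → Set
    Free-of v = v ∈ B × v ∉ U

    Reach : Fin n → Fin n → Set
    Reach c x = ∃[ d ] Walk Free-of c d × Adj d x

    add-insep : ∀ {r} → r ∈ B → (∀ x y → r ≢ x → r ≢ y → ∃[ u ] u ∈ U × u ≢ x × u ≢ y × Walk (Off B x y) r u) → Inseparable (r ∷ U) B
    add-insep r∈ spoke x y (here refl) ux uy (here refl) vx vy = pure (stop (r∈ , ux , uy))
    add-insep r∈ spoke x y (here refl) ux uy (there v∈) vx vy = do
      let (u , u∈ , a , b , w) = spoke x y ux uy
      w' ← I x y u∈ a b v∈ vx vy
      pure (w +++ w')
    add-insep r∈ spoke x y (there u∈) ux uy (here refl) vx vy = do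
      let (v , v∈ , a , b , w) = spoke x y vx vy
      w' ← I x y u∈ ux uy v∈ a b
      pure (w' +++ walk-rev w)
    add-insep r∈ spoke x y (there u∈) ux uy (there v∈) vx vy = I x y u∈ ux uy v∈ vx vy

    -- The three walks from `c` may overlap, so `c` itself need not be the branch vertex. It is
    -- replaced by the vertex `r` at which a walk from the third end first meets a path between the
    -- other two.
    fan : ∀ {c x₁ x₂ x₃} → x₁ ∈ U → x₂ ∈ U → x₃ ∈ U → x₁ ≢ x₂ → x₁ ≢ x₃ → x₂ ≢ x₃ →
      Reach c x₁ → Reach c x₂ → Reach c x₃ → ∃[ r ] r ∈ B × r ∉ U × Inseparable (r ∷ U) B
    fan {c} {x₁} {x₂} {x₃} i₁ i₂ i₃ n₁₂ n₁₃ n₂₃ (c₁ , w₁ , a₁) (c₂ , w₂ , a₂) (c₃ , w₃ , a₃)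
      with walk-pth (walk-rev w₁ +++ w₂)
    ... | L , path , L⊆ , uL with first-hit L (walk-rev w₃ +++ w₁) (pth-head path)
    ... | r , r∈L , w with ∈-∃++ r∈L
    ... | A , E , refl = r , proj₁ (L⊆ r∈L) , proj₂ (L⊆ r∈L) , add-insep (proj₁ (L⊆ r∈L)) spoke
      where
      lab : Fin n → Fin 3
      lab v with v ∈? (x₁ ∷ A) | v ∈? (x₂ ∷ E)
      ... | yes _ | _ = zero
      ... | no _ | yes _ = suc zero
      ... | no _ | no _ = suc (suc zero)
      lab₁ : ∀ {v} → v ∈ x₁ ∷ A → lab v ≡ zero
      lab₁ {v} q with v ∈? (x₁ ∷ A)
      ... | yes _ = refl
      ... | no q' = ⊥-elim (q' q)
      lab₂ : ∀ {v} → v ∉ x₁ ∷ A → v ∈ x₂ ∷ E → lab v ≡ suc zero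
      lab₂ {v} q s with v ∈? (x₁ ∷ A) | v ∈? (x₂ ∷ E)
      ... | yes q' | _ = ⊥-elim (q q')
      ... | no _ | yes _ = refl
      ... | no _ | no s' = ⊥-elim (s' s)
      lab₃ : ∀ {v} → v ∉ x₁ ∷ A → v ∉ x₂ ∷ E → lab v ≡ suc (suc zero)
      lab₃ {v} q s with v ∈? (x₁ ∷ A) | v ∈? (x₂ ∷ E)
      ... | yes q' | _ = ⊥-elim (q q')
      ... | no _ | yes s' = ⊥-elim (s s')
      ... | no _ | no _ = refl
      A⊆ : ∀ {v} → v ∈ A → Free-of v
      A⊆ q = L⊆ (∈-++⁺ˡ q)
      E⊆ : ∀ {v} → v ∈ E → Free-of v
      E⊆ q = L⊆ (∈-++⁺ʳ A (there q))
      U∉A : ∀ {v} → v ∈ U → v ≢ x₁ → v ∉ x₁ ∷ A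
      U∉A u ne (here e) = ne e
      U∉A u ne (there q) = proj₂ (A⊆ q) u
      U∉E : ∀ {v} → v ∈ U → v ≢ x₂ → v ∉ x₂ ∷ E
      U∉E u ne (here e) = ne e
      U∉E u ne (there q) = proj₂ (E⊆ q) u
      Class : Fin 3 → Fin n → Set
      Class i v = v ∈ B × (v ≡ r ⊎ lab v ≡ i)
      arm : ∀ i → ∃[ x ] x ∈ U × lab x ≡ i × Walk (Class i) r x
      arm zero = x₁ , i₁ , lab₁ (here refl) ,
        walk-snoc (walk-rev (pth-walk (proj₁ (pth-split A path)) λ q → case ∈-++⁻ A q of λ
          { (inj₁ s) → proj₁ (A⊆ s) , inj₂ (lab₁ (there s)) ; (inj₂ (here refl)) → proj₁ (L⊆ r∈L) , inj₁ refl }))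
          a₁ (U⊆B i₁ , inj₂ (lab₁ (here refl)))
      arm (suc zero) = x₂ , i₂ , l₂ ,
        walk-snoc (pth-walk (proj₂ (pth-split A path)) λ
          { (here refl) → proj₁ (L⊆ r∈L) , inj₁ refl
          ; (there s) → proj₁ (E⊆ s) , inj₂ (lab₂ (λ { (here refl) → proj₂ (E⊆ s) i₁
                                                     ; (there q) → unique-disj A uL q (there s) }) (there s)) })
          a₂ (U⊆B i₂ , inj₂ l₂)
        where
        l₂ = lab₂ (U∉A i₂ (≢-sym n₁₂)) (here refl)
      arm (suc (suc zero)) = x₃ , i₃ , l₃ ,
        walk-rev (step (U⊆B i₃ , inj₂ l₃) (symA a₃) (walk-map (λ {v} ((vB , v∉U) , h) → vB , (case v ∈? (A ++ r ∷ E) of λ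
          { (yes q) → inj₁ (h q)
          ; (no q) → inj₂ (lab₃ (λ { (here refl) → v∉U i₁ ; (there s) → q (∈-++⁺ˡ s) })
                                (λ { (here refl) → v∉U i₂ ; (there s) → q (∈-++⁺ʳ A (there s)) })) })) w))
        where
        l₃ = lab₃ (U∉A i₃ (≢-sym n₁₃)) (U∉E i₃ (≢-sym n₂₃))
      other : ∀ (i j : Fin 3) → ∃[ k ] i ≢ k × j ≢ k
      other zero zero = suc zero , (λ ()) , λ ()
      other zero (suc zero) = suc (suc zero) , (λ ()) , λ ()
      other zero (suc (suc zero)) = suc zero , (λ ()) , λ ()
      other (suc zero) zero = suc (suc zero) , (λ ()) , λ ()
      other (suc zero) (suc zero) = zero , (λ ()) , λ ()
      other (suc zero) (suc (suc zero)) = zero , (λ ()) , λ ()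
      other (suc (suc zero)) zero = suc zero , (λ ()) , λ ()
      other (suc (suc zero)) (suc zero) = zero , (λ ()) , λ ()
      other (suc (suc zero)) (suc (suc zero)) = zero , (λ ()) , λ ()
      spoke : ∀ x y → r ≢ x → r ≢ y → ∃[ u ] u ∈ U × u ≢ x × u ≢ y × Walk (Off B x y) r u
      spoke x y rx ry with other (lab x) (lab y)
      ... | k , kx , ky with arm k
      ...   | u , u∈ , lu , w' = u , u∈ , (λ { refl → kx lu }) , (λ { refl → ky lu }) ,
              walk-map (λ { (vB , inj₁ refl) → vB , rx , ry
                          ; (vB , inj₂ lv) → vB , (λ { refl → kx lv }) , (λ { refl → ky lv }) }) w'

  -- A vertex with neighbours on a path either yields a strictly shorter path, or has at most one neighbour on
  -- the path, or exactly two at distance two (consecutive ones are excluded by the colouring).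
  module _ {x y : Fin n} {L : List (Fin n)} {z : Fin n} (path : Pth x L y) where

    Shorter : Set
    Shorter = ∃[ L' ] Pth x L' y × (∀ {v} → v ∈ L' → v ∈ L ⊎ v ≡ z) × length L' < length L

    Pair : Set
    Pair = ∃[ A ] ∃[ p ] ∃[ m ] ∃[ q ] ∃[ E ] L ≡ A ++ p ∷ m ∷ q ∷ E × Adj z p × Adj z q ×
      (∀ {w} → Adj z w → w ∈ L → w ≡ p ⊎ w ≡ q)

    shortcut : ∀ A p M q E → L ≡ A ++ p ∷ M ++ q ∷ E → Adj z p → Adj z q → 2 ≤ length M → Shorter
    shortcut A p M q E refl ap aq M≥2 = A ++ p ∷ z ∷ q ∷ E ,
      pth-join A (proj₁ (pth-split A path)) (symA ap) (aq ∷ proj₂ (pth-split (p ∷ M) (proj₂ (pth-split A path)))) ,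
      (λ r → case ∈-++⁻ A r of λ
        { (inj₁ s) → inj₁ (∈-++⁺ˡ s)
        ; (inj₂ (here refl)) → inj₁ (∈-mid A)
        ; (inj₂ (there (here refl))) → inj₂ refl
        ; (inj₂ (there (there s))) → inj₁ (∈-++⁺ʳ A (there (∈-++⁺ʳ M s))) }) ,
      subst₂′ (length-++ A) (length-++ A) (+-monoʳ-< (length A) (s≤s
        (≤-trans (s≤s (s≤s ≤-refl)) (≤-trans (+-monoˡ-≤ (suc (length E)) M≥2) (≤-reflexive (sym (length-++ M)))))))
      where
      subst₂′ : ∀ {a b c d : ℕ} → a ≡ b → c ≡ d → b < d → a < c
      subst₂′ refl refl h = h

    on-path : Shorter ⊎ Few 1 z (_∈ L) ⊎ Pair
    on-path with first (adj? z) L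
    ... | inj₂ none = inj₂ (inj₁ ([] , z≤n , λ a q → ⊥-elim (none q a)))
    ... | inj₁ (A , p , R , eq , ap , A∌) with first (adj? z) R
    ...   | inj₂ none = inj₂ (inj₁ (p ∷ [] , ≤-refl , λ a q → case ∈-++⁻ A (subst (_ ∈_) eq q) of λ
              { (inj₁ s) → ⊥-elim (A∌ s a) ; (inj₂ (here refl)) → here refl ; (inj₂ (there s)) → ⊥-elim (none s a) }))
    ...   | inj₁ ([] , q , E , refl , aq , _) = ⊥-elim (no-triangle ap aq (next (proj₂ (pth-split A (subst (λ L → Pth x L y) eq path)))))
      where
      next : ∀ {v w L u} → Pth v (v ∷ w ∷ L) u → Adj v w
      next (a ∷ [-]) = a
      next (a ∷ (_ ∷ _)) = a
    ...   | inj₁ (m₁ ∷ m₂ ∷ M , q , E , refl , aq , _) = inj₁ (shortcut A p (m₁ ∷ m₂ ∷ M) q E eq ap aq (s≤s (s≤s z≤n)))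
    ...   | inj₁ (m ∷ [] , q , E , refl , aq , M∌) with first (adj? z) E
    ...     | inj₁ (M , r , F , refl , ar , _) = inj₁ (shortcut A p (m ∷ q ∷ M) r F eq ap ar (s≤s (s≤s z≤n)))
    ...     | inj₂ none = inj₂ (inj₂ (A , p , m , q , E , eq , ap , aq , λ a s → case ∈-++⁻ A (subst (_ ∈_) eq s) of λ
              { (inj₁ r) → ⊥-elim (A∌ r a)
              ; (inj₂ (here e)) → inj₁ e
              ; (inj₂ (there (here refl))) → ⊥-elim (M∌ (here refl) a)
              ; (inj₂ (there (there (here e)))) → inj₂ e
              ; (inj₂ (there (there (there r)))) → ⊥-elim (none r a) }))

-- Extremal pairs

module States {n p : ℕ} (H : Host n p) where
  open Host H
  open Legs H
  open Linkage H

  CopyOff : List (Fin n) → Set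
  CopyOff B = ∃₂ λ z leg → Spider (λ v → v ∈ Vs × v ∉ B) z ls leg

  copy-mono : ∀ {B B'} → (∀ {v} → v ∈ B' → v ∈ B) → CopyOff B → CopyOff B'
  copy-mono h (z , leg , S) = z , leg , spider-map (λ (q , r) → q , r ∘ h) S

  record State : Set where
    field
      U B    : List (Fin n)
      uniq   : Unique U
      U⊆B    : ∀ {v} → v ∈ U → v ∈ B
      B⊆V    : ∀ {v} → v ∈ B → v ∈ Vs
      insep  : Inseparable U B
      spread : Spread U
      copy   : CopyOff B

  record Extremal : Set where
    field
      state : State
    open State state public
    field
      maxU : ∀ (s : State) → length (State.U s) ≤ length U
      minB : ∀ (s : State) → length U ≤ length (State.U s) → length B ≤ length (State.B s)

  extremal : State → NN Extremal
  extremal s₀ = do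
    (s₁ , _ , mx) ← maximal (λ _ → State) (length ∘ State.U) (length (allFin n))
      (λ s _ → unique-⊆-length (State.uniq s) λ _ → ∈-allFin _) (s₀ , s₀)
    (s₂ , h , mn) ← minimal (λ s → length (State.U s₁) ≤ length (State.U s)) (length ∘ State.B) (s₁ , ≤-refl)
    pure record { state = s₂ ; maxU = λ s → ≤-trans (mx s s) h ; minB = λ s q → mn s (≤-trans h q) }

  first-in : ∀ {P u v} U → Walk P u v → u ∉ U → v ∈ U →
    ∃₂ λ d x → Walk (λ w → P w × w ∉ U) u d × Adj d x × P x × x ∈ U
  first-in U (stop _) u∉ v∈ = ⊥-elim (u∉ v∈)
  first-in U (step {y = y} q a w) u∉ v∈ with y ∈? U
  ... | yes y∈ = _ , _ , stop (q , u∉) , a , walk-start w , y∈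
  ... | no y∉ with first-in U w y∉ v∈
  ...   | d , x , w' , r = d , x , step (q , u∉) a w' , r

  -- If `P` has fewer than two elements, the pair is filled up from `U`, so that the two vertices
  -- are always distinct.
  cover₂ : ∀ {U} → Fin n → Spread U → (P : Fin n → Set) → (∀ {x} → P x → x ∈ U) →
    (∀ {a b c} → P a → P b → P c → a ≢ b → a ≢ c → b ≢ c → ⊥) →
    NN (∃₂ λ a b → a ∈ U × b ∈ U × a ≢ b × (∀ x → P x → x ≡ a ⊎ x ≡ b))
  cover₂ {U} z₀ sp P P⊆ none = do
      d₁ ← em (∃ P)
      case d₁ of λ
        { (inj₂ no₁) → let (a , a∈ , _) = sp z₀ z₀ z₀ ; (b , b∈ , ne , _) = sp a a a in
            pure (a , b , a∈ , b∈ , ≢-sym ne , λ _ q → ⊥-elim (no₁ (_ , q)))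
        ; (inj₁ (a , pa)) → do
            d₂ ← em (∃[ b ] P b × a ≢ b)
            case d₂ of λ
              { (inj₂ no₂) → let (b , b∈ , ne , _) = sp a a a in
                  pure (a , b , P⊆ pa , b∈ , ≢-sym ne , λ x q → case (x ≟F a) of λ
                    { (yes e) → inj₁ e ; (no ne') → ⊥-elim (no₂ (x , q , ≢-sym ne')) })
              ; (inj₁ (b , pb , ne)) → pure (a , b , P⊆ pa , P⊆ pb , ne , λ x q → case ((x ≟F a) , (x ≟F b)) of λ
                  { (yes e , _) → inj₁ e ; (no _ , yes e) → inj₂ e
                  ; (no e , no e') → ⊥-elim (none pa pb q ne (≢-sym e) (≢-sym e')) }) } }

  module Ext (X : Extremal) where
    open Extremal X

    min-B : ∀ {B'} → (∀ {v} → v ∈ U → v ∈ B') → (∀ {v} → v ∈ B' → v ∈ Vs) → Inseparable U B' → CopyOff B' →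
      length B ≤ length B'
    min-B U⊆ B'⊆ I c = minB (record { State state ; B = _ ; U⊆B = U⊆ ; B⊆V = B'⊆ ; insep = I ; copy = c }) ≤-refl

    no-fan : ∀ {B'} (U⊆ : ∀ {v} → v ∈ U → v ∈ B') → (∀ {v} → v ∈ B' → v ∈ Vs) → (I : Inseparable U B') → CopyOff B' →
      ∀ {c x₁ x₂ x₃} → x₁ ∈ U → x₂ ∈ U → x₃ ∈ U → x₁ ≢ x₂ → x₁ ≢ x₃ → x₂ ≢ x₃ →
      Fan.Reach I U⊆ c x₁ → Fan.Reach I U⊆ c x₂ → Fan.Reach I U⊆ c x₃ → ⊥
    no-fan U⊆ B'⊆ I c i₁ i₂ i₃ n₁ n₂ n₃ r₁ r₂ r₃ with Fan.fan I U⊆ i₁ i₂ i₃ n₁ n₂ n₃ r₁ r₂ r₃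
    ... | r , r∈ , r∉ , I' = <⇒≱ ≤-refl (maxU record
      { U = r ∷ U ; B = _ ; uniq = unique-∷ r∉ uniq ; U⊆B = λ { (here refl) → r∈ ; (there q) → U⊆ q }
      ; B⊆V = B'⊆ ; insep = I' ; copy = c
      ; spread = λ a b d → let (u , u∈ , q) = spread a b d in u , there u∈ , q })

    -- The vertices of B that {x₁ , x₂} cuts off from the rest of U are, by minimality of B, the inner vertices
    -- of a path from x₁ to x₂.
    module Segment {C : Fin n → Set} (C? : ∀ v → Dec (C v)) {x₁ x₂} (x₁∈ : x₁ ∈ U) (x₂∈ : x₂ ∈ U) (ne : x₁ ≢ x₂)
      (U∌C : ∀ {u} → u ∈ U → ¬ C u)
      (exit : ∀ {v w} → C v → Adj v w → w ∈ B → ¬ C w → w ≡ x₁ ⊎ w ≡ x₂) where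

      Q : Fin n → Set
      Q v = C v ⊎ v ≡ x₁ ⊎ v ≡ x₂

      Q? : ∀ v → Dec (Q v)
      Q? v with C? v | v ≟F x₁ | v ≟F x₂
      ... | yes c | _ | _ = yes (inj₁ c)
      ... | no _ | yes e | _ = yes (inj₂ (inj₁ e))
      ... | no _ | no _ | yes e = yes (inj₂ (inj₂ e))
      ... | no a | no b | no c = no λ { (inj₁ q) → a q ; (inj₂ (inj₁ q)) → b q ; (inj₂ (inj₂ q)) → c q }

      B₀ : List (Fin n)
      B₀ = filter (¬? ∘ Q?) B

      B₀⊆B : ∀ {v} → v ∈ B₀ → v ∈ B
      B₀⊆B q = proj₁ (filter-∈⁻ (¬? ∘ Q?) B q)

      U⊆ : ∀ {L} → Pth x₁ L x₂ → ∀ {v} → v ∈ U → v ∈ B₀ ++ L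
      U⊆ path {v} v∈ = case Q? v of λ
        { (no q) → ∈-++⁺ˡ (filter-∈ (¬? ∘ Q?) (U⊆B v∈) q)
        ; (yes (inj₁ c)) → ⊥-elim (U∌C v∈ c)
        ; (yes (inj₂ (inj₁ refl))) → ∈-++⁺ʳ B₀ (pth-head path)
        ; (yes (inj₂ (inj₂ refl))) → ∈-++⁺ʳ B₀ (pth-last path) }

      reroute : ∀ {L} → Pth x₁ L x₂ → (∀ {v} → v ∈ L → Q v) → Inseparable U (B₀ ++ L)
      reroute {L} path L⊆ = replace-insep C? ne insep U∌C exit
        (λ {v} q ¬c → case Q? v of λ
          { (no r) → ∈-++⁺ˡ (filter-∈ (¬? ∘ Q?) q r)
          ; (yes (inj₁ c)) → ⊥-elim (¬c c)
          ; (yes (inj₂ (inj₁ refl))) → ∈-++⁺ʳ B₀ (pth-head path)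
          ; (yes (inj₂ (inj₂ refl))) → ∈-++⁺ʳ B₀ (pth-last path) })
        x₁∈ x₂∈ spread path L⊆ (∈-++⁺ʳ B₀)

      -- The path may leave `B`. Putting it in place of the vertices of `Q` keeps `U` inseparable,
      -- so the minimality of `B` applies as soon as some copy avoids the new set.
      not-shorter : ∀ {L} → Pth x₁ L x₂ → (∀ {v} → v ∈ L → Q v × v ∈ Vs) → CopyOff (B₀ ++ L) →
        length (filter Q? B) ≤ length L
      not-shorter {L} path L⊆ cp = +-cancelʳ-≤ (length B₀) _ _ (≤-trans (≤-reflexive (filter-length Q? B))
        (≤-trans (min-B (U⊆ path) (λ q → [ B⊆V ∘ B₀⊆B , proj₂ ∘ L⊆ ]′ (∈-++⁻ B₀ q)) (reroute path (proj₁ ∘ L⊆)) cp)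
          (≤-reflexive (trans (length-++ B₀) (+-comm (length B₀) _)))))

      record Chord : Set where
        field
          L     : List (Fin n)
          path  : Pth x₁ L x₂
          uniqL : Unique L
          L⊆    : ∀ {v} → v ∈ L → Q v × v ∈ B
          B⊆L   : ∀ {v} → v ∈ B → Q v → v ∈ L
          short : length L ≤ length (filter Q? B)

      chord : NN (Chord ⊎ (∀ {v} → v ∈ B → ¬ C v))
      chord = do
        d ← em (Walk (λ v → Q v × v ∈ B) x₁ x₂)
        case d of λ
          { (inj₂ none) → pure (inj₂ λ {v} v∈ cv → <⇒≱ (fewer v∈ cv) (min-B
              (λ {u} u∈ → filter-∈ (¬? ∘ C?) (U⊆B u∈) (U∌C u∈))
              (λ q → B⊆V (proj₁ (filter-∈⁻ (¬? ∘ C?) B q)))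
              (drop-insep C? ne insep U∌C exit (λ q ¬c → filter-∈ (¬? ∘ C?) q ¬c) x₁∈ x₂∈
                (λ a w b → none (step (inj₂ (inj₁ refl) , U⊆B x₁∈) a
                  (walk-snoc (walk-map (λ (c , q) → inj₁ c , q) w) b (inj₂ (inj₂ refl) , U⊆B x₂∈)))))
              (copy-mono (λ q → proj₁ (filter-∈⁻ (¬? ∘ C?) B q)) copy)))
          ; (inj₁ w) → let (L , path , L⊆ , uL) = walk-pth w in
              pure (inj₁ (record { L = L ; path = path ; uniqL = uL ; L⊆ = L⊆
                ; B⊆L = (λ {v} v∈ qv → case v ∈? L of λ
                  { (yes q) → q
                  ; (no v∉) → ⊥-elim (<⇒≱ (unique-⊆-length (unique-∷ v∉ uL) λ
                        { (here refl) → filter-∈ Q? v∈ qv ; (there q) → filter-∈ Q? (proj₂ (L⊆ q)) (proj₁ (L⊆ q)) })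
                      (not-shorter path (λ q → proj₁ (L⊆ q) , B⊆V (proj₂ (L⊆ q)))
                        (copy-mono (λ q → [ B₀⊆B , proj₂ ∘ L⊆ ]′ (∈-++⁻ B₀ q)) copy))) })
                ; short = unique-⊆-length uL λ q → filter-∈ Q? (proj₂ (L⊆ q)) (proj₁ (L⊆ q)) })) }
        where
        fewer : ∀ {v} → v ∈ B → C v → length (filter (¬? ∘ C?) B) < length B
        fewer v∈ cv = ≤-trans (+-monoˡ-≤ _ (nonempty (filter-∈ C? v∈ cv))) (≤-reflexive (filter-length C? B))
          where
          nonempty : ∀ {v : Fin n} {L} → v ∈ L → 1 ≤ length L
          nonempty (here _) = s≤s z≤n
          nonempty (there _) = s≤s z≤n

    -- A third attachment would yield a fan in `z ∷ B` and hence a larger `U`; the hypothesis on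
    -- copies makes `z ∷ B` an admissible competitor.
    attachments : ∀ {z} → z ∈ Vs → z ∉ U → CopyOff (z ∷ B) →
      NN (∃₂ λ x₁ x₂ → x₁ ∈ U × x₂ ∈ U × x₁ ≢ x₂ ×
        (∀ d x → Walk (λ v → v ∈ z ∷ B × v ∉ U) z d → Adj d x → x ∈ U → x ≡ x₁ ⊎ x ≡ x₂))
    attachments {z} z∈ z∉ cp = do
        (x₁ , x₂ , a , b , ne , h) ← cover₂ z spread (λ x → x ∈ U × (∃[ d ] Walk (λ v → v ∈ z ∷ B × v ∉ U) z d × Adj d x))
          proj₁ (λ (i , r) (i' , r') (i'' , r'') n₁ n₂ n₃ → no-fan (there ∘ U⊆B)
            (λ { (here refl) → z∈ ; (there q) → B⊆V q }) (insep-mono there insep) cp i i' i'' n₁ n₂ n₃ r r' r'')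
        pure (x₁ , x₂ , a , b , ne , λ d x w ad x∈ → h x (x∈ , d , w , ad))

    -- A third neighbour of z in B would allow a shorter B through z, or a larger U.
    few₂ : ∀ {z} → z ∈ Vs → z ∉ U → CopyOff (z ∷ B) → NN (Few 2 z (_∈ B))
    few₂ {z} z∈ z∉ cp = do
        (x₁ , x₂ , x₁∈ , x₂∈ , ne , att) ← attachments z∈ z∉ cp
        C? ← decide (Walk (λ v → v ∈ z ∷ B × v ∉ U) z)
        let zz : Walk (λ v → v ∈ z ∷ B × v ∉ U) z z
            zz = stop (here refl , z∉)
            exit : ∀ {v w} → Walk (λ v → v ∈ z ∷ B × v ∉ U) z v → Adj v w → w ∈ B →
                   ¬ Walk (λ v → v ∈ z ∷ B × v ∉ U) z w → w ≡ x₁ ⊎ w ≡ x₂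
            exit {w = w} c a w∈ ¬c = case w ∈? U of λ
              { (yes w∈U) → att _ _ c a w∈U
              ; (no w∉U) → ⊥-elim (¬c (walk-snoc c a (there w∈ , w∉U))) }
        let module G = Segment C? x₁∈ x₂∈ ne (λ u∈ c → proj₂ (walk-end c) u∈) exit
        d ← G.chord
        case d of λ
          { (inj₂ none) → pure (few-pair λ a w∈ → exit zz a w∈ (none w∈))
          ; (inj₁ chord) →
              let open G.Chord chord
                  inL : ∀ {w} → Adj z w → w ∈ B → w ∈ L
                  inL {w} a w∈ = B⊆L w∈ (case C? w of λ { (yes c) → inj₁ c ; (no ¬c) → inj₂ (exit zz a w∈ ¬c) })
              in case on-path path of λ
              { (inj₂ (inj₁ f)) → pure (few-map (s≤s z≤n) inL f)
              ; (inj₂ (inj₂ (A , p , m , q , E , _ , _ , _ , only))) →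
                  pure (few-pair λ a w∈ → only a (inL a w∈))
              ; (inj₁ (L' , path' , L'⊆ , lt)) → absurd (<⇒≱ lt (≤-trans short (G.not-shorter path'
                  (λ r → case L'⊆ r of λ
                    { (inj₁ s) → proj₁ (L⊆ s) , B⊆V (proj₂ (L⊆ s))
                    ; (inj₂ refl) → inj₁ zz , z∈ })
                  (copy-mono (λ r → case ∈-++⁻ G.B₀ r of λ
                    { (inj₁ s) → there (G.B₀⊆B s)
                    ; (inj₂ s) → case L'⊆ s of λ { (inj₁ s') → there (proj₂ (L⊆ s')) ; (inj₂ refl) → here refl } }) cp)))) } }

    Z : Fin n → Set
    Z v = v ∈ Vs × v ∉ B

    good : ∀ {y} → Z y → Avoided Z proj₁ y → Good Z proj₁ y
    good {y} (y∈ , y∉) (z , leg , S , r) L h = do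
      f ← few₂ y∈ (y∉ ∘ U⊆B) (z , leg , record { Spider S
        ; centre = off (here refl) ; all = λ j q → off (∈-vs {leg = leg} j q) })
      let (w , a , w∉B , w∉L) = few-deg y∈ f L (s≤s h)
      pure (w , a , (adjV′ a , w∉B) , w∉L)
      where
      off : ∀ {x} → x ∈ vs z leg → x ∈ Vs × x ∉ y ∷ B
      off q = let (a , b) = Spider.in-Z S q in a , λ { (here refl) → r q ; (there s) → b s }

    all-few : ∀ {z leg v} → Spider Z z ls leg → Z v → v ∉ vs z leg →
      ∀ {y} → Z y → NN (CopyOff (y ∷ B) × Few 2 y (_∈ B))
    all-few S zv v∉ {y} zy = do
        (z' , leg' , S' , r) ← Exchange.all-avoided H Z proj₁ good S zv v∉ zy
        let cp : CopyOff (y ∷ B)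
            cp = z' , leg' , record { Spider S' ; centre = off S' r (here refl) ; all = λ j q → off S' r (∈-vs {leg = leg'} j q) }
        f ← few₂ (proj₁ zy) (proj₂ zy ∘ U⊆B) cp
        pure (cp , f)
      where
      off : ∀ {z' leg'} → Spider Z z' ls leg' → y ∉ vs z' leg' → ∀ {x} → x ∈ vs z' leg' → x ∈ Vs × x ∉ y ∷ B
      off S' r q = let (a , b) = Spider.in-Z S' q in a , λ { (here refl) → r q ; (there s) → b s }

    -- If B is larger than U then so is Z than the copy, by the bound on the degree of a vertex of B outside U.
    spare : ∀ {c} → c ∈ B → c ∉ U → NN (∃[ v ] Z v × v ∉ vs (proj₁ copy) (proj₁ (proj₂ copy)))
    spare {c} c∈ c∉ = do
      f ← few₂ (B⊆V c∈) c∉ (copy-mono (λ { (here refl) → c∈ ; (there q) → q }) copy)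
      let (w , a , w∉B , w∉S) = few-deg (B⊆V c∈) f (vs (proj₁ copy) (proj₁ (proj₂ copy)))
            (s≤s (s≤s (cc-spider (proj₂ (proj₂ copy)) _)))
      pure (w , (adjV′ a , w∉B) , w∉S)

    all-few′ : ∀ {c} → c ∈ B → c ∉ U → ∀ {y} → Z y → NN (CopyOff (y ∷ B) × Few 2 y (_∈ B))
    all-few′ c∈ c∉ zy = do
      (v , zv , v∉) ← spare c∈ c∉
      all-few (proj₂ (proj₂ copy)) zv v∉ zy

-- Attaching a path by a shortest link

module Attachment {n p : ℕ} (H : Host n p) where
  open Host H
  open Linkage H
  open States H

  module _ (X : Extremal) where
    open Extremal X
    open Ext X

    Inner : Fin n → Fin n → List (Fin n) → Fin n → Set
    Inner x₁ x₂ L c = c ∈ L × c ≢ x₁ × c ≢ x₂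

    -- What the cases `B` larger than `U` and `B` equal to `U` have in common. The second
    -- alternative of `few` belongs to a strand with a single inner vertex `c`; there `z` is itself
    -- a link between `c` and `B₀`, which makes up for its third neighbour.
    record Strand (x₁ x₂ : Fin n) (B₀ L : List (Fin n)) : Set where
      field
        path   : Pth x₁ L x₂
        uniqL  : Unique L
        inner  : ∃ (Inner x₁ x₂ L)
        inner∉ : ∀ {c} → Inner x₁ x₂ L c → c ∉ U
        L∌B₀   : ∀ {v} → v ∈ L → v ∉ B₀
        L⊆V    : ∀ {v} → v ∈ L → v ∈ Vs
        U⊆B₀L  : ∀ {v} → v ∈ U → v ∈ B₀ ++ L
        insepL : Inseparable U (B₀ ++ L)
        apart  : ∀ {c d} → Inner x₁ x₂ L c → d ∈ B₀ → ¬ Adj c d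
        few    : ∀ {z} → z ∈ Vs → z ∉ B₀ → z ∉ L → NN (Few 2 z (_∈ B₀ ++ L) ⊎
                   (Few 3 z (_∈ B₀ ++ L) × (∃[ c ] Inner x₁ x₂ L c × Adj z c × (∀ c' → Inner x₁ x₂ L c' → c' ≡ c)) ×
                    (∃[ d ] d ∈ B₀ × Adj z d)))

    module _ {x₁ x₂ : Fin n} (x₁∈ : x₁ ∈ U) (x₂∈ : x₂ ∈ U) (ne : x₁ ≢ x₂) (B₀ : List (Fin n))
      (B₀⊆V : ∀ {v} → v ∈ B₀ → v ∈ Vs)
      (anchored : ∀ {d} → d ∈ B₀ → NN (∃[ u ] u ∈ U × u ≢ x₁ × u ≢ x₂ × Walk (_∈ B₀) d u))
      (Conf : List (Fin n) → Set)
      (strand : ∀ {L} → Conf L → Strand x₁ x₂ B₀ L)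
      (swap : ∀ {L z} → Conf L → z ∈ Vs → z ∉ B₀ → z ∉ L → Adj z x₁ → Adj z x₂ → NN (Conf (x₁ ∷ z ∷ x₂ ∷ [])))
      where

      In : List (Fin n) → Fin n → Set
      In = Inner x₁ x₂

      record Link (L W : List (Fin n)) : Set where
        field
          {w w'} : Fin n
          wpath : Pth w W w'
          from  : ∃[ c ] In L c × Adj c w
          to    : ∃[ d ] d ∈ B₀ × Adj w' d
          out   : ∀ {v} → v ∈ W → v ∈ Vs × v ∉ B₀ × v ∉ L

      -- `G` stays connected without `x₁` and `x₂`, and no edge joins an inner vertex of `L` to
      -- `B₀`. So a walk from one to the other contains a nonempty stretch outside both.
      find-link : ∀ {L} → Conf L → NN (∃ (Link L))
      find-link {L} conf = do
          let (c , c∈ , c₁ , c₂) = inner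
              (u , u∈ , u₁ , u₂ , _) = spread x₁ x₂ x₁
              u∈B₀ : u ∈ B₀
              u∈B₀ = case ∈-++⁻ B₀ (U⊆B₀L u∈) of λ
                { (inj₁ q) → q ; (inj₂ q) → ⊥-elim (inner∉ (q , u₁ , u₂) u∈) }
          w ← conn x₁ x₂ (L⊆V c∈) c₁ c₂ (B⊆V (U⊆B u∈)) u₁ u₂
          case scan w u∈B₀ of λ
            { (inj₁ r) → pure r
            ; (inj₂ (inj₁ q)) → absurd (L∌B₀ c∈ q)
            ; (inj₂ (inj₂ (_ , _ , q , _ , out))) → absurd (proj₂ (proj₂ (out (pth-head q))) c∈) }
        where
        open Strand (strand conf)
        Tail : Fin n → Set
        Tail v = ∃[ W ] ∃[ w' ] Pth v W w' × (∃[ d ] d ∈ B₀ × Adj w' d) × (∀ {v} → v ∈ W → v ∈ Vs × v ∉ B₀ × v ∉ L)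
        scan : ∀ {v u} → Walk (λ z → z ∈ Vs × z ≢ x₁ × z ≢ x₂) v u → u ∈ B₀ → ∃ (Link L) ⊎ v ∈ B₀ ⊎ Tail v
        scan (stop _) u∈ = inj₂ (inj₁ u∈)
        scan {v} (step (v∈ , v₁ , v₂) a w) u∈ with v ∈? B₀ | v ∈? L | scan w u∈
        ... | yes q | _ | _ = inj₂ (inj₁ q)
        ... | no _ | _ | inj₁ r = inj₁ r
        ... | no _ | yes v∈L | inj₂ (inj₁ q) = ⊥-elim (apart (v∈L , v₁ , v₂) q a)
        ... | no _ | yes v∈L | inj₂ (inj₂ (W , w' , p , to , out)) =
                inj₁ (W , record { wpath = p ; from = v , (v∈L , v₁ , v₂) , a ; to = to ; out = out })
        ... | no v∉B | no v∉L | inj₂ (inj₁ q) =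
                inj₂ (inj₂ (v ∷ [] , v , [-] , (_ , q , a) , λ { (here refl) → v∈ , v∉B , v∉L }))
        ... | no v∉B | no v∉L | inj₂ (inj₂ (W , w' , p , to , out)) =
                inj₂ (inj₂ (v ∷ W , w' , a ∷ p , to , λ { (here refl) → v∈ , v∉B , v∉L ; (there q) → out q }))

      module Shortest {L W : List (Fin n)} (conf : Conf L) (link : Link L W)
        (short : ∀ {L' W'} → Conf L' → Link L' W' → length W ≤ length W') where
        open Strand (strand conf)
        open Link link

        B' : List (Fin n)
        B' = (B₀ ++ L) ++ W

        B'-split : ∀ {v} → v ∈ B' → v ∈ B₀ ++ L ⊎ v ∈ W
        B'-split = ∈-++⁻ (B₀ ++ L)

        -- Two neighbours in `B₀ ++ L` and one in `W` are within the bound. If `z` has two in `W`, a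
        -- neighbour in `B₀` or inside `L` would give a shorter link through `z`, so only `x₁` and
        -- `x₂` are left in `B₀ ++ L`, and `z` cannot see both.
        few₃ : ∀ {z} → z ∈ Vs → z ∉ B' → NN (Few 3 z (_∈ B'))
        few₃ {z} z∈ z∉ = case on-path {z = z} wpath of λ
            { (inj₁ (W' , path' , W'⊆ , lt)) → absurd (<⇒≱ lt (short conf record
                { wpath = path' ; from = from ; to = to
                ; out = λ q → case W'⊆ q of λ { (inj₁ r) → out r ; (inj₂ refl) → z-out } }))
            ; (inj₂ (inj₁ f)) → do
                g ← few z∈ z∉B₀ z∉L
                case g of λ
                  { (inj₁ g) → pure (few-map ≤-refl (λ _ → B'-split) (few-⊎ g f))
                  ; (inj₂ (g , (c , ci , zc , only) , (d , d∈ , zd))) →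
                      pure (few-map ≤-refl (λ a q → case B'-split q of λ
                        { (inj₁ r) → inj₁ r
                        ; (inj₂ r) → ⊥-elim (lonely c ci zc only (short conf record
                            { wpath = [-] ; from = c , ci , symA zc ; to = d , d∈ , zd
                            ; out = λ { (here refl) → z-out } }) wpath from a r) })
                        (few-⊎ g (few-none {P = λ _ → ⊥} λ _ ()))) }
            ; (inj₂ (inj₂ (A , p , m , q , E , refl , zp , zq , only))) →
                let noB₀ : ∀ {y} → Adj z y → y ∉ B₀
                    noB₀ {y} a y∈ = <⇒≱ (lenA A p m q E) (short conf record
                      { wpath = pth-join A (proj₁ (pth-split A wpath)) (symA zp) [-]
                      ; from = from ; to = y , y∈ , a
                      ; out = λ r → case ∈-++⁻ A r of λ
                          { (inj₁ s) → out (∈-++⁺ˡ s) ; (inj₂ (here refl)) → out (∈-mid A)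
                          ; (inj₂ (there (here refl))) → z-out } })
                    last : Pth q (q ∷ E) w'
                    last = proj₂ (pth-split (p ∷ m ∷ []) (proj₂ (pth-split A wpath)))
                    qE⊆ : ∀ {v} → v ∈ q ∷ E → v ∈ W
                    qE⊆ r = ∈-++⁺ʳ A (there (there r))
                    noL : ∀ {y} → Adj z y → y ∈ L → y ≡ x₁ ⊎ y ≡ x₂
                    noL {y} a y∈ = case ((y ≟F x₁) , (y ≟F x₂)) of λ
                      { (yes e , _) → inj₁ e
                      ; (no _ , yes e) → inj₂ e
                      ; (no n₁ , no n₂) → ⊥-elim (<⇒≱ (lenE A p m q E) (short conf record
                          { wpath = zq ∷ last ; from = y , (y∈ , n₁ , n₂) , symA a ; to = to
                          ; out = λ { (here refl) → z-out ; (there r) → out (qE⊆ r) } })) }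
                    fin : Few 1 z (_∈ B₀ ++ L) → NN (Few 3 z (_∈ B'))
                    fin f = pure (few-map ≤-refl (λ _ → B'-split) (few-⊎ f (few-pair only)))
                in case ((adj? z x₁) , (adj? z x₂)) of λ
                  -- If `z` sees both ends, the path through `z` takes the place of `L`, and the
                  -- part of `W` from `q` on is a shorter link to it.
                  { (yes a₁ , yes a₂) → do
                      conf' ← swap conf z∈ z∉B₀ z∉L a₁ a₂
                      absurd (<⇒≱ (lenE' A p m q E) (short conf' record
                        { wpath = last
                        ; from = z , (there (here refl) , (λ { refl → z∉L (pth-head path) }) , λ { refl → z∉L (pth-last path) }) , zq
                        ; to = to
                        ; out = λ r → let (v∈ , v∉ , v∉L) = out (qE⊆ r) in v∈ , v∉ , λ
                            { (here refl) → v∉L (pth-head path)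
                            ; (there (here refl)) → z∉ (∈-++⁺ʳ (B₀ ++ L) (qE⊆ r))
                            ; (there (there (here refl))) → v∉L (pth-last path) } }))
                  ; (no ¬a , _) → fin (few-one {p = x₂} λ a r → case ∈-++⁻ B₀ r of λ
                      { (inj₁ s) → ⊥-elim (noB₀ a s)
                      ; (inj₂ s) → case noL a s of λ { (inj₁ refl) → ⊥-elim (¬a a) ; (inj₂ e) → e } })
                  ; (yes _ , no ¬a) → fin (few-one {p = x₁} λ a r → case ∈-++⁻ B₀ r of λ
                      { (inj₁ s) → ⊥-elim (noB₀ a s)
                      ; (inj₂ s) → case noL a s of λ { (inj₂ refl) → ⊥-elim (¬a a) ; (inj₁ e) → e } }) } }
          where
          z∉B₀ : z ∉ B₀
          z∉B₀ q = z∉ (∈-++⁺ˡ (∈-++⁺ˡ q))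
          z∉L : z ∉ L
          z∉L q = z∉ (∈-++⁺ˡ (∈-++⁺ʳ B₀ q))
          z-out = z∈ , z∉B₀ , z∉L
          -- As `z` is a link, `W` is a single vertex by minimality. It is adjacent to the only
          -- inner vertex `c`, and so is `z`; an edge between them would close a triangle.
          lonely : ∀ {W w w'} c → In L c → Adj z c → (∀ c' → In L c' → c' ≡ c) → length W ≤ 1 → Pth w W w' →
            ∃[ c' ] In L c' × Adj c' w → ∀ {v} → Adj z v → v ∈ W → ⊥
          lonely c ci zc only _ [-] (c' , ci' , a') a (here refl) with only c' ci'
          ... | refl = no-triangle (symA zc) a' a
          lonely c ci zc only (s≤s ()) (_ ∷ [-]) _ _ _
          lonely c ci zc only (s≤s ()) (_ ∷ (_ ∷ _)) _ _ _
          lenA : ∀ (A : List (Fin n)) p m q E → length (A ++ p ∷ z ∷ []) < length (A ++ p ∷ m ∷ q ∷ E)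
          lenA A p m q E = ≤-trans (≤-reflexive (cong suc (length-++ A)))
            (≤-trans (≤-trans (≤-reflexive (sym (+-suc (length A) 2))) (+-monoʳ-≤ (length A) (s≤s (s≤s (s≤s z≤n)))))
              (≤-reflexive (sym (length-++ A))))
          lenE : ∀ (A : List (Fin n)) p m q E → length (z ∷ q ∷ E) < length (A ++ p ∷ m ∷ q ∷ E)
          lenE A p m q E = ≤-trans (m≤n+m _ (length A)) (≤-reflexive (sym (length-++ A)))
          lenE' : ∀ (A : List (Fin n)) p m q E → length (q ∷ E) < length (A ++ p ∷ m ∷ q ∷ E)
          lenE' A p m q E = ≤-trans (n≤1+n _) (lenE A p m q E)

        -- The greedy copy needs some vertex outside `B'` for its centre. The first vertex of `W`
        -- sees one: it has at most three neighbours in `B'`, and `t` is positive.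
        few-start : NN (Few 3 w (_∈ B'))
        few-start = do
            g ← few (proj₁ w-out) (proj₁ (proj₂ w-out)) (proj₂ (proj₂ w-out))
            case g of λ
              { (inj₁ g) → pure (few-map ≤-refl (λ _ → B'-split) (few-⊎ g (start-few wpath (λ p' h → short conf
                    record { wpath = p' ; from = from ; to = to ; out = λ q → out (h q) }))))
              ; (inj₂ (g , (c , ci , zc , only) , (d , d∈ , zd))) →
                  pure (few-map ≤-refl (λ a q → case B'-split q of λ
                    { (inj₁ r) → inj₁ r
                    ; (inj₂ r) → ⊥-elim (single wpath (short conf record
                        { wpath = [-] ; from = c , ci , symA zc ; to = d , d∈ , zd
                        ; out = λ { (here refl) → w-out } }) a r) })
                    (few-⊎ g (few-none {P = λ _ → ⊥} λ _ ()))) }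
          where
          w-out = out (pth-head wpath)
          single : ∀ {W w w'} → Pth w W w' → length W ≤ 1 → ∀ {v} → Adj w v → v ∈ W → ⊥
          single [-] _ a (here refl) = adj-≢ a refl
          single (_ ∷ [-]) (s≤s ())
          single (_ ∷ (_ ∷ _)) (s≤s ())
          start-few : ∀ {W w} → Pth w W w' → (∀ {W'} → Pth w W' w' → (∀ {v} → v ∈ W' → v ∈ W) → length W ≤ length W') →
            Few 1 w (_∈ W)
          start-few [-] s = few-one {p = w'} λ { a (here refl) → ⊥-elim (adj-≢ a refl) }
          start-few (_∷_ {y = y} b p) s = few-one {p = y} λ
            { a (here refl) → ⊥-elim (adj-≢ a refl)
            ; {v} a (there q) → case ∈-∃++ q of λ
              { ([] , E , refl) → pth-start p
              ; (x ∷ A , E , refl) → ⊥-elim (<⇒≱ (s≤s (s≤s (≤-trans (m≤n+m _ (length A)) (≤-reflexive (sym (length-++ A))))))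
                  (s (a ∷ proj₂ (pth-split (x ∷ A) p)) λ { (here refl) → here refl ; (there r) → there (∈-++⁺ʳ (x ∷ A) r) })) } }

        contradiction : NN ⊥
        contradiction = do
            fs ← few-start
            let (y , a , y∉B' , _) = few-deg (proj₁ (out (pth-head wpath))) fs [] (s≤s (s≤s t>0))
            (leg , S) ← greedy {Z = λ v → v ∈ Vs × v ∉ B'} {K = λ _ → t}
              (λ (v∈ , v∉) L' h → do
                f ← few₃ v∈ v∉
                few-free v∈ (λ q r → q , r) f L' h)
              (λ _ → ≤-refl) (adjV′ a , y∉B')
            let (c , ci@(c∈ , c₁ , c₂) , cw) = from
                (d , d∈ , w'd) = to
            (u , u∈ , u₁ , u₂ , du) ← anchored d∈
            let c∉U = inner∉ ci
                (A , E , eq) = ∈-∃++ c∈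
                path' = subst (λ L → Pth x₁ L x₂) eq path
                uniq' = subst Unique eq uniqL
                back₁ : Walk (λ v → v ∈ L × v ≢ x₂) c x₁
                back₁ = walk-rev (pth-walk (proj₁ (pth-split A path')) λ {v} q → case ∈-++⁻ A q of λ
                  { (inj₁ r) → subst (v ∈_) (sym eq) (∈-++⁺ˡ r) ,
                      λ { refl → unique-disj A uniq' r (pth-last (proj₂ (pth-split A path'))) }
                  ; (inj₂ (here refl)) → c∈ , c₂ })
                back₂ : Walk (λ v → v ∈ L × v ≢ x₁) c x₂
                back₂ = pth-walk (proj₂ (pth-split A path')) λ {v} q → subst (v ∈_) (sym eq) (∈-++⁺ʳ A q) ,
                  (λ { refl → head∉ A (proj₁ (pth-split A path')) uniq' c₁ q })
                onward : Walk (λ v → v ∈ B' × v ≢ x₁ × v ≢ x₂) c u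
                onward = step (L⊆B' c∈ , c₁ , c₂) cw
                  (pth-walk wpath (λ q → ∈-++⁺ʳ (B₀ ++ L) q , (λ { refl → proj₂ (proj₂ (out q)) (pth-head path) })
                      , (λ { refl → proj₂ (proj₂ (out q)) (pth-last path) })) +++
                   step (∈-++⁺ʳ (B₀ ++ L) (pth-last wpath) , (λ { refl → proj₂ (proj₂ (out (pth-last wpath))) (pth-head path) })
                      , (λ { refl → proj₂ (proj₂ (out (pth-last wpath))) (pth-last path) })) w'd
                   (walk-map (λ q → ∈-++⁺ˡ (∈-++⁺ˡ q) , (λ { refl → L∌B₀ (pth-head path) q }) , (λ { refl → L∌B₀ (pth-last path) q })) du))
                (d₁ , y₁ , v₁ , e₁ , (y₁∈ , y₁≢) , y₁∈U) = first-in U back₁ c∉U x₁∈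
                (d₂ , y₂ , v₂ , e₂ , (y₂∈ , y₂≢) , y₂∈U) = first-in U back₂ c∉U x₂∈
                (d₃ , y₃ , v₃ , e₃ , (_ , y₃≢₁ , y₃≢₂) , y₃∈U) = first-in U onward c∉U u∈
                -- Inner vertices of `L` are not in `U`, so `U` is first met at the end of `L`.
                q₁ : y₁ ≡ x₁
                q₁ = case y₁ ≟F x₁ of λ { (yes e) → e ; (no ne) → ⊥-elim (inner∉ (y₁∈ , ne , y₁≢) y₁∈U) }
                q₂ : y₂ ≡ x₂
                q₂ = case y₂ ≟F x₂ of λ { (yes e) → e ; (no ne) → ⊥-elim (inner∉ (y₂∈ , y₂≢ , ne) y₂∈U) }
            absurd (no-fan {B'} (∈-++⁺ˡ ∘ U⊆B₀L) B'⊆V (insep-mono ∈-++⁺ˡ insepL) (y , leg , S) x₁∈ x₂∈ y₃∈U ne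
              (≢-sym y₃≢₁) (≢-sym y₃≢₂)
              (d₁ , walk-map (λ ((r , _) , s) → L⊆B' r , s) v₁ , subst (Adj d₁) q₁ e₁)
              (d₂ , walk-map (λ ((r , _) , s) → L⊆B' r , s) v₂ , subst (Adj d₂) q₂ e₂)
              (d₃ , walk-map (λ ((r , _) , s) → r , s) v₃ , e₃))
          where
          L⊆B' : ∀ {v} → v ∈ L → v ∈ B'
          L⊆B' q = ∈-++⁺ˡ (∈-++⁺ʳ B₀ q)
          B'⊆V : ∀ {v} → v ∈ B' → v ∈ Vs
          B'⊆V q = case B'-split q of λ
            { (inj₁ r) → [ B₀⊆V , L⊆V ]′ (∈-++⁻ B₀ r) ; (inj₂ r) → proj₁ (out r) }
          head∉ : ∀ A {c E} → Pth x₁ (A ++ c ∷ []) c → Unique (A ++ c ∷ E) → c ≢ x₁ → x₁ ∉ c ∷ E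
          head∉ [] h u ne q = ne (pth-start h)
          head∉ (_ ∷ A) h u ne q with pth-start h
          ... | refl = unique-∉ u (∈-++⁺ʳ A q)

      attach : ∀ {L} → Conf L → NN ⊥
      attach {L} conf = do
        (W , link) ← find-link conf
        -- The minimum runs over strands as well as links, because a link found after a `swap`
        -- belongs to a different strand.
        ((L' , W') , (conf' , link') , mn) ← minimal (λ (L , W) → Conf L × Link L W) (length ∘ proj₂) ((L , W) , conf , link)
        Shortest.contradiction conf' link' λ c k → mn _ (c , k)

-- The two cases: B larger than U, and B equal to U

module Final {n p : ℕ} (H : Host n p) where
  open Host H
  open Legs H
  open Linkage H
  open States H
  open Attachment H

  module _ (X : Extremal) where
    open Extremal X
    open Ext X

    module Bridge {x₁ x₂} (x₁∈ : x₁ ∈ U) (x₂∈ : x₂ ∈ U) (ne : x₁ ≢ x₂) where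

      Anchor : Fin n → Set
      Anchor v = ∃[ u ] u ∈ U × u ≢ x₁ × u ≢ x₂ × Walk (Off B x₁ x₂) v u

      C : Fin n → Set
      C v = v ∈ B × v ≢ x₁ × v ≢ x₂ × ¬ Anchor v

      U∌C : ∀ {u} → u ∈ U → ¬ C u
      U∌C u∈ (v∈ , a , b , no-anchor) = no-anchor (_ , u∈ , a , b , stop (v∈ , a , b))

      exit : ∀ {v w} → C v → Adj v w → w ∈ B → ¬ C w → w ≡ x₁ ⊎ w ≡ x₂
      exit {v} {w} (v∈ , v₁ , v₂ , na) a w∈ ¬c = case ((w ≟F x₁) , (w ≟F x₂)) of λ
        { (yes e , _) → inj₁ e
        ; (no _ , yes e) → inj₂ e
        ; (no w₁ , no w₂) → ⊥-elim (¬c (w∈ , w₁ , w₂ , λ (u , u∈ , u₁ , u₂ , q) →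
            na (u , u∈ , u₁ , u₂ , step (v∈ , v₁ , v₂) a q))) }

      module _ (C? : ∀ v → Dec (C v)) where
        open Segment C? x₁∈ x₂∈ ne U∌C exit

        B₀∌Q : ∀ {v} → v ∈ B₀ → ¬ Q v
        B₀∌Q q = proj₂ (filter-∈⁻ (¬? ∘ Q?) B q)

        walk-B₀ : ∀ {v u} → u ∈ U → u ≢ x₁ → u ≢ x₂ → Walk (Off B x₁ x₂) v u → Walk (_∈ B₀) v u
        walk-B₀ {v} {u} u∈ u₁ u₂ = go
          where
          here∈ : ∀ {v} → Walk (Off B x₁ x₂) v u → v ∈ B₀
          here∈ w = let (v∈ , v₁ , v₂) = walk-start w in filter-∈ (¬? ∘ Q?) v∈ λ
            { (inj₁ (_ , _ , _ , na)) → na (u , u∈ , u₁ , u₂ , w)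
            ; (inj₂ (inj₁ e)) → v₁ e ; (inj₂ (inj₂ e)) → v₂ e }
          go : ∀ {v} → Walk (Off B x₁ x₂) v u → Walk (_∈ B₀) v u
          go w@(stop _) = stop (here∈ w)
          go w@(step _ a w') = step (here∈ w) a (go w')

        anchored : ∀ {d} → d ∈ B₀ → NN (∃[ u ] u ∈ U × u ≢ x₁ × u ≢ x₂ × Walk (_∈ B₀) d u)
        anchored {d} d∈ = do
          (u , u∈ , u₁ , u₂ , w) ← by-contra {Anchor d} λ na → pure (B₀∌Q d∈ (inj₁ (B₀⊆B d∈ ,
            (λ e → B₀∌Q d∈ (inj₂ (inj₁ e))) , (λ e → B₀∌Q d∈ (inj₂ (inj₂ e))) , na)))
          pure (u , u∈ , u₁ , u₂ , walk-B₀ u∈ u₁ u₂ w)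

        -- `L` may leave `B`, as it does after a swap. By `shortL` the list `B₀ ++ L` is no longer
        -- than `B`, so it is extremal again (`X'`) and the bound of two neighbours holds for it as
        -- well.
        record Conf (L : List (Fin n)) : Set where
          field
            path   : Pth x₁ L x₂
            uniqL  : Unique L
            inner  : ∃ (Inner X x₁ x₂ L)
            inner∉ : ∀ {c} → Inner X x₁ x₂ L c → c ∉ U
            L∌B₀   : ∀ {v} → v ∈ L → v ∉ B₀
            L⊆V    : ∀ {v} → v ∈ L → v ∈ Vs
            insepL : Inseparable U (B₀ ++ L)
            apart  : ∀ {c d} → Inner X x₁ x₂ L c → d ∈ B₀ → ¬ Adj c d
            copyL  : CopyOff (B₀ ++ L)
            shortL : length L ≤ length (filter Q? B)

          X' : Extremal
          X' = record
            { state = record { State state ; B = B₀ ++ L ; U⊆B = U⊆ path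
                             ; B⊆V = λ q → [ B⊆V ∘ B₀⊆B , L⊆V ]′ (∈-++⁻ B₀ q) ; insep = insepL ; copy = copyL }
            ; maxU = maxU
            ; minB = λ s h → ≤-trans (≤-trans (≤-reflexive (length-++ B₀)) (≤-trans (+-monoʳ-≤ (length B₀) shortL)
                (≤-reflexive (trans (+-comm (length B₀) _) (filter-length Q? B))))) (minB s h) }

          fewL : ∀ {z} → z ∈ Vs → z ∉ B₀ → z ∉ L → NN (CopyOff (z ∷ B₀ ++ L) × Few 2 z (_∈ B₀ ++ L))
          fewL z∈ z∉B₀ z∉L = Ext.all-few′ X' (∈-++⁺ʳ B₀ (proj₁ (proj₂ inner))) (inner∉ (proj₂ inner))
            (z∈ , λ q → [ z∉B₀ , z∉L ]′ (∈-++⁻ B₀ q))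

          strand : Strand X x₁ x₂ B₀ L
          strand = record
            { path = path ; uniqL = uniqL ; inner = inner ; inner∉ = inner∉ ; L∌B₀ = L∌B₀ ; L⊆V = L⊆V
            ; U⊆B₀L = U⊆ path ; insepL = insepL ; apart = apart
            ; few = λ z∈ a b → do
                (_ , f) ← fewL z∈ a b
                pure (inj₁ f) }

        -- `z` has at most two neighbours in `B₀ ++ L`, and these are `x₁` and `x₂`. Hence `z` sees
        -- nothing of `B₀`, so `x₁` and `x₂` cut off `C` together with `z`. The new path has three
        -- vertices and `L` has at least as many.
        swap : ∀ {L z} → Conf L → z ∈ Vs → z ∉ B₀ → z ∉ L → Adj z x₁ → Adj z x₂ → NN (Conf (x₁ ∷ z ∷ x₂ ∷ []))
        swap {L} {z} conf z∈ z∉B₀ z∉L a₁ a₂ = do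
            (cp , f) ← fewL z∈ z∉B₀ z∉L
            let apart' : ∀ {d} → d ∈ B₀ → ¬ Adj z d
                apart' d∈ a = few-three f a₁ (∈-++⁺ʳ B₀ (pth-head path)) a₂ (∈-++⁺ʳ B₀ (pth-last path)) a (∈-++⁺ˡ d∈)
                  ne (λ { refl → L∌B₀ (pth-head path) d∈ }) (λ { refl → L∌B₀ (pth-last path) d∈ })
            pure record
              { path = symA a₁ ∷ a₂ ∷ [-]
              ; uniqL = unique-∷ (λ { (here e) → z≢₁ (sym e) ; (there (here e)) → ne e })
                  (unique-∷ (λ { (here e) → z≢₂ e }) ([] ∷ []))
              ; inner = z , there (here refl) , z≢₁ , z≢₂
              ; inner∉ = λ { (here refl , n₁ , _) → ⊥-elim (n₁ refl) ; (there (here refl) , _) → z∉U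
                           ; (there (there (here refl)) , _ , n₂) → ⊥-elim (n₂ refl) }
              ; L∌B₀ = λ { (here refl) → L∌B₀ (pth-head path) ; (there (here refl)) → z∉B₀
                         ; (there (there (here refl))) → L∌B₀ (pth-last path) }
              ; L⊆V = λ { (here refl) → L⊆V (pth-head path) ; (there (here refl)) → z∈
                        ; (there (there (here refl))) → L⊆V (pth-last path) }
              ; insepL = replace-insep C⁺? ne insep
                  (λ { u∈ (inj₁ c) → U∌C u∈ c ; u∈ (inj₂ refl) → z∉U u∈ })
                  (λ { (inj₁ c) a w∈ ¬c → exit c a w∈ (¬c ∘ inj₁)
                     ; {w = w} (inj₂ refl) a w∈ ¬c → case Q? w of λ
                       { (no nq) → ⊥-elim (apart' (filter-∈ (¬? ∘ Q?) w∈ nq) a)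
                       ; (yes (inj₁ c)) → ⊥-elim (¬c (inj₁ c))
                       ; (yes (inj₂ e)) → e } })
                  (λ {v} v∈ ¬c → case Q? v of λ
                    { (no nq) → ∈-++⁺ˡ (filter-∈ (¬? ∘ Q?) v∈ nq)
                    ; (yes (inj₁ c)) → ⊥-elim (¬c (inj₁ c))
                    ; (yes (inj₂ (inj₁ refl))) → ∈-++⁺ʳ B₀ (here refl)
                    ; (yes (inj₂ (inj₂ refl))) → ∈-++⁺ʳ B₀ (there (there (here refl))) })
                  x₁∈ x₂∈ spread (symA a₁ ∷ a₂ ∷ [-])
                  (λ { (here refl) → inj₂ (inj₁ refl) ; (there (here refl)) → inj₁ (inj₂ refl)
                     ; (there (there (here refl))) → inj₂ (inj₂ refl) })
                  (∈-++⁺ʳ B₀)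
              ; apart = λ { (here refl , n₁ , _) _ → ⊥-elim (n₁ refl) ; (there (here refl) , _) → apart'
                          ; (there (there (here refl)) , _ , n₂) _ → ⊥-elim (n₂ refl) }
              ; copyL = copy-mono (λ q → case ∈-++⁻ B₀ q of λ
                  { (inj₁ r) → there (∈-++⁺ˡ r)
                  ; (inj₂ (here refl)) → there (∈-++⁺ʳ B₀ (pth-head path))
                  ; (inj₂ (there (here refl))) → here refl
                  ; (inj₂ (there (there (here refl)))) → there (∈-++⁺ʳ B₀ (pth-last path)) }) cp
              ; shortL = ≤-trans (three inner) shortL }
          where
          open Conf conf
          z≢₁ : z ≢ x₁
          z≢₁ refl = z∉L (pth-head path)
          z≢₂ : z ≢ x₂
          z≢₂ refl = z∉L (pth-last path)
          z∉U : z ∉ U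
          z∉U q = [ z∉B₀ , z∉L ]′ (∈-++⁻ B₀ (U⊆ path q))
          C⁺? : ∀ v → Dec (C v ⊎ v ≡ z)
          C⁺? v with C? v | v ≟F z
          ... | yes c | _ = yes (inj₁ c)
          ... | no _ | yes e = yes (inj₂ e)
          ... | no a | no b = no [ a , b ]′
          three : ∃ (Inner X x₁ x₂ L) → 3 ≤ length L
          three (c , c∈ , c₁ , c₂) = unique-⊆-length {xs = x₁ ∷ c ∷ x₂ ∷ []}
            (unique-∷ (λ { (here e) → c₁ (sym e) ; (there (here e)) → ne e })
              (unique-∷ (λ { (here e) → c₂ e }) ([] ∷ [])))
            λ { (here refl) → pth-head path ; (there (here refl)) → c∈ ; (there (there (here refl))) → pth-last path }

        start : ∀ {c} → C c → NN (∃ Conf)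
        start {c} cc = do
          d ← chord
          case d of λ
            { (inj₂ none) → absurd (none (proj₁ cc) cc)
            ; (inj₁ ch) →
                let open Chord ch
                    in-C : ∀ {v} → Inner X x₁ x₂ L v → C v
                    in-C (v∈ , v₁ , v₂) = case proj₁ (L⊆ v∈) of λ
                      { (inj₁ c) → c ; (inj₂ (inj₁ e)) → ⊥-elim (v₁ e) ; (inj₂ (inj₂ e)) → ⊥-elim (v₂ e) }
                in pure (L , record
                { path = path ; uniqL = uniqL
                ; inner = c , B⊆L (proj₁ cc) (inj₁ cc) , proj₁ (proj₂ cc) , proj₁ (proj₂ (proj₂ cc))
                ; inner∉ = λ i u∈ → U∌C u∈ (in-C i)
                ; L∌B₀ = λ q r → B₀∌Q r (proj₁ (L⊆ q))
                ; L⊆V = λ q → B⊆V (proj₂ (L⊆ q))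
                ; insepL = reroute path (λ q → proj₁ (L⊆ q))
                ; apart = λ i d∈ a → case exit (in-C i) a (B₀⊆B d∈) (λ cd → B₀∌Q d∈ (inj₁ cd)) of λ
                    { e → B₀∌Q d∈ (inj₂ e) }
                ; copyL = copy-mono (λ q → [ B₀⊆B , (λ r → proj₂ (L⊆ r)) ]′ (∈-++⁻ B₀ q)) copy
                ; shortL = short }) }

    B-not-larger : ∀ {c} → c ∈ B → c ∉ U → NN ⊥
    B-not-larger {c} c∈ c∉ = do
      (x₁ , x₂ , x₁∈ , x₂∈ , ne , att) ← attachments (B⊆V c∈) c∉ (copy-mono (λ { (here refl) → c∈ ; (there q) → q }) copy)
      let module S = Bridge x₁∈ x₂∈ ne
      C? ← decide S.C
      -- `c` lies in `C`: a walk from `c` to another vertex of `U` that misses `x₁` and `x₂` would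
      -- first meet `U` in a third attachment.
      (L , conf) ← S.start C? (c∈ , (λ { refl → c∉ x₁∈ }) , (λ { refl → c∉ x₂∈ }) , λ (u , u∈ , u₁ , u₂ , w) →
        let (d , x , w' , a , (_ , n₁ , n₂) , x∈) = first-in U w c∉ u∈
        in [ n₁ , n₂ ]′ (att d x (walk-map (λ ((v∈ , _) , v∉) → there v∈ , v∉) w') a x∈))
      attach X x₁∈ x₂∈ ne (Segment.B₀ C? x₁∈ x₂∈ ne S.U∌C S.exit)
        (λ q → B⊆V (Segment.B₀⊆B C? x₁∈ x₂∈ ne S.U∌C S.exit q)) (S.anchored C?)
        (S.Conf C?) (S.Conf.strand) (S.swap C?) conf

    module Ears (B⊆U : ∀ {v} → v ∈ B → v ∈ U) (fewU : ∀ {z} → z ∈ Vs → z ∉ U → NN (Few 2 z (_∈ U))) where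

      record Ear (u₁ u₂ : Fin n) (M : List (Fin n)) : Set where
        field
          {m m'} : Fin n
          path : Pth m M m'
          from : Adj u₁ m
          to   : Adj m' u₂
          u₁∈  : u₁ ∈ U
          u₂∈  : u₂ ∈ U
          ends≢ : u₁ ≢ u₂
          out  : ∀ {v} → v ∈ M → v ∈ Vs × v ∉ U

      -- When the first vertex `y₁` of `U` has been reached, `G` without `y₁` is still connected,
      -- and a walk in it reaches a second one.
      find-ear : ∀ {z} → z ∈ Vs → z ∉ U → NN (∃[ u₁ ] ∃[ u₂ ] ∃[ M ] Ear u₁ u₂ M)
      find-ear {z} z∈ z∉ = do
        let (u , u∈ , _) = spread z z z
            (a , a∈ , a≢u , _) = spread u u u
        w ← conn a a z∈ (apart a∈) (apart a∈) (B⊆V (U⊆B u∈)) (≢-sym a≢u) (≢-sym a≢u)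
        let (d₁ , y₁ , w₁ , e₁ , _ , y₁∈) = first-in U w z∉ u∈
            (b , b∈ , b≢ , _) = spread y₁ y₁ y₁
        w' ← conn y₁ y₁ z∈ (apart y₁∈) (apart y₁∈) (B⊆V (U⊆B b∈)) b≢ b≢
        let (d₂ , y₂ , w₂ , e₂ , (_ , y₂≢ , _) , y₂∈) = first-in U w' z∉ b∈
            (M , path , M⊆ , _) = walk-pth (walk-map {Q = λ v → v ∈ Vs × v ∉ U} (λ ((q , _) , r) → q , r) (walk-rev w₁)
              +++ walk-map (λ ((q , _) , r) → q , r) w₂)
        pure (y₁ , y₂ , M , record
          { path = path ; from = symA e₁ ; to = e₂ ; u₁∈ = y₁∈ ; u₂∈ = y₂∈ ; ends≢ = ≢-sym y₂≢ ; out = M⊆ })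
        where
        apart : ∀ {a} → a ∈ U → z ≢ a
        apart a∈ refl = z∉ a∈

      Shortest : List (Fin n) → Set
      Shortest M = ∀ {u₁ u₂ M'} → Ear u₁ u₂ M' → length M ≤ length M'

      pth-snoc : ∀ {x L y z} → Pth x L y → Adj y z → Pth x (L ++ z ∷ []) z
      pth-snoc [-] a = a ∷ [-]
      pth-snoc (b ∷ h) a = b ∷ pth-snoc h a

      pth-nonempty : ∀ {x L y} → Pth x L y → 1 ≤ length L
      pth-nonempty [-] = s≤s z≤n
      pth-nonempty (_ ∷ _) = s≤s z≤n

      module _ {x₁ x₂ : Fin n} where

        Other : Fin n → Set
        Other v = v ≢ x₁ × v ≢ x₂

        other? : ∀ v → Dec (Other v)
        other? v = ¬? (v ≟F x₁) ×-dec ¬? (v ≟F x₂)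

        B₀ : List (Fin n)
        B₀ = filter other? U

        record EarConf (L : List (Fin n)) : Set where
          field
            {M} : List (Fin n)
            L≡  : L ≡ x₁ ∷ M ++ x₂ ∷ []
            ear : Ear x₁ x₂ M
            uniqM : Unique M
            least : Shortest M
          open Ear ear

          single : ∀ {N : List (Fin n)} {c} A E → N ≡ A ++ c ∷ E → length N ≤ length (A ++ c ∷ []) → length N ≤ length (c ∷ E) → N ≡ c ∷ []
          single [] [] e _ _ = e
          single [] (x ∷ E) refl (s≤s ()) _
          single (a ∷ A) E refl _ h = ⊥-elim (<⇒≱ (s≤s (≤-trans (m≤n+m _ (length A)) (≤-reflexive (sym (length-++ A))))) h)

          -- The edge cuts the ear at `c` into two ears, one ending and one starting at `d`. Neither
          -- is shorter than `M`, so `c` is both the first and the last vertex of `M`.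
          edge-to-U : ∀ {c d} → c ∈ M → d ∈ U → Other d → Adj c d → M ≡ c ∷ []
          edge-to-U {c} {d} c∈ d∈ (d₁ , d₂) a with ∈-∃++ c∈
          ... | A , E , eq = single A E eq
            (least record { path = proj₁ (pth-split A path′) ; from = from ; to = a ; u₁∈ = u₁∈ ; u₂∈ = d∈ ; ends≢ = ≢-sym d₁
                          ; out = λ q → out (subst (_ ∈_) (sym eq) (case ∈-++⁻ A q of λ
                              { (inj₁ r) → ∈-++⁺ˡ r ; (inj₂ (here refl)) → ∈-mid A })) })
            (least record { path = proj₂ (pth-split A path′) ; from = symA a ; to = to ; u₁∈ = d∈ ; u₂∈ = u₂∈ ; ends≢ = d₂
                          ; out = λ q → out (subst (_ ∈_) (sym eq) (∈-++⁺ʳ A q)) })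
            where
            path′ : Pth m (A ++ c ∷ E) m'
            path′ = subst (λ L → Pth m L m') eq path

          M⊆L : ∀ {v} → v ∈ M → v ∈ L
          M⊆L q = subst (_ ∈_) (sym L≡) (there (∈-++⁺ˡ q))

          L-cases : ∀ {v} → v ∈ L → v ≡ x₁ ⊎ v ≡ x₂ ⊎ v ∈ M
          L-cases q with subst (_ ∈_) L≡ q
          ... | here e = inj₁ e
          ... | there r with ∈-++⁻ M r
          ...   | inj₁ s = inj₂ (inj₂ s)
          ...   | inj₂ (here e) = inj₂ (inj₁ e)

          U⊆L : ∀ {v} → v ∈ U → v ∈ B₀ ++ L
          U⊆L {v} v∈ = case ((v ≟F x₁) , (v ≟F x₂)) of λ
            { (yes refl , _) → ∈-++⁺ʳ B₀ (subst (_ ∈_) (sym L≡) (here refl))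
            ; (no _ , yes refl) → ∈-++⁺ʳ B₀ (subst (_ ∈_) (sym L≡) (there (∈-mid M)))
            ; (no a , no b) → ∈-++⁺ˡ (filter-∈ other? v∈ (a , b)) }

          inner-M : ∀ {v} → Inner X x₁ x₂ L v → v ∈ M
          inner-M (v∈ , v₁ , v₂) = case L-cases v∈ of λ
            { (inj₁ e) → ⊥-elim (v₁ e) ; (inj₂ (inj₁ e)) → ⊥-elim (v₂ e) ; (inj₂ (inj₂ q)) → q }

          M-inner : ∀ {v} → v ∈ M → Inner X x₁ x₂ L v
          M-inner q = M⊆L q , (λ { refl → proj₂ (out q) u₁∈ }) , λ { refl → proj₂ (out q) u₂∈ }

          UM : ∀ {v} → v ∈ B₀ ++ L → v ∈ U ⊎ v ∈ M
          UM q = case ∈-++⁻ B₀ q of λ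
            { (inj₁ r) → inj₁ (proj₁ (filter-∈⁻ other? U r))
            ; (inj₂ r) → case L-cases r of λ
              { (inj₁ refl) → inj₁ u₁∈ ; (inj₂ (inj₁ refl)) → inj₁ u₂∈ ; (inj₂ (inj₂ s)) → inj₂ s } }

          -- A vertex with two neighbours in `U` is an ear by itself; if it also sees `M`, then `M`
          -- is a single vertex `c`. Its neighbours in `U` differ from `x₁` and `x₂`, which are
          -- adjacent to `c`, as there are no triangles. This is how the second alternative arises.
          few′ : ∀ {z} → z ∈ Vs → z ∉ B₀ → z ∉ L → NN (Few 2 z (_∈ B₀ ++ L) ⊎
                   (Few 3 z (_∈ B₀ ++ L) × (∃[ c ] Inner X x₁ x₂ L c × Adj z c × (∀ c' → Inner X x₁ x₂ L c' → c' ≡ c)) ×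
                    (∃[ d ] d ∈ B₀ × Adj z d)))
          few′ {z} z∈ z∉B₀ z∉L = do
              f ← fewU z∈ z∉U
              case on-path {z = z} path of λ
                { (inj₁ (M' , path' , M'⊆ , lt)) → absurd (<⇒≱ lt (least record
                    { Ear ear ; path = path' ; out = λ q → case M'⊆ q of λ { (inj₁ r) → out r ; (inj₂ refl) → z∈ , z∉U } }))
                ; (inj₂ (inj₁ g)) → do
                    d₁ ← em (Few 1 z (_∈ U))
                    case d₁ of λ
                      { (inj₁ f₁) → pure (inj₁ (few-map ≤-refl (λ _ → UM) (few-⊎ f₁ g)))
                      ; (inj₂ ¬f₁) → do
                          (u , u' , a , u∈ , a' , u'∈ , u≢) ← two-nbrs ¬f₁
                          d₂ ← em (∃[ c ] c ∈ M × Adj z c)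
                          case d₂ of λ
                            { (inj₂ none) → pure (inj₁ (few-map ≤-refl (λ b q → case UM q of λ
                                { (inj₁ r) → r ; (inj₂ r) → ⊥-elim (none (_ , r , b)) }) f))
                            ; (inj₁ (c , c∈ , zc)) →
                                let M≡ = sole c∈ path (least record
                                           { path = [-] ; from = symA a ; to = a' ; u₁∈ = u∈ ; u₂∈ = u'∈ ; ends≢ = u≢
                                           ; out = λ { (here refl) → z∈ , z∉U } })
                                in pure (inj₂ (few-map ≤-refl (λ _ → UM) (few-⊎ f g) ,
                                  (c , M-inner c∈ , zc , λ c' i → only-one M≡ (inner-M i)) ,
                                  u , filter-∈ other? u∈ (
                                    (λ { refl → no-triangle zc a (symA (subst (Adj x₁) (proj₁ (ends-eq M≡ path)) from)) }) ,
                                    (λ { refl → no-triangle zc a (subst (λ v → Adj v x₂) (proj₂ (ends-eq M≡ path)) to) })) , a)) } }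
                ; (inj₂ (inj₂ (A , p , v , q , E , eq , zp , zq , only))) →
                    let path₁ = subst (λ L → Pth m L m') eq path
                        out₁ : ∀ {v'} → v' ∈ A ++ p ∷ v ∷ q ∷ E → v' ∈ Vs × v' ∉ U
                        out₁ r = out (subst (_ ∈_) (sym eq) r)
                        no-U : ∀ {u} → Adj z u → u ∈ U → ⊥
                        no-U {u} a u∈ = case u ≟F x₂ of λ
                          { (no u₂) → <⇒≱ (≤-trans (≤-trans (m≤n+m _ (length A)) (≤-reflexive (sym (length-++ A))))
                                (≤-reflexive (cong length (sym eq)))) (least record
                                { path = zq ∷ proj₂ (pth-split (p ∷ v ∷ []) (proj₂ (pth-split A path₁))) ; from = symA a ; to = to
                                ; u₁∈ = u∈ ; u₂∈ = u₂∈ ; ends≢ = u₂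
                                ; out = λ { (here refl) → z∈ , z∉U ; (there r) → out₁ (∈-++⁺ʳ A (there (there r))) } })
                          ; (yes refl) → <⇒≱ (≤-trans (shorter A p v q E) (≤-reflexive (cong length (sym eq)))) (least record
                                { path = pth-join A (proj₁ (pth-split A path₁)) (symA zp) [-] ; from = from ; to = a
                                ; u₁∈ = u₁∈ ; u₂∈ = u∈ ; ends≢ = ends≢
                                ; out = λ r → case ∈-++⁻ A r of λ
                                    { (inj₁ s) → out₁ (∈-++⁺ˡ s) ; (inj₂ (here refl)) → out₁ (∈-mid A)
                                    ; (inj₂ (there (here refl))) → z∈ , z∉U } }) }
                    in pure (inj₁ (few-pair λ a r → case UM r of λ
                      { (inj₁ s) → ⊥-elim (no-U a s) ; (inj₂ s) → only a s })) }
            where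
            z∉U : z ∉ U
            z∉U q = [ z∉B₀ , z∉L ]′ (∈-++⁻ B₀ (U⊆L q))
            sole : ∀ {M m m' c} → c ∈ M → Pth m M m' → length M ≤ 1 → M ≡ c ∷ []
            sole (here refl) [-] _ = refl
            sole _ (_ ∷ [-]) (s≤s ())
            sole _ (_ ∷ (_ ∷ _)) (s≤s ())
            only-one : ∀ {M c c'} → M ≡ c ∷ [] → c' ∈ M → c' ≡ c
            only-one refl (here e) = e
            ends-eq : ∀ {M m m' c} → M ≡ c ∷ [] → Pth m M m' → m ≡ c × m' ≡ c
            ends-eq refl [-] = refl , refl
            shorter : ∀ (A : List (Fin n)) p m q E → length (A ++ p ∷ z ∷ []) < length (A ++ p ∷ m ∷ q ∷ E)
            shorter A p m q E = ≤-trans (≤-reflexive (cong suc (length-++ A)))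
              (≤-trans (≤-trans (≤-reflexive (sym (+-suc (length A) 2))) (+-monoʳ-≤ (length A) (s≤s (s≤s (s≤s z≤n)))))
                (≤-reflexive (sym (length-++ A))))

          strand : Strand X x₁ x₂ B₀ L
          strand = record
            { path = subst (λ L → Pth x₁ L x₂) (sym L≡) (from ∷ pth-snoc path to)
            ; uniqL = subst Unique (sym L≡) (unique-∷ (λ q → case ∈-++⁻ M q of λ
                { (inj₁ r) → proj₂ (out r) u₁∈ ; (inj₂ (here e)) → ends≢ e })
                (unique-++ uniqM ([] ∷ []) λ { r (here refl) → proj₂ (out r) u₂∈ }))
            ; inner = m , M-inner (pth-head path)
            ; inner∉ = λ i → proj₂ (out (inner-M i))
            ; L∌B₀ = λ q r → let (v∈ , v₁ , v₂) = filter-∈⁻ other? U r in proj₂ (out (inner-M (q , v₁ , v₂))) v∈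
            ; L⊆V = λ q → case L-cases q of λ
                { (inj₁ refl) → B⊆V (U⊆B u₁∈) ; (inj₂ (inj₁ refl)) → B⊆V (U⊆B u₂∈) ; (inj₂ (inj₂ r)) → proj₁ (out r) }
            ; U⊆B₀L = U⊆L
            ; insepL = insep-mono (λ q → U⊆L (B⊆U q)) insep
            -- By `edge-to-U` the inner vertex would have the three neighbours `x₁`, `x₂` and `d` in
            -- `U`.
            ; apart = λ i d∈ a → let c∈ = inner-M i
                                     (dU , d₁ , d₂) = filter-∈⁻ other? U d∈
                                     e = edge-to-U c∈ dU (d₁ , d₂) a
                                     (e₁ , e₂) = ends-eq′ e path
                in fewU (proj₁ (out c∈)) (proj₂ (out c∈)) λ f →
                  few-three f (symA (subst (Adj x₁) e₁ from)) u₁∈ (subst (λ v → Adj v x₂) e₂ to) u₂∈ a dU ends≢ (≢-sym d₁) (≢-sym d₂)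
            ; few = few′ }
            where
            ends-eq′ : ∀ {M m m' c} → M ≡ c ∷ [] → Pth m M m' → m ≡ c × m' ≡ c
            ends-eq′ refl [-] = refl , refl

        ear-swap : ∀ {L z} → EarConf L → z ∈ Vs → z ∉ B₀ → z ∉ L → Adj z x₁ → Adj z x₂ → NN (EarConf (x₁ ∷ z ∷ x₂ ∷ []))
        ear-swap conf z∈ z∉B₀ z∉L a₁ a₂ = pure record
          { M = _ ∷ [] ; L≡ = refl ; uniqM = [] ∷ [] ; least = λ e → pth-nonempty (Ear.path e)
          ; ear = record { path = [-] ; from = symA a₁ ; to = a₂ ; u₁∈ = Ear.u₁∈ ear ; u₂∈ = Ear.u₂∈ ear ; ends≢ = Ear.ends≢ ear
                         ; out = λ { (here refl) → z∈ , λ q → [ z∉B₀ , z∉L ]′ (∈-++⁻ B₀ (U⊆L q)) } } }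
          where open EarConf conf

      U-not-all : ∀ {z} → z ∈ Vs → z ∉ U → NN ⊥
      U-not-all z∈ z∉ = do
        (u₁ , u₂ , M , e) ← find-ear z∈ z∉
        ((x₁ , x₂ , M₁) , e₁ , mn) ← minimal (λ (a , b , M) → Ear a b M) (λ (_ , _ , M) → length M) ((u₁ , u₂ , M) , e)
        let module E = Ear e₁
            (M₂ , path , M⊆ , uM) = walk-pth (pth-walk E.path (λ q → q))
        attach X E.u₁∈ E.u₂∈ E.ends≢ (B₀ {x₁} {x₂})
          (λ q → B⊆V (U⊆B (proj₁ (filter-∈⁻ other? U q))))
          (λ {d} q → let (d∈ , d₁ , d₂) = filter-∈⁻ other? U q in pure (d , d∈ , d₁ , d₂ , stop q))
          EarConf EarConf.strand ear-swap
          record { L≡ = refl ; uniqM = uM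
                 ; ear = record { E ; path = path ; out = λ q → E.out (M⊆ q) }
                 ; least = λ e → ≤-trans (unique-⊆-length uM M⊆) (mn _ e) }

  Outside : Fin n → (Fin p → List (Fin n)) → Fin n → Set
  Outside z leg v = v ∈ Vs × v ∉ vs z leg

  record GoodCopy : Set where
    field
      z      : Fin n
      leg    : Fin p → List (Fin n)
      spider : Spider (_∈ Vs) z ls leg
      linked : ∀ x y {u v} → Outside z leg u → u ≢ x → u ≢ y → Outside z leg v → v ≢ x → v ≢ y →
               NN (Walk (λ w → Outside z leg w × w ≢ x × w ≢ y) u v)
      big    : ∀ a b c → ∃[ u ] Outside z leg u × u ≢ a × u ≢ b × u ≢ c

  good-copy : State → NN GoodCopy
  good-copy s = do
      X ← extremal s
      conclude X
    where
    conclude : Extremal → NN GoodCopy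
    conclude X = do
        d₁ ← em (∃[ c ] c ∈ B × c ∉ U)
        case d₁ of λ
          { (inj₁ (c , c∈ , c∉)) → B-not-larger X c∈ c∉ >>= absurd
          ; (inj₂ none) → do
              let B⊆U : ∀ {v} → v ∈ B → v ∈ U
                  B⊆U {v} v∈ = case v ∈? U of λ { (yes q) → q ; (no q) → ⊥-elim (none (v , v∈ , q)) }
                  (z , leg , S) = copy
              d₂ ← em (∃[ v ] Ext.Z X v × v ∉ vs z leg)
              case d₂ of λ
                { (inj₁ (v , zv , v∉)) → Ears.U-not-all X B⊆U (λ z∈ z∉ → do
                      (_ , f) ← Ext.all-few X S zv v∉ (z∈ , λ q → z∉ (B⊆U q))
                      pure (few-map ≤-refl (λ _ q → U⊆B q) f))
                    (proj₁ zv) (λ q → proj₂ zv (U⊆B q)) >>= absurd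
                -- The copy fills `Z`, so the rest of `G` is `B`, that is `U`, which no two vertices
                -- separate.
                ; (inj₂ all) →
                    let in-B : ∀ {v} → Outside z leg v → v ∈ B
                        in-B {v} (v∈ , v∉) = case v ∈? B of λ { (yes q) → q ; (no q) → ⊥-elim (all (v , (v∈ , q) , v∉)) }
                        B-out : ∀ {v} → v ∈ B → Outside z leg v
                        B-out q = B⊆V q , λ r → proj₂ (Spider.in-Z S r) q
                    in pure record
                      { z = z ; leg = leg ; spider = spider-map proj₁ S
                      ; linked = λ x y u∈ a b v∈ c d → do
                          w ← insep x y (B⊆U (in-B u∈)) a b (B⊆U (in-B v∈)) c d
                          pure (walk-map (λ (q , r) → B-out q , r) w)
                      ; big = λ a b c → let (u , u∈ , r) = spread a b c in u , B-out (U⊆B u∈) , r } } }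
      where open Extremal X

-- The initial pair

module Initial {n p : ℕ} (H : Host n p) where
  open Host H
  open Legs H
  open Linkage H
  open States H

  module Fragment (S : List (Fin n)) (uS : Unique S) (S⊆V : ∀ {v} → v ∈ S → v ∈ Vs)
    (degS : ∀ {v} → v ∈ Vs → ∀ L → cc (not (col v)) L ≤ 2 → ∃[ y ] Adj v y × y ∈ S × y ∉ L)
    (copyS : CopyOff S) where

    Closed : List (Fin n) → Fin n → Fin n → Set
    Closed D p q = ∀ {a b} → a ∈ D → Adj a b → b ∈ S → b ∈ D ⊎ b ≡ p ⊎ b ≡ q

    -- At most one neighbour, as both permitted ones are `r`; `S` itself has none. The smallest such
    -- `D` is an enclosure for the second choice: no nonempty proper subset of `D` has a single
    -- neighbour, which is what `impossible` needs besides the minimality of `D'`.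
    Frag₁ : List (Fin n) → Set
    Frag₁ D = Unique D × (∀ {v} → v ∈ D → v ∈ S) × (∃[ v ] v ∈ D) × (∃[ r ] Closed D r r)

    Frag₂ : List (Fin n) → List (Fin n) → Set
    Frag₂ D D' = Unique D' × (∀ {v} → v ∈ D' → v ∈ D) × (∃[ v ] v ∈ D') × (∃₂ λ p q → Closed D' p q)

    filter-< : ∀ {P : Fin n → Set} (P? : ∀ v → Dec (P v)) {L v} → Unique L → v ∈ L → ¬ P v → length (filter P? L) < length L
    filter-< P? {L} u v∈ ¬p = unique-⊆-length (unique-∷ (λ q → ¬p (proj₂ (filter-∈⁻ P? L q))) (unique-filter⁺ P? u))
      λ { (here refl) → v∈ ; (there q) → proj₁ (filter-∈⁻ P? L q) }

    module Minimal {D D'} (uD : Unique D) (D⊆S : ∀ {v} → v ∈ D → v ∈ S) {r} (cD : Closed D r r)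
      (minD : ∀ E → Frag₁ E → length D ≤ length E)
      (uD' : Unique D') (D'⊆D : ∀ {v} → v ∈ D' → v ∈ D)
      (minD' : ∀ E → Frag₂ D E → length D' ≤ length E) where

      Side : Fin n → Fin n → (Fin n → Set) → Set
      Side x y A = (∀ {a b} → A a → Adj a b → b ∈ S → A b ⊎ b ≡ x ⊎ b ≡ y) × (∀ {a} → A a → a ≢ x × a ≢ y)

      module _ {x y : Fin n} {A : Fin n → Set} (A? : ∀ v → Dec (A v)) (side : Side x y A)
        {u v} (u∈ : u ∈ D') (Au : A u) (v∈ : v ∈ D') (¬Av : ¬ A v) where

        not-closed : ∀ {p q} → Closed (filter A? D') p q → ⊥
        not-closed c = <⇒≱ (filter-< A? uD' v∈ ¬Av) (minD' _ (unique-filter⁺ A? uD' ,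
          (λ s → D'⊆D (proj₁ (filter-∈⁻ A? D' s))) , (u , filter-∈ A? u∈ Au) , (_ , _ , c)))

        meets : ∀ {p q} → Closed D' p q → ¬ A p → ¬ A q → ⊥
        meets c ¬p ¬q = not-closed λ {a} a∈ ad b∈ → let (a∈D' , Aa) = filter-∈⁻ A? D' a∈ in
          case proj₁ side Aa ad b∈ of λ
            { (inj₂ e) → inj₂ e
            ; (inj₁ Ab) → case c a∈D' ad b∈ of λ
              { (inj₁ b∈D') → inj₁ (filter-∈ A? b∈D' Ab)
              ; (inj₂ (inj₁ refl)) → ⊥-elim (¬p Ab)
              ; (inj₂ (inj₂ refl)) → ⊥-elim (¬q Ab) } }

        module _ {p q} (c : Closed D' p q) (Ap : A p) (¬Aq : ¬ A q) (q≢x : q ≢ x) (q≢y : q ≢ y) where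

          border : ∀ {a b} → a ∈ filter A? D' → Adj a b → b ∈ S →
            b ∈ filter A? D' ⊎ b ≡ p ⊎ (b ≡ x × x ∈ D') ⊎ (b ≡ y × y ∈ D')
          border {a} a∈ ad b∈ = let (a∈D' , Aa) = filter-∈⁻ A? D' a∈ in
            case (c a∈D' ad b∈ , proj₁ side Aa ad b∈) of λ
              { (inj₁ b∈D' , inj₁ Ab) → inj₁ (filter-∈ A? b∈D' Ab)
              ; (inj₁ b∈D' , inj₂ (inj₁ refl)) → inj₂ (inj₂ (inj₁ (refl , b∈D')))
              ; (inj₁ b∈D' , inj₂ (inj₂ refl)) → inj₂ (inj₂ (inj₂ (refl , b∈D')))
              ; (inj₂ (inj₁ e) , _) → inj₂ (inj₁ e)
              ; (inj₂ (inj₂ refl) , inj₁ Aq) → ⊥-elim (¬Aq Aq)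
              ; (inj₂ (inj₂ refl) , inj₂ (inj₁ e)) → ⊥-elim (q≢x e)
              ; (inj₂ (inj₂ refl) , inj₂ (inj₂ e)) → ⊥-elim (q≢y e) }

          -- Otherwise `p` and `y` alone would bound the part of `D'` in `A`, a smaller set with at
          -- most two neighbours.
          x∈D' : x ∈ D'
          x∈D' = case x ∈? D' of λ
            { (yes s) → s
            ; (no x∉) → ⊥-elim (not-closed {p} {y} λ a∈ ad b∈ → case border a∈ ad b∈ of λ
              { (inj₁ s) → inj₁ s ; (inj₂ (inj₁ e)) → inj₂ (inj₁ e)
              ; (inj₂ (inj₂ (inj₁ (_ , s)))) → ⊥-elim (x∉ s) ; (inj₂ (inj₂ (inj₂ (e , _)))) → inj₂ (inj₂ e) }) }

          y∈D' : y ∈ D'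
          y∈D' = case y ∈? D' of λ
            { (yes s) → s
            ; (no y∉) → ⊥-elim (not-closed {p} {x} λ a∈ ad b∈ → case border a∈ ad b∈ of λ
              { (inj₁ s) → inj₁ s ; (inj₂ (inj₁ e)) → inj₂ (inj₁ e)
              ; (inj₂ (inj₂ (inj₁ (e , _)))) → inj₂ (inj₂ e) ; (inj₂ (inj₂ (inj₂ (_ , s)))) → ⊥-elim (y∉ s) }) }

          x≢y : x ≢ y
          x≢y refl = not-closed {p} {x} λ a∈ ad b∈ → case border a∈ ad b∈ of λ
              { (inj₁ s) → inj₁ s ; (inj₂ (inj₁ e)) → inj₂ (inj₁ e)
              ; (inj₂ (inj₂ (inj₁ (e , _)))) → inj₂ (inj₂ e) ; (inj₂ (inj₂ (inj₂ (e , _)))) → inj₂ (inj₂ e) }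

          -- The side that misses the neighbour r of D would give a smaller fragment A ∩ D.
          impossible : ¬ A r → ⊥
          impossible ¬Ar = <⇒≱ F<D' (minD' F (unique-filter⁺ A? uD , (λ s → proj₁ (filter-∈⁻ A? D s)) ,
              (u , filter-∈ A? (D'⊆D u∈) Au) , (x , y , F-closed)))
            where
            F = filter A? D
            F-closed : Closed F x y
            F-closed a∈ ad b∈ = let (a∈D , Aa) = filter-∈⁻ A? D a∈ in case proj₁ side Aa ad b∈ of λ
              { (inj₂ e) → inj₂ e
              ; (inj₁ Ab) → case cD a∈D ad b∈ of λ
                { (inj₁ b∈D) → inj₁ (filter-∈ A? b∈D Ab)
                ; (inj₂ (inj₁ refl)) → ⊥-elim (¬Ar Ab) ; (inj₂ (inj₂ refl)) → ⊥-elim (¬Ar Ab) } }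
            Rest : Fin n → Set
            Rest v = A v × v ∉ D' × v ≢ p
            Rest? : ∀ v → Dec (Rest v)
            Rest? v = A? v ×-dec ¬? (v ∈? D') ×-dec ¬? (v ≟F p)
            off-D' : ∀ {a b} → Rest a → Adj a b → a ∈ S → b ∉ D'
            off-D' (Aa , a∉ , a≢) ad a∈ b∈ = case c b∈ (symA ad) a∈ of λ
              { (inj₁ s) → a∉ s ; (inj₂ (inj₁ e)) → a≢ e ; (inj₂ (inj₂ refl)) → ¬Aq Aa }
            -- The part of `A` in `D` beyond `D'` and `p`. It has no neighbour in `D'`, hence
            -- neither `x` nor `y`, and `r` is not in `A`; only `p` remains, so the minimality of
            -- `D` makes it empty.
            G = filter Rest? D
            G-closed : Closed G p p
            G-closed {b = b} a∈ ad b∈ = let (a∈D , ra@(Aa , _)) = filter-∈⁻ Rest? D a∈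
                                            b∉ = off-D' ra ad (D⊆S a∈D) in
              case proj₁ side Aa ad b∈ of λ
                { (inj₂ (inj₁ refl)) → ⊥-elim (b∉ x∈D')
                ; (inj₂ (inj₂ refl)) → ⊥-elim (b∉ y∈D')
                ; (inj₁ Ab) → case cD a∈D ad b∈ of λ
                  { (inj₂ (inj₁ refl)) → ⊥-elim (¬Ar Ab) ; (inj₂ (inj₂ refl)) → ⊥-elim (¬Ar Ab)
                  ; (inj₁ b∈D) → case b ≟F p of λ
                    { (yes e) → inj₂ (inj₁ e) ; (no ne) → inj₁ (filter-∈ Rest? b∈D (Ab , b∉ , ne)) } } }
            G-empty : ∀ {w} → w ∈ D → ¬ Rest w
            G-empty w∈ rw = <⇒≱ (filter-< Rest? uD (D'⊆D u∈) (λ (_ , s , _) → s u∈)) (minD G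
              (unique-filter⁺ Rest? uD , (λ s → D⊆S (proj₁ (filter-∈⁻ Rest? D s))) , (_ , filter-∈ Rest? w∈ rw) , (p , G-closed)))
            ≢p? : ∀ v → Dec (v ≢ p)
            ≢p? v = ¬? (v ≟F p)
            F' = filter ≢p? F
            F'⊆ : ∀ {w} → w ∈ F' → A w × w ∈ D'
            F'⊆ {w} s = let (w∈F , ne) = filter-∈⁻ ≢p? F s ; (w∈D , Aw) = filter-∈⁻ A? D w∈F in
              Aw , (case w ∈? D' of λ { (yes t) → t ; (no t) → ⊥-elim (G-empty w∈D (Aw , t , ne)) })
            -- `F` lies in `D'` except possibly for `p`, whereas `D'` also contains `x` and `y`,
            -- which are not in `A`.
            F<D' : length F < length D'
            F<D' = ≤-trans (s≤s (unique-⊆-length {ys = p ∷ F'} (unique-filter⁺ A? uD) λ {w} s → case w ≟F p of λ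
                { (yes e) → here e ; (no ne) → there (filter-∈ ≢p? s ne) }))
              (unique-⊆-length {xs = x ∷ y ∷ F'} (unique-∷ (λ { (here e) → x≢y e ; (there s) → proj₁ (proj₂ side (proj₁ (F'⊆ s))) refl })
                (unique-∷ (λ s → proj₂ (proj₂ side (proj₁ (F'⊆ s))) refl) (unique-filter⁺ ≢p? (unique-filter⁺ A? uD))))
                λ { (here refl) → x∈D' ; (there (here refl)) → y∈D' ; (there (there s)) → proj₂ (F'⊆ s) })

      -- If `x` and `y` separate `D'`, there are two sides `A` and `A'`. A side with neither `p` nor
      -- `q` would cut a smaller set out of `D'`, so each side contains exactly one of them. One of
      -- the sides misses `r`, and `impossible` applies to it.
      insep-D' : ∀ {p q} → Closed D' p q → Inseparable D' S
      insep-D' {p} {q} c x y {u} {v} u∈ ux uy v∈ vx vy = by-contra λ none → do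
          A? ← decide (Walk (Off S x y) u)
          let in-S : ∀ {w} → w ∈ D' → w ∈ S
              in-S s = D⊆S (D'⊆D s)
              A = Walk (Off S x y) u
              A' = λ w → w ∈ S × (w ≢ x × w ≢ y) × ¬ A w
              A'? : ∀ w → Dec (A' w)
              A'? w = (w ∈? S) ×-dec (¬? (w ≟F x) ×-dec ¬? (w ≟F y)) ×-dec ¬? (A? w)
              sideA : Side x y A
              sideA = (λ {_} {b} w ad b∈ → case ((b ≟F x) , (b ≟F y)) of λ
                  { (yes e , _) → inj₂ (inj₁ e) ; (no _ , yes e) → inj₂ (inj₂ e)
                  ; (no e , no e') → inj₁ (walk-snoc w ad (b∈ , e , e')) }) , λ w → proj₂ (walk-end w)
              sideA' : Side x y A'
              sideA' = (λ {_} {b} (a∈ , a≢ , ¬a) ad b∈ → case ((b ≟F x) , (b ≟F y)) of λ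
                  { (yes e , _) → inj₂ (inj₁ e) ; (no _ , yes e) → inj₂ (inj₂ e)
                  ; (no e , no e') → inj₁ (b∈ , (e , e') , λ w → ¬a (walk-snoc w (symA ad) (a∈ , a≢))) }) ,
                  λ (_ , h , _) → h
              Au : A u
              Au = stop (in-S u∈ , ux , uy)
              A'v : A' v
              A'v = in-S v∈ , (vx , vy) , none
              ¬A'u : ¬ A' u
              ¬A'u (_ , _ , h) = h Au
              swapped : Closed D' q p
              swapped = λ a∈ ad b∈ → case c a∈ ad b∈ of λ
                { (inj₁ s) → inj₁ s ; (inj₂ (inj₁ e)) → inj₂ (inj₂ e) ; (inj₂ (inj₂ e)) → inj₂ (inj₁ e) }
              finish : ∀ {p q} → Closed D' p q → Closed D' q p → A p → A' q → ⊥
              finish c c' Ap A'q = case A? r of λ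
                { (no ¬r) → impossible A? sideA u∈ Au v∈ none c Ap (proj₂ (proj₂ A'q))
                    (proj₁ (proj₁ (proj₂ A'q))) (proj₂ (proj₁ (proj₂ A'q))) ¬r
                ; (yes Ar) → impossible A'? sideA' v∈ A'v u∈ ¬A'u c' A'q (λ (_ , _ , h) → h Ap)
                    (proj₁ (proj₂ sideA Ap)) (proj₂ (proj₂ sideA Ap)) (λ (_ , _ , h) → h Ar) }
          pure (case ((A? p) , (A? q)) of λ
            { (no ¬p , no ¬q) → meets A? sideA u∈ Au v∈ none c ¬p ¬q
            ; (yes Ap , yes Aq) → meets A'? sideA' v∈ A'v u∈ ¬A'u c (λ (_ , _ , h) → h Ap) (λ (_ , _ , h) → h Aq)
            ; (yes Ap , no ¬q) → case A'? q of λ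
              { (yes A'q) → finish c swapped Ap A'q
              ; (no ¬A'q) → meets A'? sideA' v∈ A'v u∈ ¬A'u c (λ (_ , _ , h) → h Ap) ¬A'q }
            ; (no ¬p , yes Aq) → case A'? p of λ
              { (yes A'p) → finish swapped c Aq A'p
              ; (no ¬A'p) → meets A'? sideA' v∈ A'v u∈ ¬A'u c ¬A'p (λ (_ , _ , h) → h Aq) } })

      spread-D' : ∀ {p q} → Closed D' p q → ∃[ u ] u ∈ D' → Spread D'
      spread-D' {p} {q} c (u , u∈) a b d
          with degS (S⊆V (D⊆S (D'⊆D u∈))) (p ∷ q ∷ []) (cc≤length _ (p ∷ q ∷ []))
      ... | v , ad , v∈S , v∉ = pick (c u∈ ad v∈S)
        where
        -- Of five entries at most two have one of the two colours. The adjacent vertices `u` and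
        -- `v` of `D'` have both colours, so one of them has a neighbour in `S` off this list, and
        -- this neighbour lies in `D'`.
        L = a ∷ b ∷ d ∷ p ∷ q ∷ []
        next : ∀ {w} → w ∈ D' → cc (not (col w)) L ≤ 2 → ∃[ u ] u ∈ D' × u ≢ a × u ≢ b × u ≢ d
        next {w} w∈ h with degS (S⊆V (D⊆S (D'⊆D w∈))) L h
        ... | y , ad , y∈ , y∉ with c w∈ ad y∈
        ...   | inj₁ s = y , s , (λ { refl → y∉ (here refl) }) , (λ { refl → y∉ (there (here refl)) }) ,
                         λ { refl → y∉ (there (there (here refl))) }
        ...   | inj₂ (inj₁ refl) = ⊥-elim (y∉ (there (there (there (here refl)))))
        ...   | inj₂ (inj₂ refl) = ⊥-elim (y∉ (there (there (there (there (here refl))))))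
        pick : v ∈ D' ⊎ v ≡ p ⊎ v ≡ q → ∃[ u ] u ∈ D' × u ≢ a × u ≢ b × u ≢ d
        pick (inj₂ (inj₁ refl)) = ⊥-elim (v∉ (here refl))
        pick (inj₂ (inj₂ refl)) = ⊥-elim (v∉ (there (here refl)))
        pick (inj₁ v∈) = case cc (not (col u)) L ≤? 2 of λ
          { (yes h) → next u∈ h
          ; (no h) → next v∈ (+-cancelˡ-≤ (cc (not (col u)) L) _ _ (≤-trans (≤-reflexive
              (trans (cong (λ c → cc (not (col u)) L + cc (not c) L) (colA ad)) (cc-both (not (col u)) L)))
              (+-monoˡ-≤ 2 (≰⇒> h)))) }

    state : (∃[ v ] v ∈ S) → NN State
    state (v , v∈) = do
      (D , (uD , D⊆S , (w , w∈) , (r , cD)) , minD) ← minimal Frag₁ length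
        (S , uS , (λ q → q) , (v , v∈) , (v , λ _ _ b∈ → inj₁ b∈))
      (D' , (uD' , D'⊆D , ne , (p , q , cD')) , minD') ← minimal (Frag₂ D) length
        (D , uD , (λ q → q) , (w , w∈) , (r , r , λ {a} {b} → cD {a} {b}))
      let module M = Minimal uD D⊆S (λ {a} {b} → cD {a} {b}) minD uD' D'⊆D minD'
      pure record { U = D' ; B = S ; uniq = uD' ; U⊆B = λ s → D⊆S (D'⊆D s) ; B⊆V = S⊆V
                  ; insep = M.insep-D' (λ {a} {b} → cD' {a} {b}) ; spread = M.spread-D' (λ {a} {b} → cD' {a} {b}) ne ; copy = copyS }

  initial : ∀ {v} → v ∈ Vs → NN State
  initial {v} v∈ = do
      (leg , S) ← greedy {Z = _∈ Vs} {K = λ _ → t} (λ q → few-free {P = λ _ → ⊥} q (λ r _ → r)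
        (few-map z≤n (λ _ x → x) (few-none λ _ ()))) (λ _ → ≤-refl) v∈
      let In : Fin n → Set
          In w = w ∈ Vs × w ∉ vs v leg
          In? : ∀ w → Dec (In w)
          In? w = (w ∈? Vs) ×-dec ¬? (w ∈? vs v leg)
          R = filter In? (allFin n)
          split : ∀ {w} → w ∈ R → In w
          split q = proj₂ (filter-∈⁻ In? (allFin n) q)
          degR : ∀ {w} → w ∈ Vs → ∀ L → cc (not (col w)) L ≤ 2 → ∃[ y ] Adj w y × y ∈ R × y ∉ L
          degR w∈ L h = let (y , a , y∉) = deg w∈ (L ++ vs v leg) (≤-trans (≤-reflexive (cc-++ _ L (vs v leg)))
                              (+-mono-≤ h (cc-spider S _)))
                        in y , a , filter-∈ In? (∈-allFin y) (adjV′ a , λ q → y∉ (∈-++⁺ʳ L q)) , λ q → y∉ (∈-++⁺ˡ q)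
      Fragment.state R (unique-filter⁺ In? (allFin⁺ n)) (λ q → proj₁ (split q)) degR
        (v , leg , record { Spider S ; centre = v∈ , (λ q → proj₂ (split q) (here refl))
                          ; all = λ j q → Spider.all S j q , λ r → proj₂ (split r) (∈-vs {leg = leg} j q) })
        (let (y , _ , y∈ , _) = degR v∈ [] z≤n in y , y∈)

  exists-good-copy : ∀ {v} → v ∈ Vs → NN (Final.GoodCopy H)
  exists-good-copy v∈ = initial v∈ >>= Final.good-copy H

open import Defs

-- Cardinalities, degrees and cycles

─-∉ : ∀ {n} (p q : Subset n) {x} → x ∈ˢ p ─ q → x ∉ˢ q
─-∉ (true Vec.∷ p) (true Vec.∷ q) (Vec.there h) (Vec.there k) = ─-∉ p q h k
─-∉ (true Vec.∷ p) (false Vec.∷ q) (Vec.there h) (Vec.there k) = ─-∉ p q h k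
─-∉ (false Vec.∷ p) (true Vec.∷ q) (Vec.there h) (Vec.there k) = ─-∉ p q h k
─-∉ (false Vec.∷ p) (false Vec.∷ q) (Vec.there h) (Vec.there k) = ─-∉ p q h k

unique-≤∣∣ : ∀ {n} {L : List (Fin n)} {S : Subset n} → Unique L → (∀ {x} → x ∈ L → x ∈ˢ S) → length L ≤ ∣ S ∣
unique-≤∣∣ {L = []} u h = z≤n
unique-≤∣∣ {L = x ∷ L} {S} u h = ≤-trans (s≤s (unique-≤∣∣ {S = S -ˢ x} (unique-tail u)
  λ q → x∈p∧x≢y⇒x∈p-y (h (there q)) λ { refl → unique-∉ u q })) (x∈p⇒∣p-x∣<∣p∣ (h (here refl)))

cc-≤∣∣ : ∀ {n} (col : Fin n → Bool) b {L : List (Fin n)} {S : Subset n} → Unique L →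
  (∀ {x} → x ∈ L → col x ≡ b → x ∈ˢ S) → Colour.cc col b L ≤ ∣ S ∣
cc-≤∣∣ col b {[]} u h = z≤n
cc-≤∣∣ col b {x ∷ L} {S} u h with col x ≟B b
... | yes e = ≤-trans (≤-reflexive (cong (_+ Colour.cc col b L) (trans (cong (λ c → δ c b) e) (δ-refl b))))
      (≤-trans (s≤s (cc-≤∣∣ col b {S = S -ˢ x} (unique-tail u) λ q e' →
        x∈p∧x≢y⇒x∈p-y (h (there q) e') λ { refl → unique-∉ u q })) (x∈p⇒∣p-x∣<∣p∣ (h (here refl) e)))
... | no ne = ≤-trans (≤-reflexive (cong (_+ Colour.cc col b L) (δ-≢ ne))) (cc-≤∣∣ col b (unique-tail u) (h ∘ there))
  where
  δ-≢ : ∀ {a b} → a ≢ b → δ a b ≡ 0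
  δ-≢ {true} {true} ne = ⊥-elim (ne refl)
  δ-≢ {true} {false} _ = refl
  δ-≢ {false} {true} _ = refl
  δ-≢ {false} {false} ne = ⊥-elim (ne refl)

module _ {n : ℕ} (G : Graph n) where

  nbrs : Fin n → List (Fin n)
  nbrs v = filter (adj? G v) (allFin n)

  ∈-nbrs : ∀ {v w} → Adj G v w → w ∈ nbrs v
  ∈-nbrs {v} {w} a = filter-∈ (adj? G v) (∈-allFin w) a

  nbrs-adj : ∀ {v w} → w ∈ nbrs v → Adj G v w
  nbrs-adj {v} q = proj₂ (filter-∈⁻ (adj? G v) (allFin n) q)

  nbrs-unique : ∀ v → Unique (nbrs v)
  nbrs-unique v = unique-filter⁺ (adj? G v) (allFin⁺ n)

  degree-nbrs : ∀ v → degree G v ≡ length (nbrs v)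
  degree-nbrs v = go n (λ i → i)
    where
    go : ∀ k (f : Fin k → Fin n) → Vec.count (adj? G v) (Vec.tabulate f) ≡ length (filter (adj? G v) (tabulate f))
    go zero f = refl
    go (suc k) f with adj? G v (f zero)
    ... | yes _ = cong suc (go k (f ∘ suc))
    ... | no _ = go k (f ∘ suc)

  degree-≥ : ∀ {v L} → Unique L → (∀ {w} → w ∈ L → Adj G v w) → length L ≤ degree G v
  degree-≥ {v} u h = ≤-trans (unique-⊆-length u (λ q → ∈-nbrs (h q))) (≤-reflexive (sym (degree-nbrs v)))

  adj-≢ : ∀ {v w} → Adj G v w → v ≢ w
  adj-≢ a e = loopless G e a

  module _ {R : Fin n → Fin n → Set} (R⊆ : ∀ {x y} → R x y → Adj G x y) where
    open Paths R

    lookup-step : ∀ {x a L y} → Pth x (a ∷ L) y → ∀ i → R (lookup (a ∷ L) (inject₁ i)) (lookup L i)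
    lookup-step {L = b ∷ L} (r ∷ h) zero with pth-start h
    ... | refl = r
    lookup-step {L = b ∷ L} (r ∷ h) (suc i) = lookup-step h i

    lookup-last : ∀ {x a L y} → Pth x (a ∷ L) y → lookup (a ∷ L) (fromℕ (length L)) ≡ y
    lookup-last [-] = refl
    lookup-last {L = b ∷ L} (r ∷ h) = lookup-last h

    lookup-∈ : ∀ (L : List (Fin n)) i → lookup L i ∈ L
    lookup-∈ (x ∷ L) zero = here refl
    lookup-∈ (x ∷ L) (suc i) = there (lookup-∈ L i)

    lookup-inj : ∀ {L : List (Fin n)} → Unique L → ∀ i j → lookup L i ≡ lookup L j → i ≡ j
    lookup-inj {x ∷ L} u zero zero e = refl
    lookup-inj {x ∷ L} u zero (suc j) e = ⊥-elim (unique-∉ u (subst (_∈ L) (sym e) (lookup-∈ L j)))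
    lookup-inj {x ∷ L} u (suc i) zero e = ⊥-elim (unique-∉ u (subst (_∈ L) e (lookup-∈ L i)))
    lookup-inj {x ∷ L} u (suc i) (suc j) e = cong suc (lookup-inj (unique-tail u) i j e)

    cycle : ∀ {x a b d L y} → Pth x (a ∷ b ∷ d ∷ L) y → Unique (a ∷ b ∷ d ∷ L) → Adj G y x → Cycle G
    cycle {a = a} {b} {d} {L} h u e = record
      { k = length L
      ; vertex = lookup (a ∷ b ∷ d ∷ L)
      ; injective = λ {i} {j} → lookup-inj u i j
      ; step = λ i → R⊆ (lookup-step h i)
      ; close = subst (λ v → Adj G v a) (sym (lookup-last h)) (subst (Adj G _) (sym (pth-start h)) e) }

  -- A walk that never steps from `u` to `v` shortens to a path with at least three vertices, which
  -- the edge closes to a cycle.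
  no-detour : ¬ Cycle G → ∀ {u v} → Adj G u v → ¬ Paths.Walk (λ x y → Adj G x y × ¬ (x ≡ u × y ≡ v)) (λ _ → ⊤) u v
  no-detour acyc {u} {v} a w with Paths.walk-pth _ w
  ... | _ , Paths.[-] , _ , _ = adj-≢ a refl
  ... | _ , ((_ , ne) Paths.∷ Paths.[-]) , _ , _ = ne (refl , refl)
  ... | _ ∷ _ ∷ d ∷ L , h@(_ Paths.∷ (_ Paths.∷ _)) , _ , uL = acyc (cycle proj₁ h uL (symm G a))
  ... | _ ∷ _ ∷ [] , (_ Paths.∷ (_ Paths.∷ ())) , _ , _

-- Decomposing a spider into a centre and legs

module Decompose {m : ℕ} (T : Graph m) (isSpider : IsSpider T) where

  open Paths (Adj T)

  record Skeleton (c : Fin m) {q} (leg : Fin q → List (Fin m)) : Set where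
    field
      linked   : ∀ j → Linked c (leg j)
      nonempty : ∀ j → 0 < length (leg j)
      inV      : ∀ j {x} → x ∈ leg j → x ∈ˢ V T
      uniq     : ∀ j → Unique (leg j)
      cent∉    : ∀ j → c ∉ leg j
      disj     : ∀ {i j x} → x ∈ leg i → x ∈ leg j → i ≡ j

    all-unique : Unique (c ∷ concatF q leg)
    all-unique = unique-∷ (λ h → let (j , r) = ∈-concatF⁻ q h in cent∉ j r) (unique-concatF q uniq disj)

  Legs : Set
  Legs = ∃[ q ] (Fin q → List (Fin m))

  size : Legs → ℕ
  size (q , leg) = sumF q (length ∘ leg)

  length-concatF : ∀ q (f : Fin q → List (Fin m)) → length (concatF q f) ≡ sumF q (length ∘ f)
  length-concatF zero f = refl
  length-concatF (suc q) f = trans (length-++ (f zero)) (cong (length (f zero) +_) (length-concatF q (f ∘ suc)))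

  size-bound : ∀ {c} (L : Legs) → Skeleton c (proj₂ L) → size L ≤ length (allFin m)
  size-bound (q , leg) s = ≤-trans (≤-reflexive (sym (length-concatF q leg)))
    (unique-⊆-length (unique-tail (Skeleton.all-unique s)) λ _ → ∈-allFin _)

  Consec : ∀ {q} → Fin m → (Fin q → List (Fin m)) → Fin m → Fin m → Set
  Consec c leg x y = ∃[ j ] ∃₂ λ A E → c ∷ leg j ≡ A ++ x ∷ y ∷ E

  record Decomposition : Set where
    field
      {c}      : Fin m
      {q}      : ℕ
      {leg}    : Fin q → List (Fin m)
      skeleton : Skeleton c leg
      c∈V      : c ∈ˢ V T
      cover    : ∀ {v} → v ∈ˢ V T → v ∈ c ∷ concatF q leg
      consec   : ∀ {a b} → Adj T a b → NN (Consec c leg a b ⊎ Consec c leg b a)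

  module Maximal {c : Fin m} (c∈ : c ∈ˢ V T) (low : ∀ {v} → v ∈ˢ V T → v ≢ c → ¬ 2 < degree T v)
    {q} {leg : Fin q → List (Fin m)} (sk : Skeleton c leg)
    (mx : ∀ L → Skeleton c (proj₂ L) → size L ≤ size (q , leg)) where
    open Skeleton sk

    Verts : List (Fin m)
    Verts = c ∷ concatF q leg

    ∈-leg : ∀ {x} j → x ∈ leg j → x ∈ Verts
    ∈-leg j h = there (∈-concatF j h)

    new-leg : ∀ {x} → Adj T c x → x ∉ Verts → ⊥
    new-leg {x} a x∉ = <⇒≱ ≤-refl (mx (suc q , λ { zero → x ∷ [] ; (suc j) → leg j }) record
      { linked = λ { zero → a ∷ [] ; (suc j) → linked j }
      ; nonempty = λ { zero → s≤s z≤n ; (suc j) → nonempty j }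
      ; inV = λ { zero (here refl) → adj⇒∈V T (symm T a) ; (suc j) h → inV j h }
      ; uniq = λ { zero → [] ∷ [] ; (suc j) → uniq j }
      ; cent∉ = λ { zero (here refl) → x∉ (here refl) ; (suc j) → cent∉ j }
      ; disj = λ { {zero} {zero} _ _ → refl
                 ; {zero} {suc j} (here refl) h → ⊥-elim (x∉ (∈-leg j h))
                 ; {suc i} {zero} h (here refl) → ⊥-elim (x∉ (∈-leg i h))
                 ; {suc i} {suc j} h k → cong suc (disj h k) } })

    longer-leg : ∀ {x y} j A → leg j ≡ A ++ y ∷ [] → Adj T y x → x ∉ Verts → ⊥
    longer-leg {x} {y} j A eq a x∉ = <⇒≱ (sumF-mono-< q
        (upd-elim (λ i L → length (leg i) ≤ length L) (<⇒≤ longer) (λ _ _ → ≤-refl)) j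
        (subst (λ L → length (leg j) < length L) (sym (upd-same leg j X)) longer))
      (mx (q , upd leg j X) record
        { linked = upd-elim (λ _ → Linked c) (linked-++ end (linked j) (a ∷ [])) (λ i _ → linked i)
        ; nonempty = upd-elim (λ _ L → 0 < length L) (≤-trans (s≤s z≤n) longer) (λ i _ → nonempty i)
        ; inV = upd-elim (λ _ L → ∀ {x} → x ∈ L → x ∈ˢ V T) (λ h → case ∈-++⁻ (leg j) h of λ
            { (inj₁ r) → inV j r ; (inj₂ (here refl)) → adj⇒∈V T (symm T a) }) (λ i _ → inV i)
        ; uniq = upd-elim (λ _ → Unique) (unique-++ (uniq j) ([] ∷ []) λ { r (here refl) → x∉ (∈-leg j r) }) (λ i _ → uniq i)
        ; cent∉ = upd-elim (λ _ → c ∉_) (λ h → case ∈-++⁻ (leg j) h of λ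
            { (inj₁ r) → cent∉ j r ; (inj₂ (here refl)) → x∉ (here refl) }) (λ i _ → cent∉ i)
        ; disj = λ {i} {k} h r → case (split i h , split k r) of λ
            { (inj₁ s , inj₁ s') → disj s s'
            ; (inj₂ (e , _) , inj₂ (e' , _)) → trans e (sym e')
            ; (inj₁ s , inj₂ (_ , refl)) → ⊥-elim (x∉ (∈-leg i s))
            ; (inj₂ (_ , refl) , inj₁ s) → ⊥-elim (x∉ (∈-leg k s)) } })
      where
      X = leg j ++ x ∷ []
      end : Ends c (leg j) y
      end = subst (λ L → Ends c L y) (sym eq) (ends-++∷ c A y)
      longer : length (leg j) < length X
      longer = ≤-reflexive (sym (trans (length-++ (leg j)) (+-comm _ 1)))
      split : ∀ i {v} → v ∈ upd leg j X i → v ∈ leg i ⊎ (i ≡ j × v ≡ x)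
      split = upd-elim (λ i L → ∀ {v} → v ∈ L → v ∈ leg i ⊎ (i ≡ j × v ≡ x))
        (λ h → case ∈-++⁻ (leg j) h of λ { (inj₁ r) → inj₁ r ; (inj₂ (here e)) → inj₂ (refl , e) }) (λ i _ → inj₁)

    -- Inner vertices of legs have degree at most two, and no leg can be prolonged or added.
    closed : ∀ {a b} → a ∈ Verts → Adj T a b → b ∈ Verts
    closed {a} {b} a∈ ad with b ∈? Verts
    ... | yes h = h
    closed (here refl) ad | no b∉ = ⊥-elim (new-leg ad b∉)
    closed {a} {b} (there h) ad | no b∉ with ∈-concatF⁻ q h
    ... | j , r with ∈-∃++ r
    ...   | A , [] , eq = ⊥-elim (longer-leg j A eq ad b∉)
    ...   | A , w ∷ E , eq with ends c A
    ...     | u , e with linked-++⁻ʳ e (subst (Linked c) eq (linked j))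
    ...       | ua ∷ (aw ∷ _) = ⊥-elim (low (inV j r) (λ { refl → cent∉ j r }) (degree-≥ T {L = u ∷ w ∷ b ∷ []}
                  (unique-∷ (λ { (here p) → u≢w p ; (there (here refl)) → b∉ u∈ })
                    (unique-∷ (λ { (here refl) → b∉ (∈-leg j w∈) }) ([] ∷ [])))
                  λ { (here refl) → symm T ua ; (there (here refl)) → aw ; (there (there (here refl))) → ad }))
      where
      w∈ : w ∈ leg j
      w∈ = subst (w ∈_) (sym eq) (∈-++⁺ʳ A (there (here refl)))
      u-cases : u ≡ c ⊎ u ∈ A
      u-cases = ends-∈ e
      u∈ : u ∈ Verts
      u∈ = case u-cases of λ { (inj₁ p) → here p ; (inj₂ s) → ∈-leg j (subst (u ∈_) (sym eq) (∈-++⁺ˡ s)) }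
      u≢w : u ≢ w
      u≢w refl = case u-cases of λ
        { (inj₁ refl) → cent∉ j w∈
        ; (inj₂ s) → unique-disj A (subst Unique eq (uniq j)) s (there (here refl)) }

    reach : ∀ {a v} → a ∈ Verts → Star (Adj T) a v → v ∈ Verts
    reach a∈ ε = a∈
    reach a∈ (e ◅ es) = reach (closed a∈ e) es

    module _ {u v : Fin m} (u-v : ¬ Consec c leg u v) (v-u : ¬ Consec c leg v u) where

      Without : Fin m → Fin m → Set
      Without x y = Adj T x y × ¬ (x ≡ u × y ≡ v)

      module W = Paths Without

      along : ∀ {j} pre A {y x E} → c ∷ leg j ≡ pre ++ y ∷ A ++ x ∷ E → Linked y (A ++ x ∷ E) →
        W.Walk (λ _ → ⊤) y x × W.Walk (λ _ → ⊤) x y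
      along {j} pre [] {E = E} eq (a ∷ _) =
        W.step tt (a , (λ { (refl , refl) → u-v (j , pre , E , eq) })) (W.stop tt) ,
        W.step tt (symm T a , (λ { (refl , refl) → v-u (j , pre , E , eq) })) (W.stop tt)
      along {j} pre (d ∷ A) {y} {x} {E} eq (a ∷ l) with along (pre ++ y ∷ []) A
          (trans eq (sym (++-assoc pre (y ∷ []) (d ∷ A ++ x ∷ E)))) l
      ... | w , w' = W.step tt (a , (λ { (refl , refl) → u-v (j , pre , _ , eq) })) w ,
        (w' W.+++ W.step tt (symm T a , (λ { (refl , refl) → v-u (j , pre , _ , eq) })) (W.stop tt))

      to-centre : ∀ {x} → x ∈ Verts → W.Walk (λ _ → ⊤) c x × W.Walk (λ _ → ⊤) x c
      to-centre (here refl) = W.stop tt , W.stop tt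
      to-centre (there h) with ∈-concatF⁻ q h
      ... | j , r with ∈-∃++ r
      ...   | A , E , eq = along {j} [] A (cong (c ∷_) eq) (subst (Linked c) eq (linked j))

    -- Every vertex is joined to `c` along its leg, so an edge off the legs could be bypassed
    -- through `c`, which the tree does not allow.
    only-consec : ∀ {a b} → Adj T a b → NN (Consec c leg a b ⊎ Consec c leg b a)
    only-consec {a} {b} ad = by-contra λ none → pure (no-detour T (proj₂ (proj₁ isSpider)) ad
      (let u-v = none ∘ inj₁ ; v-u = none ∘ inj₂ in
       Paths._+++_ _ (proj₂ (to-centre u-v v-u (all-V (adj⇒∈V T ad)))) (proj₁ (to-centre u-v v-u (all-V (adj⇒∈V T (symm T ad)))))))
      where
      all-V : ∀ {v} → v ∈ˢ V T → v ∈ Verts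
      all-V v∈ = reach (here refl) (proj₂ (proj₁ (proj₁ isSpider)) c∈ v∈)

    decomposition : Decomposition
    decomposition = record { skeleton = sk ; c∈V = c∈ ; consec = only-consec
      ; cover = λ v∈ → reach (here refl) (proj₂ (proj₁ (proj₁ isSpider)) c∈ v∈) }

  decompose : NN Decomposition
  decompose = do
      (c , c∈ , low) ← centre
      ((q , leg) , sk , mx) ← maximal (λ L → Skeleton c (proj₂ L)) size (length (allFin m)) size-bound
        ((0 , λ ()) , record { linked = λ () ; nonempty = λ () ; inV = λ () ; uniq = λ () ; cent∉ = λ () ; disj = λ { {()} } })
      pure (Maximal.decomposition c∈ (λ {v} → low v) sk mx)
    where
    centre : NN (∃[ c ] c ∈ˢ V T × (∀ v → v ∈ˢ V T → v ≢ c → ¬ 2 < degree T v))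
    centre = do
      d ← em (∃[ c ] c ∈ˢ V T × 2 < degree T c)
      case d of λ
        { (inj₁ (c , c∈ , h)) → pure (c , c∈ , λ v v∈ ne h' → ne (proj₂ isSpider v∈ c∈ h' h))
        ; (inj₂ none) → let (c , c∈) = proj₁ (proj₁ (proj₁ isSpider)) in
            pure (c , c∈ , λ v v∈ _ h → none (v , v∈ , h)) }

-- Finite search and decidable 3-connectivity

∈ˢ-irrelevant : ∀ {n} {x : Fin n} {S : Subset n} (p q : x ∈ˢ S) → p ≡ q
∈ˢ-irrelevant Vec.here Vec.here = refl
∈ˢ-irrelevant (Vec.there p) (Vec.there q) = cong Vec.there (∈ˢ-irrelevant p q)

module _ {n : ℕ} (S : Subset n) where

  ∣∣-filter : ∣ S ∣ ≡ length (filter (_∈ˢ? S) (allFin n))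
  ∣∣-filter = go n (λ i → i) S λ _ → refl
    where
    go : ∀ k (f : Fin k → Fin n) (p : Subset k) → (∀ i → Vec.lookup p i ≡ Vec.lookup S (f i)) →
      ∣ p ∣ ≡ length (filter (_∈ˢ? S) (tabulate f))
    go zero f Vec.[] h = refl
    go (suc k) f (s Vec.∷ p) h with f zero ∈ˢ? S
    ... | yes q = step s (trans (h zero) (Vec.[]=⇒lookup q))
      where
      step : ∀ s → s ≡ true → ∣ s Vec.∷ p ∣ ≡ suc (length (filter (_∈ˢ? S) (tabulate (f ∘ suc))))
      step true _ = cong suc (go k (f ∘ suc) p (h ∘ suc))
    ... | no q = step s (h zero)
      where
      step : ∀ s → s ≡ Vec.lookup S (f zero) → ∣ s Vec.∷ p ∣ ≡ length (filter (_∈ˢ? S) (tabulate (f ∘ suc)))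
      step true e = ⊥-elim (q (Vec.lookup⇒[]= (f zero) S (sym e)))
      step false _ = go k (f ∘ suc) p (h ∘ suc)

  ∣∣-≤ : ∀ {L : List (Fin n)} → (∀ {x} → x ∈ˢ S → x ∈ L) → ∣ S ∣ ≤ length L
  ∣∣-≤ h = ≤-trans (≤-reflexive ∣∣-filter) (unique-⊆-length (unique-filter⁺ (_∈ˢ? S) (allFin⁺ n))
    λ q → h (proj₂ (filter-∈⁻ (_∈ˢ? S) (allFin n) q)))

  cover-by-two : ∣ S ∣ ≤ 2 → ∀ d → ∃₂ λ x y → (∀ {w} → w ∈ˢ S → w ≡ x ⊎ w ≡ y) ×
    (x ∈ˢ S ⊎ x ≡ d) × (y ∈ˢ S ⊎ y ≡ d)
  cover-by-two h d with filter (_∈ˢ? S) (allFin n) | ∣∣-filter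
                      | (λ {w} (q : w ∈ˢ S) → filter-∈ (_∈ˢ? S) (∈-allFin w) q)
                      | (λ {w} q → proj₂ (filter-∈⁻ (_∈ˢ? S) {x = w} (allFin n) q))
  ... | [] | _ | to | _ = d , d , (λ q → case to q of λ ()) , inj₂ refl , inj₂ refl
  ... | x ∷ [] | _ | to | from = x , x , (λ q → case to q of λ { (here e) → inj₁ e }) ,
          inj₁ (from (here refl)) , inj₁ (from (here refl))
  ... | x ∷ y ∷ [] | _ | to | from = x , y , (λ q → case to q of λ { (here e) → inj₁ e ; (there (here e)) → inj₂ e }) ,
          inj₁ (from (here refl)) , inj₁ (from (there (here refl)))
  ... | x ∷ y ∷ z ∷ _ | e | _ | _ = ⊥-elim (<⇒≱ (s≤s (s≤s (s≤s z≤n))) (≤-trans (≤-reflexive (sym e)) h))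

anyVec? : ∀ {n} k {P : Vec.Vec (Fin n) k → Set} → (∀ v → Dec (P v)) → Dec (∃ P)
anyVec? zero P? = map′ (λ h → Vec.[] , h) (λ { (Vec.[] , h) → h }) (P? Vec.[])
anyVec? (suc k) P? = map′ (λ (x , v , h) → x Vec.∷ v , h) (λ { (x Vec.∷ v , h) → x , v , h })
  (any? λ x → anyVec? k λ v → P? (x Vec.∷ v))

least : ∀ {P : ℕ → Set} → (∀ k → Dec (P k)) → ∃ P → ∃ (IsMinimum P)
least {P} P? (k , pk) = go k 0 (subst P (sym (+-identityʳ k)) pk) λ _ ()
  where
  go : ∀ d i → P (d + i) → (∀ j → j < i → ¬ P j) → ∃ (IsMinimum P)
  go d i h lt with P? i
  ... | yes pi = i , pi , λ k pk → ≮⇒≥ λ k<i → lt k k<i pk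
  go zero i h lt | no ¬pi = ⊥-elim (¬pi h)
  go (suc d) i h lt | no ¬pi = go d (suc i) (subst P (sym (+-suc d i)) h) λ j j<si pj →
    case m≤n⇒m<n∨m≡n (≤-pred j<si) of λ { (inj₁ j<i) → lt j j<i pj ; (inj₂ refl) → ¬pi pj }

module _ {n : ℕ} (K : Graph n) where

  Separates : Fin n → Fin n → Subset n → Set
  Separates u v R = u ∈ˢ R × v ∉ˢ R × (∀ a b → Adj K a b → a ∈ˢ R → b ∈ˢ R)

  separates? : ∀ u v R → Dec (Separates u v R)
  separates? u v R = (u ∈ˢ? R) ×-dec ¬? (v ∈ˢ? R) ×-dec
    all? λ a → all? λ b → adj? K a b →-dec ((a ∈ˢ? R) →-dec (b ∈ˢ? R))

  stays : ∀ {u v R} → (∀ a b → Adj K a b → a ∈ˢ R → b ∈ˢ R) → Star (Adj K) u v → u ∈ˢ R → v ∈ˢ R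
  stays c ε h = h
  stays c (e ◅ es) h = stays c es (c _ _ e h)

  -- Connection by a path is undecided here, but its negation is: it is witnessed by a closed set of vertices.
  unlinked? : ∀ u v → Dec (¬ Star (Adj K) u v)
  unlinked? u v with anySubset? (separates? u v)
  ... | yes (R , u∈ , v∉ , c) = yes λ s → v∉ (stays c s u∈)
  ... | no none = no λ ¬s → run (do
      star? ← decide (Star (Adj K) u)
      let R = Vec.tabulate (λ w → does (star? w))
          to : ∀ {w} → Star (Adj K) u w → w ∈ˢ R
          to {w} s = Vec.lookup⇒[]= w R (trans (Vec.lookup∘tabulate _ w) (dec-true (star? w) s))
          from : ∀ {w} → w ∈ˢ R → NN (Star (Adj K) u w)
          from {w} h ¬s = case trans (sym (trans (Vec.lookup∘tabulate _ w) (dec-false (star? w) ¬s))) (Vec.[]=⇒lookup h) of λ ()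
      pure (none (R , to ε , (λ h → from h ¬s) , λ a b e h → case star? b of λ
        { (yes s) → to s ; (no ¬b) → ⊥-elim (from h λ s → ¬b (s ◅◅ (e ◅ ε))) })))

  disconnected? : Dec (Disconnected K)
  disconnected? = any? λ u → any? λ v → (u ∈ˢ? V K) ×-dec (v ∈ˢ? V K) ×-dec unlinked? u v

module _ {n : ℕ} (K : Graph n) where

  Cut : Subset n → Set
  Cut S = Disconnected (K ∖ S) ⊎ ∣ V (K ∖ S) ∣ ≡ 1

  cut? : ∀ S → Dec (Cut S)
  cut? S = disconnected? (K ∖ S) ⊎-dec (∣ V (K ∖ S) ∣ ≟ 1)

  SmallCut : Subset n → Set
  SmallCut S = ∣ S ∣ ≤ 2 × S ⊆ˢ V K × Cut S

  -- 3-connectivity in a decidable form, as the finite search requires: only separators with at most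
  -- two elements are inspected.
  Robust : Set
  Robust = Nonempty (V K) × ¬ ∃ SmallCut

  robust? : Dec Robust
  robust? = nonempty? (V K) ×-dec ¬? (anySubset? λ S → (∣ S ∣ ≤? 2) ×-dec (S ⊆? V K) ×-dec cut? S)

  robust⇒3-connected : Robust → KConnected 3 K
  robust⇒3-connected ((v , v∈) , no-cut) =
    let (c , (S , S⊆ , eq , cut) , mn) = least (λ k → anySubset? λ S → (S ⊆? V K) ×-dec (∣ S ∣ ≟ k) ×-dec cut? S) start
    in c , ((S , S⊆ , eq , cut) , mn) , ≮⇒≥ λ c<3 → no-cut (S , ≤-trans (≤-reflexive eq) (≤-pred c<3) , S⊆ , cut)
    where
    R = V K -ˢ v
    -- The minimum that defines the connectivity must be attained; deleting all vertices but `v`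
    -- shows that some separator exists.
    start : ∃[ k ] ∃[ S ] S ⊆ˢ V K × ∣ S ∣ ≡ k × Cut S
    start = ∣ R ∣ , R , p─q⊆p (V K) ⁅ v ⁆ , refl , inj₂ (trans (cong ∣_∣ (⊆-antisym sub sup)) (∣⁅x⁆∣≡1 v))
      where
      sub : V K ─ R ⊆ˢ ⁅ v ⁆
      sub {x} h = case x ≟F v of λ
        { (yes refl) → x∈⁅x⁆ v
        ; (no ne) → ⊥-elim (─-∉ (V K) R h (x∈p∧x≢y⇒x∈p-y (p─q⊆p (V K) R h) ne)) }
      sup : ⁅ v ⁆ ⊆ˢ V K ─ R
      sup h with x∈⁅y⁆⇒x≡y v h
      ... | refl = ∈-─ v∈ λ r → ─-∉ (V K) ⁅ v ⁆ r (x∈⁅x⁆ v)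

-- Colourings from bipartitions, and images of spiders

module Bipartitioned {n : ℕ} {G : Graph n} {X Y : Subset n} (bip : IsBipartition G X Y) where
  open IsBipartition bip

  col : Fin n → Bool
  col v = does (v ∈ˢ? X)

  in-Y : ∀ {v} → v ∈ˢ V G → v ∉ˢ X → v ∈ˢ Y
  in-Y h v∉ = [ (λ q → ⊥-elim (v∉ q)) , (λ q → q) ]′ (x∈p∪q⁻ X Y (subst (_ ∈ˢ_) (sym cover) h))

  colA : ∀ {x y} → Adj G x y → col y ≡ not (col x)
  colA {x} {y} a with x ∈ˢ? X | y ∈ˢ? X
  ... | yes p | yes q = ⊥-elim (independentˡ p q a)
  ... | yes _ | no _ = refl
  ... | no _ | yes _ = refl
  ... | no p | no q = ⊥-elim (independentʳ (in-Y (adj⇒∈V G a) p) (in-Y (adj⇒∈V G (symm G a)) q) a)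

  col-true : ∀ {v} → col v ≡ true → v ∈ˢ X
  col-true {v} e with v ∈ˢ? X
  ... | yes p = p

  col-false : ∀ {v} → col v ≡ false → v ∉ˢ X
  col-false {v} e with v ∈ˢ? X
  ... | no p = p

module Image {m n : ℕ} (T : Graph m) (G : Graph n) (F : Fin m → Fin n)
  (hom : ∀ a b → Adj T a b → Adj G (F a) (F b))
  (F∈ : ∀ a → a ∈ˢ V T → F a ∈ˢ V G)
  (inj : ∀ a b → a ∈ˢ V T → b ∈ˢ V T → F a ≡ F b → a ≡ b)
  (I : Subset n) (I-to : ∀ {v} → v ∈ˢ I → ∃[ a ] a ∈ˢ V T × F a ≡ v) (I-from : ∀ {a} → a ∈ˢ V T → F a ∈ˢ I)
  where

  image : Graph n
  image = record
    { V        = I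
    ; Adj      = λ u v → ∃₂ λ a b → Adj T a b × F a ≡ u × F b ≡ v
    ; adj?     = λ u v → any? λ a → any? λ b → adj? T a b ×-dec (F a ≟F u) ×-dec (F b ≟F v)
    ; symm     = λ (a , b , e , p , q) → b , a , symm T e , q , p
    ; loopless = λ { u≡v (a , b , e , p , q) → loopless G (trans p (trans u≡v (sym q))) (hom a b e) }
    ; adj⇒∈V   = λ { (a , b , e , refl , _) → I-from (adj⇒∈V T e) }
    }

  pre : ∀ {v} → v ∈ˢ I → Fin m
  pre h = proj₁ (I-to h)

  pre∈ : ∀ {v} (h : v ∈ˢ I) → pre h ∈ˢ V T
  pre∈ h = proj₁ (proj₂ (I-to h))

  F-pre : ∀ {v} (h : v ∈ˢ I) → F (pre h) ≡ v
  F-pre h = proj₂ (proj₂ (I-to h))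

  pre-unique : ∀ {v a} (h : v ∈ˢ I) → a ∈ˢ V T → F a ≡ v → pre h ≡ a
  pre-unique h a∈ e = inj _ _ (pre∈ h) a∈ (trans (F-pre h) (sym e))

  adj-pre : ∀ {u v} (p : u ∈ˢ I) (q : v ∈ˢ I) → Adj image u v → Adj T (pre p) (pre q)
  adj-pre p q (a , b , e , refl , refl) = subst₂ (Adj T) (sym (pre-unique p (adj⇒∈V T e) refl))
    (sym (pre-unique q (adj⇒∈V T (symm T e)) refl)) e

  subgraph : image IsSubgraphOf G
  subgraph = (λ h → subst (_∈ˢ V G) (F-pre h) (F∈ _ (pre∈ h))) , λ { (a , b , e , refl , refl) → hom a b e }

  vertex-≡ : ∀ {k} {K : Graph k} {u v : Vertex K} → proj₁ u ≡ proj₁ v → u ≡ v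
  vertex-≡ {u = _ , p} {_ , q} refl = cong (_ ,_) (∈ˢ-irrelevant p q)

  iso : T ≅ image
  iso = record
    { bijection = mk↔ₛ′ (λ (a , a∈) → F a , I-from a∈) (λ (v , v∈) → pre v∈ , pre∈ v∈)
        (λ (v , v∈) → vertex-≡ {K = image} (F-pre v∈)) (λ (a , a∈) → vertex-≡ {K = T} (pre-unique (I-from a∈) a∈ refl))
    ; adj⇔ = λ (a , a∈) (b , b∈) → mk⇔ (λ e → a , b , e , refl , refl)
        (λ (a' , b' , e , p , q) → subst₂ (Adj T) (inj _ _ (adj⇒∈V T e) a∈ p) (inj _ _ (adj⇒∈V T (symm T e)) b∈ q) e) }

  star : ∀ {a b} → Star (Adj T) a b → Star (Adj image) (F a) (F b)
  star ε = ε
  star (e ◅ s) = (_ , _ , e , refl , refl) ◅ star s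

  degree-≤ : ∀ {v} (h : v ∈ˢ I) → degree image v ≤ degree T (pre h)
  degree-≤ {v} h = ≤-trans (≤-reflexive (degree-nbrs image v)) (≤-trans (unique-⊆-length (nbrs-unique image v) sub)
    (≤-reflexive (trans (length-map F (nbrs T (pre h))) (sym (degree-nbrs T (pre h))))))
    where
    sub : ∀ {w} → w ∈ nbrs image v → w ∈ map F (nbrs T (pre h))
    sub {w} q with nbrs-adj image {v} {w} q
    ... | a , b , e , p , refl = ∈-map⁺ F (∈-nbrs T (subst (λ x → Adj T x b) (sym (pre-unique h (adj⇒∈V T e) p)) e))

  spider : IsSpider T → IsSpider image
  spider (((( v , v∈) , conn) , acyclic) , legs) =
    (((F v , I-from v∈) , λ {u} {w} p q → subst₂ (Star (Adj image)) (F-pre p) (F-pre q) (star (conn (pre∈ p) (pre∈ q)))) ,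
      λ C → let open Cycle C
                in-I : ∀ i → vertex i ∈ˢ I
                in-I i = on-cycle C i
            in acyclic record
      { k = k ; vertex = λ i → pre (in-I i)
      ; injective = λ {i} {j} e → injective (trans (sym (F-pre (in-I i))) (trans (cong F e) (F-pre (in-I j))))
      ; step = λ i → adj-pre (in-I _) (in-I _) (step i)
      ; close = adj-pre (in-I _) (in-I _) close }) ,
    λ p q h h' → trans (sym (F-pre p)) (trans (cong F (legs (pre∈ p) (pre∈ q)
      (≤-trans h (degree-≤ p)) (≤-trans h' (degree-≤ q)))) (F-pre q))
    where
    on-cycle : (C : Cycle image) → ∀ i → Cycle.vertex C i ∈ˢ I
    on-cycle C zero = adj⇒∈V image (Cycle.step C zero)
    on-cycle C (suc i) = adj⇒∈V image (symm image (Cycle.step C i))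

module _ {m n : ℕ} where

  -- The value outside the first list is the default d.
  assign : Fin n → List (Fin m) → List (Fin n) → Fin m → Fin n
  assign d (a ∷ A) (b ∷ B) v with v ≟F a
  ... | yes _ = b
  ... | no _ = assign d A B v
  assign d _ _ _ = d

  assign-map : ∀ d {A B} → Unique A → length A ≡ length B → map (assign d A B) A ≡ B
  assign-map d {[]} {[]} u e = refl
  assign-map d {a ∷ A} {b ∷ B} u e = cong₂ _∷_ head
      (trans (tail A λ q → unique-∉ u q) (assign-map d (unique-tail u) (suc-injective e)))
    where
    head : assign d (a ∷ A) (b ∷ B) a ≡ b
    head with a ≟F a
    ... | yes _ = refl
    ... | no ne = ⊥-elim (ne refl)
    tail : ∀ C → a ∉ C → map (assign d (a ∷ A) (b ∷ B)) C ≡ map (assign d A B) C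
    tail [] _ = refl
    tail (c ∷ C) a∉ with c ≟F a
    ... | yes refl = ⊥-elim (a∉ (here refl))
    ... | no _ = cong (_ ∷_) (tail C (a∉ ∘ there))

  ++-split : ∀ (A C : List (Fin n)) {B D} → length A ≡ length C → A ++ B ≡ C ++ D → A ≡ C × B ≡ D
  ++-split [] [] e h = refl , h
  ++-split (a ∷ A) (c ∷ C) e h with ∷-injective h
  ... | refl , h' with ++-split A C (suc-injective e) h'
  ...   | p , r = cong (a ∷_) p , r

  map-concatF : ∀ (F : Fin m → Fin n) q {f : Fin q → List (Fin m)} {g : Fin q → List (Fin n)} →
    (∀ j → length (f j) ≡ length (g j)) → map F (concatF q f) ≡ concatF q g → ∀ j → map F (f j) ≡ g j
  map-concatF F (suc q) {f} {g} e h j with ++-split (map F (f zero)) (g zero) (trans (length-map F (f zero)) (e zero))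
      (trans (sym (map-++ F (f zero) _)) h)
  map-concatF F (suc q) e h zero | p , r = p
  map-concatF F (suc q) e h (suc j) | p , r = map-concatF F q (e ∘ suc) r j

  length-concatF-≡ : ∀ q {f : Fin q → List (Fin m)} {g : Fin q → List (Fin n)} →
    (∀ j → length (f j) ≡ length (g j)) → length (concatF q f) ≡ length (concatF q g)
  length-concatF-≡ zero e = refl
  length-concatF-≡ (suc q) {f} {g} e = trans (length-++ (f zero))
    (trans (cong₂ _+_ (e zero) (length-concatF-≡ q (e ∘ suc))) (sym (length-++ (g zero))))

  map-unique-inj : ∀ (F : Fin m → Fin n) {L} → Unique (map F L) → ∀ {a b} → a ∈ L → b ∈ L → F a ≡ F b → a ≡ b
  map-unique-inj F u (here refl) (here refl) e = refl
  map-unique-inj F {_ ∷ L} u (here refl) (there q) e = ⊥-elim (unique-∉ u (subst (_∈ map F L) (sym e) (∈-map⁺ F q)))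
  map-unique-inj F {_ ∷ L} u (there p) (here refl) e = ⊥-elim (unique-∉ u (subst (_∈ map F L) e (∈-map⁺ F p)))
  map-unique-inj F u (there p) (there q) e = map-unique-inj F (unique-tail u) p q e

-- Assembling the theorem

module Main {m n : ℕ} (T : Graph m) {X Y : Subset m} (isSpider : IsSpider T) (bipT : IsBipartition T X Y)
  (G : Graph n) (κ : KConnected 3 G) {X' Y' : Subset n} (bipG : IsBipartition G X' Y')
  {d : ℕ} (isMin : IsMinDegree G d) (d≥ : d ≥ (∣ X ∣ ⊔ ∣ Y ∣) + 3) where

  module BT = Bipartitioned bipT
  module BG = Bipartitioned bipG
  open Decompose T isSpider

  bound : ℕ
  bound = ∣ X ∣ ⊔ ∣ Y ∣

  Vs : List (Fin n)
  Vs = filter (_∈ˢ? V G) (allFin n)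

  to-Vs : ∀ {v} → v ∈ˢ V G → v ∈ Vs
  to-Vs {v} h = filter-∈ (_∈ˢ? V G) (∈-allFin v) h

  from-Vs : ∀ {v} → v ∈ Vs → v ∈ˢ V G
  from-Vs h = proj₂ (filter-∈⁻ (_∈ˢ? V G) (allFin n) h)

  no-small-cut : ∀ S → S ⊆ˢ V G → ∣ S ∣ ≤ 2 → ¬ Disconnected (G ∖ S)
  no-small-cut S S⊆ h dis = let (c , (_ , mn) , 3≤c) = κ in
    <⇒≱ 3≤c (≤-trans (mn ∣ S ∣ (S , S⊆ , refl , inj₁ dis)) h)

  connected : ∀ x y {u v} → u ∈ Vs → u ≢ x → u ≢ y → v ∈ Vs → v ≢ x → v ≢ y →
    NN (Paths.Walk (Adj G) (λ z → z ∈ Vs × z ≢ x × z ≢ y) u v)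
  connected x y {u} {v} u∈ ux uy v∈ vx vy none = no-small-cut S
      (λ h → proj₂ (x∈p∩q⁻ (⁅ x ⁆ ∪ ⁅ y ⁆) (V G) h))
      (∣∣-≤ S {x ∷ y ∷ []} λ h → case in-S h of λ { (inj₁ e) → here e ; (inj₂ e) → there (here e) })
      (u , v , place u∈ ux uy , place v∈ vx vy , λ s → none (walk s (u∈ , ux , uy)))
    where
    -- A separator has to consist of vertices of `G`, while `x` and `y` are arbitrary.
    S = (⁅ x ⁆ ∪ ⁅ y ⁆) ∩ V G
    in-S : ∀ {w} → w ∈ˢ S → w ≡ x ⊎ w ≡ y
    in-S h = case x∈p∪q⁻ ⁅ x ⁆ ⁅ y ⁆ (proj₁ (x∈p∩q⁻ (⁅ x ⁆ ∪ ⁅ y ⁆) (V G) h)) of λ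
      { (inj₁ r) → inj₁ (x∈⁅y⁆⇒x≡y x r) ; (inj₂ r) → inj₂ (x∈⁅y⁆⇒x≡y y r) }
    place : ∀ {w} → w ∈ Vs → w ≢ x → w ≢ y → w ∈ˢ V G ─ S
    place w∈ wx wy = ∈-─ (from-Vs w∈) λ h → [ wx , wy ]′ (in-S h)
    walk : ∀ {u} → Star (Adj (G ∖ S)) u v → u ∈ Vs × u ≢ x × u ≢ y →
      Paths.Walk (Adj G) (λ z → z ∈ Vs × z ≢ x × z ≢ y) u v
    walk ε h = Paths.stop h
    walk ((a , _ , w∉) ◅ s) h = Paths.step h a (walk s (to-Vs w∈ ,
        (λ { refl → w∉ (x∈p∩q⁺ (x∈p∪q⁺ (inj₁ (x∈⁅x⁆ x)) , w∈)) }) ,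
        (λ { refl → w∉ (x∈p∩q⁺ (x∈p∪q⁺ (inj₂ (x∈⁅x⁆ y)) , w∈)) })))
      where w∈ = adj⇒∈V G (symm G a)

  open Colour BG.col using (cc)

  cc-filter : ∀ b L → length (filter (λ v → BG.col v ≟B b) L) ≡ cc b L
  cc-filter b [] = refl
  cc-filter b (x ∷ L) with BG.col x | b
  ... | true | true = cong suc (cc-filter true L)
  ... | true | false = cc-filter false L
  ... | false | true = cc-filter true L
  ... | false | false = cong suc (cc-filter false L)

  free-nbr : ∀ {x} → x ∈ Vs → ∀ L → cc (not (BG.col x)) L ≤ 2 + bound → ∃[ y ] Adj G x y × y ∉ L
  free-nbr {x} x∈ L h with any? (λ y → adj? G x y ×-dec ¬? (y ∈? L))
  ... | yes r = r
  ... | no none = ⊥-elim (<⇒≱ (≤-trans (≤-reflexive (+-comm 3 bound)) (≤-trans d≥ (proj₂ isMin _ (x , from-Vs x∈ , refl))))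
        (≤-trans (≤-reflexive (degree-nbrs G x)) (≤-trans (unique-⊆-length (nbrs-unique G x) λ {y} q →
          let a = nbrs-adj G {x} {y} q in filter-∈ (λ v → BG.col v ≟B not (BG.col x))
            (case y ∈? L of λ { (yes r) → r ; (no r) → ⊥-elim (none (y , a , r)) }) (BG.colA a))
          (≤-trans (≤-reflexive (cc-filter _ L)) h))))

  record Embedding (F : Fin m → Fin n) (I : Subset n) : Set where
    field
      hom    : ∀ a b → Adj T a b → Adj G (F a) (F b)
      F∈     : ∀ a → a ∈ˢ V T → F a ∈ˢ V G
      inj    : ∀ a b → a ∈ˢ V T → b ∈ˢ V T → F a ≡ F b → a ≡ b
      robust : Robust (G ∖ I)

  range? : (F : Fin m → Fin n) → ∀ v → Dec (∃[ a ] a ∈ˢ V T × F a ≡ v)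
  range? F v = any? λ a → (a ∈ˢ? V T) ×-dec (F a ≟F v)

  range : (Fin m → Fin n) → Subset n
  range F = Vec.tabulate λ v → does (range? F v)

  range-to : ∀ F {v} → v ∈ˢ range F → ∃[ a ] a ∈ˢ V T × F a ≡ v
  range-to F {v} h with range? F v | trans (sym (Vec.lookup∘tabulate (λ v → does (range? F v)) v)) (Vec.[]=⇒lookup h)
  ... | yes r | _ = r
  ... | no _ | ()

  range-from : ∀ F {a} → a ∈ˢ V T → F a ∈ˢ range F
  range-from F {a} h = Vec.lookup⇒[]= (F a) (range F) (trans (Vec.lookup∘tabulate (λ v → does (range? F v)) (F a))
    (dec-true (range? F (F a)) (a , h , refl)))

  embedding? : ∀ F I → Dec (Embedding F I)
  embedding? F I = map′ (λ (a , b , c , e) → record { hom = a ; F∈ = b ; inj = c ; robust = e })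
    (λ E → let open Embedding E in hom , F∈ , inj , robust)
    ((all? λ a → all? λ b → adj? T a b →-dec adj? G (F a) (F b)) ×-dec
     (all? λ a → (a ∈ˢ? V T) →-dec (F a ∈ˢ? V G)) ×-dec
     (all? λ a → all? λ b → (a ∈ˢ? V T) →-dec ((b ∈ˢ? V T) →-dec ((F a ≟F F b) →-dec (a ≟F b)))) ×-dec
     robust? (G ∖ I))

  Goal : Set₁
  Goal = ∃[ T' ] T' IsSubgraphOf G × IsSpider T' × T ≅ T' × KConnected 3 (G ∖ V T')

  conclude : ∀ {F} → Embedding F (range F) → Goal
  conclude {F} E = image , subgraph , spider isSpider , iso , robust⇒3-connected (G ∖ range F) robust
    where
    open Embedding E
    open Image T G F hom F∈ inj (range F) (range-to F) (range-from F)

  module _ (D : Decomposition) where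
    open Decomposition D
    open Skeleton skeleton

    shape : Fin q → ℕ
    shape j = length (leg j)

    -- The two parts of `T` give the counts for one colour of the centre. Exchanging the colours
    -- gives the other, so each count must be bounded by the larger part.
    shape-cap : ∀ a b → shapeCount q shape a b ≤ bound
    shape-cap a b = case twoCol a (BT.col c) of λ
        { (inj₁ refl) → at-centre b
        ; (inj₂ refl) → ≤-trans (≤-reflexive (trans (cong (shapeCount q shape (not (BT.col c))) (sym (not-not b)))
            (shapeCount-flip q shape (BT.col c) (not b)))) (at-centre (not b)) }
      where
      inV′ : ∀ {x} → x ∈ c ∷ concatF q leg → x ∈ˢ V T
      inV′ (here refl) = c∈V
      inV′ (there h) = let (j , r) = ∈-concatF⁻ q h in inV j r
      count : ∀ b → Colour.cc BT.col b (c ∷ concatF q leg) ≡ shapeCount q shape (BT.col c) b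
      count b = cong (δ (BT.col c) b +_) (trans (Colour.cc-concatF BT.col b q leg)
        (sumF-cong q λ j → Proper.linked-cc (Adj T) BT.col BT.colA b (linked j)))
      at-centre : ∀ b → shapeCount q shape (BT.col c) b ≤ bound
      at-centre true = ≤-trans (≤-reflexive (sym (count true)))
        (≤-trans (cc-≤∣∣ BT.col true all-unique λ _ e → BT.col-true e) (m≤m⊔n ∣ X ∣ ∣ Y ∣))
      at-centre false = ≤-trans (≤-reflexive (sym (count false)))
        (≤-trans (cc-≤∣∣ BT.col false all-unique λ h e → BT.in-Y (inV′ h) (BT.col-false e)) (m≤n⊔m ∣ X ∣ ∣ Y ∣))

    host : Host n q
    host = record
      { Adj = Adj G ; adj? = adj? G ; symA = symm G ; Vs = Vs ; adjV = λ a → to-Vs (adj⇒∈V G a)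
      ; col = BG.col ; colA = BG.colA ; t = bound ; ls = shape ; ls>0 = nonempty ; cap = shape-cap
      ; deg = free-nbr ; conn = connected }

    module H = Host host

    module FromCopy (gc : Final.GoodCopy host) where
      open Final.GoodCopy gc renaming (leg to leg'; linked to joined; spider to copy)
      module S = H.Spider copy

      F : Fin m → Fin n
      F = assign z (c ∷ concatF q leg) (z ∷ concatF q leg')

      len : ∀ j → length (leg j) ≡ length (leg' j)
      len j = sym (S.len j)

      F-all : map F (c ∷ concatF q leg) ≡ z ∷ concatF q leg'
      F-all = assign-map z all-unique (cong suc (length-concatF-≡ q len))

      F-c : F c ≡ z
      F-c = proj₁ (∷-injective F-all)

      F-leg : ∀ j → map F (leg j) ≡ leg' j
      F-leg = map-concatF F q len (proj₂ (∷-injective F-all))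

      consec-adj : ∀ {a b} → Consec c leg a b → Adj G (F a) (F b)
      consec-adj {a} {b} (j , A , E , eq) = edge (map F A) (trans (sym (cong₂ _∷_ F-c (F-leg j)))
          (trans (cong (map F) eq) (map-++ F A (a ∷ b ∷ E)))) (S.linked j)
        where
        edge : ∀ A {z L x y E} → z ∷ L ≡ A ++ x ∷ y ∷ E → H.Linked z L → Adj G x y
        edge [] refl (a Paths.∷ _) = a
        edge (_ ∷ []) refl (_ Paths.∷ (a Paths.∷ _)) = a
        edge (_ ∷ b ∷ A) refl (_ Paths.∷ l) = edge (b ∷ A) refl l

      hom : ∀ a b → Adj T a b → Adj G (F a) (F b)
      hom a b e = case adj? G (F a) (F b) of λ
        { (yes r) → r
        ; (no ¬r) → ⊥-elim (consec e λ { (inj₁ s) → ¬r (consec-adj s) ; (inj₂ s) → ¬r (symm G (consec-adj s)) }) }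

      F-vs : ∀ {a} → a ∈ˢ V T → F a ∈ H.vs z leg'
      F-vs {a} h = subst (F a ∈_) F-all (∈-map⁺ F (cover h))

      vs-F : ∀ {v} → v ∈ H.vs z leg' → ∃[ a ] a ∈ˢ V T × F a ≡ v
      vs-F {v} h with ∈-map⁻ F (subst (v ∈_) (sym F-all) h)
      ... | a , here refl , e = a , c∈V , sym e
      ... | a , there r , e = let (j , s) = ∈-concatF⁻ q r in a , inV j s , sym e

      robust : ∀ I → (∀ {v} → v ∈ˢ I → v ∈ H.vs z leg') → (∀ {v} → v ∈ H.vs z leg' → v ∈ˢ I) → Robust (G ∖ I)
      robust I to from = (let (u , out , _) = big z z z in u , place out) , λ
          { (S , h , S⊆ , inj₁ (u , v , u∈ , v∈ , ¬s)) →
              -- `w` fills up a separator with fewer than two elements; it differs from `u` and `v`,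
              -- so these survive the deletion of `x` and `y`.
              let (w , _ , wu , wv , _) = big u v v
                  (x , y , cov , x∈ , y∈) = cover-by-two S h w
                  avoid = λ {w'} {e} (k : w' ∉ˢ S) (ne : w ≢ w') (r : e ∈ˢ S ⊎ e ≡ w) → avoids {S} k ne r
              in joined x y (outside S u∈) (avoid (off S u∈) wu x∈) (avoid (off S u∈) wu y∈)
                            (outside S v∈) (avoid (off S v∈) wv x∈) (avoid (off S v∈) wv y∈)
                   λ p → ¬s (star S cov p)
          ; (S , h , S⊆ , inj₂ one) →
              let (x , y , cov , _) = cover-by-two S h z
                  (u₁ , o₁ , x₁ , y₁ , _) = big x y y
                  (u₂ , o₂ , x₂ , y₂ , ne) = big x y u₁
              in <⇒≱ ≤-refl (≤-trans (unique-≤∣∣ {L = u₁ ∷ u₂ ∷ []} {S = V ((G ∖ I) ∖ S)}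
                   (unique-∷ (λ { (here e) → ne (sym e) }) ([] ∷ []))
                   λ { (here refl) → place₂ S o₁ λ q → [ x₁ , y₁ ]′ (cov q)
                     ; (there (here refl)) → place₂ S o₂ λ q → [ x₂ , y₂ ]′ (cov q) }) (≤-reflexive one)) }
        where
        Out : Fin n → Set
        Out = Final.Outside host z leg'
        place : ∀ {v} → Out v → v ∈ˢ V (G ∖ I)
        place (v∈ , v∉) = ∈-─ (from-Vs v∈) λ q → v∉ (to q)
        place₂ : ∀ S {v} → Out v → v ∉ˢ S → v ∈ˢ V ((G ∖ I) ∖ S)
        place₂ S o v∉ = ∈-─ (place o) v∉
        off : ∀ S {v} → v ∈ˢ V ((G ∖ I) ∖ S) → v ∉ˢ S
        off S = ─-∉ (V (G ∖ I)) S
        outside : ∀ S {v} → v ∈ˢ V ((G ∖ I) ∖ S) → Out v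
        outside S h = let h' = p─q⊆p (V (G ∖ I)) S h in
          to-Vs (p─q⊆p (V G) I h') , λ q → ─-∉ (V G) I h' (from q)
        avoids : ∀ {S w w' e} → w' ∉ˢ S → w ≢ w' → e ∈ˢ S ⊎ e ≡ w → w' ≢ e
        avoids k ne (inj₁ r) refl = k r
        avoids k ne (inj₂ r) refl = ne (sym r)
        star : ∀ S {x y} → (∀ {w} → w ∈ˢ S → w ≡ x ⊎ w ≡ y) → ∀ {u v} →
          H.Walk (λ w → Out w × w ≢ x × w ≢ y) u v → Star (Adj ((G ∖ I) ∖ S)) u v
        star S cov (Paths.stop _) = ε
        star S cov (Paths.step ((_ , u∉) , ux , uy) a p) with H.walk-start p
        ... | (_ , v∉) , vx , vy = ((a , (λ q → u∉ (to q)) , (λ q → v∉ (to q))) ,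
                (λ q → [ ux , uy ]′ (cov q)) , (λ q → [ vx , vy ]′ (cov q))) ◅ star S cov p

      -- The map is tabulated because the search runs over the finitely many vectors and not over
      -- functions.
      embedding : ∃[ f ] Embedding (Vec.lookup f) (range (Vec.lookup f))
      embedding = f , record
        { hom = λ a b e → subst₂ (Adj G) (sym (F≡ a)) (sym (F≡ b)) (hom a b e)
        ; F∈ = λ a h → subst (_∈ˢ V G) (sym (F≡ a)) (from-Vs (S.in-Z (F-vs h)))
        ; inj = λ a b a∈ b∈ e → map-unique-inj F (subst Unique (sym F-all) S.vs-unique) (cover a∈) (cover b∈)
            (trans (sym (F≡ a)) (trans e (F≡ b)))
        ; robust = robust (range (Vec.lookup f))
            (λ h → let (a , a∈ , e) = range-to (Vec.lookup f) h in subst (_∈ H.vs z leg') (trans (sym (F≡ a)) e) (F-vs a∈))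
            (λ h → let (a , a∈ , e) = vs-F h in subst (_∈ˢ range (Vec.lookup f)) (trans (F≡ a) e) (range-from (Vec.lookup f) a∈)) }
        where
        f = Vec.tabulate F
        F≡ : ∀ a → Vec.lookup f a ≡ F a
        F≡ = Vec.lookup∘tabulate F

  theorem : Goal
  theorem = case anyVec? m (λ f → embedding? (Vec.lookup f) (range (Vec.lookup f))) of λ
    { (yes (f , E)) → conclude E
    ; (no none) → ⊥-elim (run (do
        D ← decompose
        let (v , v∈ , _) = proj₁ isMin
        gc ← Initial.exists-good-copy (host D) (to-Vs v∈)
        pure (none (FromCopy.embedding D gc)))) }

theorem4p2 : ∀ {m n} (T : Graph m) (X Y : Subset m) →
    IsSpider T → IsBipartition T X Y →
    (G : Graph n) → KConnected 3 G → Bipartite G →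
    (d : ℕ) → IsMinDegree G d → d ≥ (∣ X ∣ ⊔ ∣ Y ∣) + 3 →
    ∃[ T' ] T' IsSubgraphOf G × IsSpider T' × T ≅ T' × KConnected 3 (G ∖ V T')
theorem4p2 T X Y isSpider bipT G κ (_ , _ , bipG) d isMin d≥ =
  Main.theorem T isSpider bipT G κ bipG isMin d≥
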